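{- Let $(p,l_1)\in\Psi_1^{\rm irr}$. If $\Delta_{(p,l_1)}\neq 0$, then for each $n>1$ there exists exactly one irregular pair of order $n$ related to $(p,l_1)$. Thus there is a unique sequence $(l_n)_{n\ge 1}$ (starting with the given $l_1$), resp. a unique sequence $(s_n)_{n\geq 1}$ (with $s_1=l_1$), such that for all $n\ge1$ $$(p,l_n)\in\Psi_n^{\rm irr}\quad\text{resp.}\quad (p,s_1,\ldots,s_n)\in\widehat{\Psi}_n^{\rm irr},$$ where for $n>1$ the pair of order $n$ is related to $(p,l_1)$, and one has $$l_1\le l_2\le l_3\le\cdots,\qquad \lim_{n\to\infty}l_n=\infty .$$ Moreover $$\Delta_{(p,l_1)}=\Delta_{(p,l_2)}=\Delta_{(p,l_3)}=\cdots .$$ If $p$ is an irregular prime with $\Delta(p)=1$, then $i(p)=i_2(p)=i_3(p)=\cdots$.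
   Context: $B_n$ denotes the Bernoulli numbers, $\frac{z}{e^z-1}=\sum_{n\ge0}B_n\frac{z^n}{n!}$, and $\widehat{B}(n)=B_n/n$. $\varphi$ is Euler's totient function. For a rational $q$ and a positive integer $m$, $m\mid q$ (also written $q\equiv0\pmod m$) means that $m$ divides the numerator of $q$ in lowest terms. Congruences modulo powers of $p$ are between $p$-integral rationals. $p$ always denotes an odd prime. For $n\ge1$, $\Psi_n^{\rm irr}$ is the set of irregular pairs of order $n$: pairs $(p,l)$ with $p$ an odd prime, $l$ even, $2\le l<\varphi(p^n)$ and $p^n\mid\widehat{B}(l)$. Put $i_n(p)=\#\{(p,l)\in\Psi_n^{\rm irr}\}$ and $i(p)=i_1(p)$; $p$ is irregular if $i(p)>0$. For $n>m\ge1$, $(p,l_n)\in\Psi_n^{\rm irr}$ is related to $(p,l_m)\in\Psi_m^{\rm irr}$ if $l_n\equiv l_m\pmod{\varphi(p^m)}$. For $(p,l)\in\Psi_n^{\rm irr}$ (regarded as a pair of order $n$), $\Delta_{(p,l)}$ is the integer with $0\le\Delta_{(p,l)}<p$ and $\Delta_{(p,l)}\equiv p^{ -n}\left(\widehat{B}(l+\varphi(p^n))-\widehat{B}(l)\right)\pmod p$. In the chain of equalities, $\Delta_{(p,l_n)}$ is computed with $(p,l_n)$ regarded as a pair of order $n$. For an irregular prime $p$, $\Delta(p)=1$ if $\Delta_{(p,l)}\ne0$ for all $(p,l)\in\Psi_1^{\rm irr}$, and $\Delta(p)=0$ otherwise. $p$-adic notation: $\widehat{\Psi}_n^{\rm irr}$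 is the set of tuples $(p,s_1,\ldots,s_n)$ with $0\le s_\nu<p$, $s_1$ even, $2\le s_1\le p-3$, such that $(p,l)\in\Psi_n^{\rm irr}$ for $l=\sum_{\nu=1}^n s_\nu\,\varphi(p^{\nu-1})$. The tuple is called related to $(p,l_1)$ if the pair $(p,l)$ is. -}

module Defs where

open import Data.Bool.Base using (if_then_else_)
open import Data.Empty using (⊥)
open import Data.Fin.Base using (Fin; zero; suc; toℕ)
open import Data.Integer.Base using (+_; ∣_∣)
open import Data.List.Base using (List; applyUpTo; filter; find; length; upTo)
open import Data.List.Relation.Unary.All using (all?)
open import Data.Maybe.Base using (fromMaybe)
open import Data.Nat.Base
  using (ℕ; zero; suc; _+_; _*_; _∸_; _^_; _!; _≤_; _<_; ∣_-_∣; NonZero)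
open import Data.Nat.Coprimality using (coprime?)
open import Data.Nat.Divisibility using (_∣_; _∣?_)
open import Data.Nat.Primality using (Prime; prime?)
open import Data.Nat.Properties using (_≟_; _≤?_; _<?_; _!≢0; +-0-monoid)
open import Data.Product.Base using (_×_; _,_; ∃)
open import Data.Rational.Base as ℚ using (ℚ; 0ℚ; 1ℚ; ↥_; ↧ₙ_; _/_)
import Data.Rational.Properties as ℚ
import Data.Rational.Unnormalised.Base as ℚᵘ
open import Data.Vec.Base using (Vec; _∷_; []; head; lookup)
open import Data.Vec.Functional using (Vector)
open import Relation.Binary.PropositionalEquality
  using (_≡_; refl; sym; trans; cong; cong₂; module ≡-Reasoning)
open import Relation.Nullary.Decidable using (Dec; does; ¬?; _×-dec_)
open import Relation.Nullary.Negation using (¬_)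
open import Relation.Unary using (Pred; Decidable; _∈_)
open import Level using (0ℓ)

import Algebra.Properties.Monoid.Sum +-0-monoid as ℕSum
import Algebra.Properties.Monoid.Sum ℚ.+-0-monoid as ℚSum

-- recip 0 = 0 is a junk value: below, the argument is always nonzero wherever
-- the result matters.
recip : ℕ → ℚ
recip zero    = 0ℚ
recip (suc n) = + 1 / suc n

fromℕ : ℕ → ℚ
fromℕ n = + n / 1

------------------------------------------------------------------------
-- Formal power series over ℚ and Bernoulli numbers

PowerSeries : Set
PowerSeries = ℕ → ℚ

infixl 7 _⊛_

_⊛_ : PowerSeries → PowerSeries → PowerSeries
(f ⊛ g) n = ℚSum.sum {suc n} λ i → f (toℕ i) ℚ.* g (n ∸ toℕ i)

egf : (ℕ → ℚ) → PowerSeries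
egf a n = a n ℚ.* recip (n !)

-- e^z - 1
expMinusOne : PowerSeries
expMinusOne zero    = 0ℚ
expMinusOne (suc n) = recip (suc n !)

-- z
Z : PowerSeries
Z 1 = 1ℚ
Z _ = 0ℚ

-- The coefficients c₀, …, cₙ of z / (e^z - 1), highest index first.  Comparing
-- coefficients of z^(n+2) in (e^z - 1) · Σ cₖ z^k = z gives
-- c₍ₙ₊₁₎ = - Σ_{j ≤ n} c₍ₙ₋ⱼ₎ / (j+2)!.
coeffs : (n : ℕ) → Vec ℚ (suc n)
coeffs zero    = 1ℚ ∷ []
coeffs (suc n) =
  ℚ.- ℚSum.sum (λ j → recip ((2 + toℕ j) !) ℚ.* lookup cs j) ∷ cs
  where cs = coeffs n

-- Bₙ = n! cₙ; bernoulli-egf below is the defining generating function identity.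
bernoulli : ℕ → ℚ
bernoulli n = fromℕ (n !) ℚ.* head (coeffs n)

private

  fromℕ*recip : ∀ n .{{_ : NonZero n}} → fromℕ n ℚ.* recip n ≡ 1ℚ
  fromℕ*recip n@(suc m) = ℚ.toℚᵘ-injective (begin
    ℚ.toℚᵘ (fromℕ n ℚ.* recip n)                     ≈⟨ ℚ.toℚᵘ-homo-* (fromℕ n) (recip n) ⟩
    ℚ.toℚᵘ (fromℕ n) ℚᵘ.* ℚ.toℚᵘ (recip n)           ≈⟨ ℚᵘ.*-cong (ℚ.toℚᵘ-fromℚᵘ (ℚᵘ.mkℚᵘ (+ n) 0)) (ℚ.toℚᵘ-fromℚᵘ (ℚᵘ.mkℚᵘ (+ 1) m)) ⟩
    ℚᵘ.mkℚᵘ (+ n) 0 ℚᵘ.* ℚᵘ.1/ (ℚᵘ.mkℚᵘ (+ n) 0)     ≈⟨ ℚᵘ.*-inverseʳ (ℚᵘ.mkℚᵘ (+ n) 0) ⟩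
    ℚᵘ.1ℚᵘ                                           ∎)
    where
    import Data.Rational.Unnormalised.Properties as ℚᵘ
    open ℚᵘ.≃-Reasoning

  egf-bernoulli : ∀ n → egf bernoulli n ≡ head (coeffs n)
  egf-bernoulli n = begin
    fromℕ (n !) ℚ.* c ℚ.* recip (n !)    ≡⟨ cong (ℚ._* recip (n !)) (ℚ.*-comm (fromℕ (n !)) c) ⟩
    c ℚ.* fromℕ (n !) ℚ.* recip (n !)    ≡⟨ ℚ.*-assoc c (fromℕ (n !)) (recip (n !)) ⟩
    c ℚ.* (fromℕ (n !) ℚ.* recip (n !))  ≡⟨ cong (c ℚ.*_) (fromℕ*recip (n !) {{n !≢0}}) ⟩
    c ℚ.* 1ℚ                             ≡⟨ ℚ.*-identityʳ c ⟩
    c                                    ∎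
    where
    open ≡-Reasoning
    c = head (coeffs n)

  lookup-coeffs : ∀ n (j : Fin (suc n)) → lookup (coeffs n) j ≡ head (coeffs (n ∸ toℕ j))
  lookup-coeffs zero    zero    = refl
  lookup-coeffs (suc n) zero    = refl
  lookup-coeffs (suc n) (suc j) = lookup-coeffs n j

bernoulli-egf : ∀ n → (expMinusOne ⊛ egf bernoulli) n ≡ Z n
bernoulli-egf zero    = trans (ℚ.+-identityʳ _) (ℚ.*-zeroˡ (egf bernoulli 0))
bernoulli-egf (suc n) = begin
  0ℚ ℚ.* egf bernoulli (suc n) ℚ.+ (1ℚ ℚ.* egf bernoulli n ℚ.+ rest n)
    ≡⟨ cong₂ ℚ._+_ (ℚ.*-zeroˡ (egf bernoulli (suc n)))
                   (cong (ℚ._+ rest n) (trans (ℚ.*-identityˡ _) (egf-bernoulli n))) ⟩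
  0ℚ ℚ.+ (head (coeffs n) ℚ.+ rest n)
    ≡⟨ ℚ.+-identityˡ _ ⟩
  head (coeffs n) ℚ.+ rest n
    ≡⟨ cancel n ⟩
  Z (suc n) ∎
  where
  open ≡-Reasoning
  rest : ℕ → ℚ
  rest n = ℚSum.sum {n} λ j → recip ((2 + toℕ j) !) ℚ.* egf bernoulli (n ∸ suc (toℕ j))
  cancel : ∀ n → head (coeffs n) ℚ.+ rest n ≡ Z (suc n)
  cancel zero    = refl
  cancel (suc n) = trans
    (cong (head (coeffs (suc n)) ℚ.+_) (ℚSum.sum-cong-≗ λ j →
      cong (recip ((2 + toℕ j) !) ℚ.*_)
           (trans (egf-bernoulli (n ∸ toℕ j)) (sym (lookup-coeffs n j)))))
    (ℚ.+-inverseˡ (ℚSum.sum λ j → recip ((2 + toℕ j) !) ℚ.* lookup (coeffs n) j))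

-- B̂(n) = Bₙ / n, used only for n ≥ 1.
B̂ : ℕ → ℚ
B̂ n = bernoulli n ℚ.* recip n

------------------------------------------------------------------------
-- Arithmetic

φ : ℕ → ℕ
φ n = length (filter (λ k → coprime? k n) (applyUpTo suc n))

OddPrime : Pred ℕ 0ℓ
OddPrime p = Prime p × ¬ 2 ∣ p

infix 4 _∣ℚ_ _∣ℚ?_

-- Elements of ℚ are stored in lowest terms, so ↥ q is the reduced numerator.
_∣ℚ_ : ℕ → ℚ → Set
m ∣ℚ q = m ∣ ∣ ↥ q ∣

_∣ℚ?_ : ∀ m q → Dec (m ∣ℚ q)
m ∣ℚ? q = m ∣? ∣ ↥ q ∣

_Integral_ : ℕ → ℚ → Set
p Integral q = ¬ p ∣ ↧ₙ q

-- q ≡ r (mod p) for p-integral rationals.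
Congruent : ℕ → ℚ → ℚ → Set
Congruent p q r = p Integral q × p Integral r × p ∣ℚ (q ℚ.- r)

congruent? : ∀ p q r → Dec (Congruent p q r)
congruent? p q r = ¬? (p ∣? ↧ₙ q) ×-dec ¬? (p ∣? ↧ₙ r) ×-dec (p ∣ℚ? (q ℚ.- r))

-- The d with 0 ≤ d < p and d ≡ q (mod p).  For p prime it exists and is unique
-- when q is p-integral; otherwise there is none and the value is 0.
residue : ℕ → ℚ → ℕ
residue p q = fromMaybe 0 (find (λ d → congruent? p (fromℕ d) q) (upTo p))

------------------------------------------------------------------------
-- Irregular pairs

Ψ : ℕ → Pred (ℕ × ℕ) 0ℓ
Ψ n (p , l) =
  OddPrime p × 2 ∣ l × 2 ≤ l × l < φ (p ^ n) × (p ^ n) ∣ℚ B̂ l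

Ψ? : ∀ n → Decidable (Ψ n)
Ψ? n (p , l) =
  (prime? p ×-dec ¬? (2 ∣? p)) ×-dec
  (2 ∣? l) ×-dec (2 ≤? l) ×-dec (l <? φ (p ^ n)) ×-dec ((p ^ n) ∣ℚ? B̂ l)

-- The l with (p , l) ∈ Ψ n, without repetition.
irregularIndices : ℕ → ℕ → List ℕ
irregularIndices n p = filter (λ l → Ψ? n (p , l)) (upTo (φ (p ^ n)))

i : ℕ → ℕ → ℕ
i n p = length (irregularIndices n p)

Irregular : Pred ℕ 0ℓ
Irregular p = OddPrime p × 0 < i 1 p

-- The congruence relating (p , l) of order n > m to (p , l′) of order m.
Related : (p m l l′ : ℕ) → Set
Related p m l l′ = φ (p ^ m) ∣ ∣ l - l′ ∣

-- Δ₍ₚ,ₗ₎ for (p , l) regarded as a pair of order n.  For (p , l) ∈ Ψ n the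
-- rational whose residue is taken is p-integral by Kummer's congruences.
Δ : (n p l : ℕ) → ℕ
Δ n p l = residue p (recip (p ^ n) ℚ.* (B̂ (l + φ (p ^ n)) ℚ.- B̂ l))

-- Δ(p), meaningful for irregular primes p.
Δₚ : ℕ → ℕ
Δₚ p = if does (all? (λ l → ¬? (Δ 1 p l ≟ 0)) (irregularIndices 1 p)) then 1 else 0

------------------------------------------------------------------------
-- p-adic notation

-- l = Σ_{ν=1}^n s_ν φ(p^(ν-1)); index i : Fin n stands for ν = i + 1.
fromDigits : ℕ → ∀ {n} → Vector ℕ n → ℕ
fromDigits p s = ℕSum.sum λ i → s i * φ (p ^ toℕ i)

Ψ̂ : ∀ n → Pred (ℕ × Vector ℕ n) 0ℓ
Ψ̂ zero    _       = ⊥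
Ψ̂ (suc n) (p , s) =
  (∀ ν → s ν < p) ×
  (2 ∣ s zero × 2 ≤ s zero × s zero ≤ p ∸ 3) ×
  (p , fromDigits p s) ∈ Ψ (suc n)

------------------------------------------------------------------------
-- Sequences indexed by n ≥ 1; the entry at 0 is disregarded.

infix 4 _≈_

_≈_ : (a b : ℕ → ℕ) → Set
a ≈ b = ∀ n → 1 ≤ n → a n ≡ b n

-- (s₁ , … , sₙ)
prefix : (ℕ → ℕ) → ∀ n → Vector ℕ n
prefix s n i = s (suc (toℕ i))

IrregularSeq : (p l₁ : ℕ) → Pred (ℕ → ℕ) 0ℓ
IrregularSeq p l₁ l =
  l 1 ≡ l₁ ×
  (∀ n → 1 ≤ n → (p , l n) ∈ Ψ n) ×
  (∀ n → 1 < n → Related p 1 (l n) l₁)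

IrregularDigits : (p l₁ : ℕ) → Pred (ℕ → ℕ) 0ℓ
IrregularDigits p l₁ s =
  s 1 ≡ l₁ ×
  (∀ n → 1 ≤ n → (p , prefix s n) ∈ Ψ̂ n) ×
  (∀ n → 1 < n → Related p 1 (fromDigits p (prefix s n)) l₁)

TendsToInfinity : Pred (ℕ → ℕ) 0ℓ
TendsToInfinity a = ∀ M → ∃ λ N → ∀ n → N ≤ n → M ≤ a n

{-# OPTIONS --safe #-}
-- Let p be an odd prime and c an integer prime to p.  The generating function of
-- (c^l − 1)(1 − p^{l−1}) B̂(l), l ≥ 1, is a rational function of x = e^z which
-- becomes an integral combination ρ of powers x^j with p ∤ j after multiplication
-- by 1 + y + ⋯ + y^{c−1}, where y = x^p.  Expanding the inverse of this factor in
-- powers of y − 1 shows that, for every bound M, the numbers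
-- c^M (c^l − 1)(1 − p^{l−1}) B̂(l) with l ≤ M are the moments Σ w_j j^{l−1} of one
-- finite measure with integral weights w_j supported on integers j prime to p.
-- For such j, Fermat's theorem gives j^{p−1} = 1 + p q, and
-- (1 + p q)^{p^k} ≡ 1 + p^{k+1} q (mod p^{k+2}); hence the moment A(t) at
-- l = l₁ + (p−1) t satisfies A(t + p^k) ≡ A(t) + p^{k+1} K (mod p^{k+2}) with K
-- independent of k and t.
--
-- Choosing c with c^{l₁} ≢ 1 (mod p) makes the factor in front of B̂(l) a p-adic
-- unit, so Δ is a unit multiple of K modulo p, whatever the order of the pair.  If
-- Δ ≠ 0, a solution t < p^k of p^{k+1} ∣ A(t) extends to exactly one solution
-- t + s p^k, s < p, of p^{k+2} ∣ A(t + s p^k).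
--
-- For c = p + 1 and (p−1) ∣ l the measure gives −1 modulo p, so p does not divide
-- B̂(l): the indices divisible by p − 1 are never irregular, and the case p = 3
-- shows B̂(l) ≠ 0 for all even l ≥ 2, which forces l_n → ∞.
--
-- Throughout, p′ stands for p − 1.
module Submission where

-- With respect to z^(l-1)/(l-1)!, the numbers B̂(l), l ≥ 1, have the generating function 1/(e^z -
-- 1) - 1/z. The factor c^l - 1 cancels the pole 1/z and leaves a rational function of e^z. The
-- factor 1 - p^(l-1) removes the exponents divisible by p, to which Fermat's theorem would not
-- apply, and it is 1 modulo p for l ≥ 2. The obstacle is that the inverse of 1 + y + ⋯ + y^(c-1) is
-- an infinite expansion in y - 1 with growing powers of c in the denominators. Truncating at M and
-- clearing denominators by c^M is harmless because p ∤ c, but the integers A and the slope K then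
-- depend on M. Divisibility of B̂(l) and Δ do not. Hence every comparison is made inside one model
-- whose bound exceeds all arguments involved, and information on K passes from one M to another
-- only through Δ. The multiplier c with c^(l₁) ≢ 1 is found by finite differences, in place of a
-- primitive root.

-- The integers inside the rationals.

module Embedding where

  open import Defs
  open import Data.Integer.Base as ℤ using (ℤ; +_)
  import Data.Integer.Properties as ℤ
  import Data.Integer.Tactic.RingSolver as ℤ
  open import Data.Nat.Base as ℕ using (ℕ; suc)
  import Data.Nat.Properties as ℕ
  open import Data.Rational.Base
  open import Data.Rational.Properties
  import Data.Rational.Unnormalised.Base as ℚᵘ
  import Data.Rational.Unnormalised.Properties as ℚᵘ
  open import Level using (0ℓ)
  open import Relation.Binary.PropositionalEquality
  open import Relation.Nullary.Decidable using (dec⇒maybe)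
  open import Tactic.RingSolver using (solve-∀)
  open import Tactic.RingSolver.Core.AlmostCommutativeRing
    using (AlmostCommutativeRing; fromCommutativeRing)

  ℚ-ring : AlmostCommutativeRing 0ℓ 0ℓ
  ℚ-ring = fromCommutativeRing +-*-commutativeRing λ x → dec⇒maybe (0ℚ ≟ x)

  ι : ℤ → ℚ
  ι z = z / 1

  private

    toℚᵘ-ι : ∀ z → toℚᵘ (ι z) ℚᵘ.≃ ℚᵘ.mkℚᵘ z 0
    toℚᵘ-ι z = toℚᵘ-fromℚᵘ (ℚᵘ.mkℚᵘ z 0)

  ι-+ : ∀ x y → ι (x ℤ.+ y) ≡ ι x + ι y
  ι-+ x y = toℚᵘ-injective (let open ℚᵘ.≃-Reasoning in begin
    toℚᵘ (ι (x ℤ.+ y))               ≈⟨ toℚᵘ-ι (x ℤ.+ y) ⟩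
    ℚᵘ.mkℚᵘ (x ℤ.+ y) 0              ≈⟨ ℚᵘ.*≡* (cong (ℤ._* + 1) (cong₂ ℤ._+_ (sym (ℤ.*-identityʳ x)) (sym (ℤ.*-identityʳ y)))) ⟩
    ℚᵘ.mkℚᵘ x 0 ℚᵘ.+ ℚᵘ.mkℚᵘ y 0     ≈⟨ ℚᵘ.+-cong (toℚᵘ-ι x) (toℚᵘ-ι y) ⟨
    toℚᵘ (ι x) ℚᵘ.+ toℚᵘ (ι y)       ≈⟨ toℚᵘ-homo-+ (ι x) (ι y) ⟨
    toℚᵘ (ι x + ι y)                 ∎)

  ι-* : ∀ x y → ι (x ℤ.* y) ≡ ι x * ι y
  ι-* x y = toℚᵘ-injective (let open ℚᵘ.≃-Reasoning in begin
    toℚᵘ (ι (x ℤ.* y))               ≈⟨ toℚᵘ-ι (x ℤ.* y) ⟩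
    ℚᵘ.mkℚᵘ x 0 ℚᵘ.* ℚᵘ.mkℚᵘ y 0     ≈⟨ ℚᵘ.*-cong (toℚᵘ-ι x) (toℚᵘ-ι y) ⟨
    toℚᵘ (ι x) ℚᵘ.* toℚᵘ (ι y)       ≈⟨ toℚᵘ-homo-* (ι x) (ι y) ⟨
    toℚᵘ (ι x * ι y)                 ∎)

  ι-neg : ∀ x → ι (ℤ.- x) ≡ - ι x
  ι-neg x = toℚᵘ-injective (let open ℚᵘ.≃-Reasoning in begin
    toℚᵘ (ι (ℤ.- x))    ≈⟨ toℚᵘ-ι (ℤ.- x) ⟩
    ℚᵘ.- ℚᵘ.mkℚᵘ x 0    ≈⟨ ℚᵘ.-‿cong (toℚᵘ-ι x) ⟨
    ℚᵘ.- toℚᵘ (ι x)     ≈⟨ toℚᵘ-homo‿- (ι x) ⟨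
    toℚᵘ (- ι x)        ∎)

  ι-injective : ∀ {x y} → ι x ≡ ι y → x ≡ y
  ι-injective {x} {y} eq with ℚᵘ.≃-trans (ℚᵘ.≃-trans (ℚᵘ.≃-sym (toℚᵘ-ι x)) (ℚᵘ.≃-reflexive (cong toℚᵘ eq))) (toℚᵘ-ι y)
  ... | ℚᵘ.*≡* eq′ = ℤ.*-cancelʳ-≡ x y (+ 1) eq′

  *ι↧ : ∀ q → q * ι (↧ q) ≡ ι (↥ q)
  *ι↧ q@record{} = toℚᵘ-injective (let open ℚᵘ.≃-Reasoning in begin
    toℚᵘ (q * ι (↧ q))                 ≈⟨ toℚᵘ-homo-* q (ι (↧ q)) ⟩
    toℚᵘ q ℚᵘ.* toℚᵘ (ι (↧ q))         ≈⟨ ℚᵘ.*-congˡ {toℚᵘ q} (toℚᵘ-ι (↧ q)) ⟩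
    toℚᵘ q ℚᵘ.* ℚᵘ.mkℚᵘ (↧ q) 0        ≈⟨ ℚᵘ.*≡* (trans (ℤ.*-identityʳ (↥ q ℤ.* ↧ q)) (cong (↥ q ℤ.*_) (trans (sym (ℤ.*-identityʳ (↧ q))) (ℤ.pos-* (↧ₙ q) 1)))) ⟩
    ℚᵘ.mkℚᵘ (↥ q) 0                    ≈⟨ toℚᵘ-ι (↥ q) ⟨
    toℚᵘ (ι (↥ q))                     ∎)

  -- Replaces an equation for a rational number by one between integers, where divisibility of the
  -- reduced numerator by powers of p can be decided with Euclid's lemma.
  cross-multiply : ∀ q u z → q * ι u ≡ ι z → ↥ q ℤ.* u ≡ z ℤ.* ↧ q
  cross-multiply q u z eq = ι-injective (let open ≡-Reasoning in begin
    ι (↥ q ℤ.* u)       ≡⟨ ι-* (↥ q) u ⟩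
    ι (↥ q) * ι u       ≡⟨ cong (_* ι u) (*ι↧ q) ⟨
    q * ι (↧ q) * ι u   ≡⟨ lemma q (ι (↧ q)) (ι u) ⟩
    q * ι u * ι (↧ q)   ≡⟨ cong (_* ι (↧ q)) eq ⟩
    ι z * ι (↧ q)       ≡⟨ ι-* z (↧ q) ⟨
    ι (z ℤ.* ↧ q)       ∎)
    where
    lemma : ∀ a b c → a * b * c ≡ a * c * b
    lemma = solve-∀ ℚ-ring

  fromℕ-+ : ∀ m n → fromℕ (m ℕ.+ n) ≡ fromℕ m + fromℕ n
  fromℕ-+ m n = ι-+ (+ m) (+ n)

  fromℕ-* : ∀ m n → fromℕ (m ℕ.* n) ≡ fromℕ m * fromℕ n
  fromℕ-* m n = trans (cong ι (ℤ.pos-* m n)) (ι-* (+ m) (+ n))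

  fromℕ-suc : ∀ n → fromℕ (suc n) ≡ 1ℚ + fromℕ n
  fromℕ-suc = fromℕ-+ 1

  ι-- : ∀ x y → ι (x ℤ.- y) ≡ ι x - ι y
  ι-- x y = trans (ι-+ x (ℤ.- y)) (cong (λ z → ι x + z) (ι-neg y))

  fromℕ*recip : ∀ n .{{_ : ℕ.NonZero n}} → fromℕ n * recip n ≡ 1ℚ
  fromℕ*recip n@(suc m) = toℚᵘ-injective (let open ℚᵘ.≃-Reasoning in begin
    toℚᵘ (fromℕ n * recip n)                          ≈⟨ toℚᵘ-homo-* (fromℕ n) (recip n) ⟩
    toℚᵘ (fromℕ n) ℚᵘ.* toℚᵘ (recip n)                ≈⟨ ℚᵘ.*-cong (toℚᵘ-ι (+ n)) (toℚᵘ-fromℚᵘ (ℚᵘ.mkℚᵘ (+ 1) m)) ⟩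
    ℚᵘ.mkℚᵘ (+ n) 0 ℚᵘ.* ℚᵘ.1/ (ℚᵘ.mkℚᵘ (+ n) 0)      ≈⟨ ℚᵘ.*-inverseʳ (ℚᵘ.mkℚᵘ (+ n) 0) ⟩
    ℚᵘ.1ℚᵘ                                            ∎)

  *-cancelʳ-fromℕ : ∀ n .{{_ : ℕ.NonZero n}} {x y} → x * fromℕ n ≡ y * fromℕ n → x ≡ y
  *-cancelʳ-fromℕ n {x} {y} eq = let open ≡-Reasoning in begin
    x                        ≡⟨ unit x ⟩
    x * fromℕ n * recip n    ≡⟨ cong (_* recip n) eq ⟩
    y * fromℕ n * recip n    ≡⟨ unit y ⟨
    y                        ∎
    where
    unit : ∀ x → x ≡ x * fromℕ n * recip n
    unit x = sym (trans (*-assoc x _ _) (trans (cong (x *_) (fromℕ*recip n)) (*-identityʳ x)))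

-- Exponential generating functions as sequences of coefficients.

module Sequences where

  open Embedding
  open import Defs
  open import Data.Nat.Base as ℕ using (ℕ; zero; suc; s≤s; s<s; _<_; _^_)
  import Data.Nat.Properties as ℕ
  open import Data.Rational.Base hiding (_<_)
  open import Data.Rational.Properties using (+-identityʳ; +-identityˡ; *-zeroˡ; *-zeroʳ; *-identityˡ; *-comm)
  open import Relation.Binary.PropositionalEquality
  open import Tactic.RingSolver using (solve-∀)
  open ≡-Reasoning

  Seq : Set
  Seq = ℕ → ℚ

  ∑ : ℕ → Seq → ℚ
  ∑ zero    f = 0ℚ
  ∑ (suc n) f = ∑ n f + f n

  ∑-cong : ∀ n {f g : Seq} → (∀ i → i < n → f i ≡ g i) → ∑ n f ≡ ∑ n g
  ∑-cong zero    eq = refl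
  ∑-cong (suc n) eq = cong₂ _+_ (∑-cong n λ i i<n → eq i (ℕ.m<n⇒m<1+n i<n)) (eq n ℕ.≤-refl)

  ∑-+ : ∀ n (f g : Seq) → ∑ n (λ i → f i + g i) ≡ ∑ n f + ∑ n g
  ∑-+ zero    f g = refl
  ∑-+ (suc n) f g = trans (cong (_+ (f n + g n)) (∑-+ n f g)) (lemma (∑ n f) (∑ n g) (f n) (g n))
    where
    lemma : ∀ a b c d → a + b + (c + d) ≡ a + c + (b + d)
    lemma = solve-∀ ℚ-ring

  ∑-* : ∀ n c (f : Seq) → ∑ n (λ i → c * f i) ≡ c * ∑ n f
  ∑-* zero    c f = sym (*-zeroʳ c)
  ∑-* (suc n) c f = trans (cong (_+ c * f n) (∑-* n c f)) (lemma c (∑ n f) (f n))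
    where
    lemma : ∀ a b c → a * b + a * c ≡ a * (b + c)
    lemma = solve-∀ ℚ-ring

  ∑-- : ∀ n (f g : Seq) → ∑ n (λ i → f i - g i) ≡ ∑ n f - ∑ n g
  ∑-- zero    f g = refl
  ∑-- (suc n) f g = trans (cong (_+ (f n - g n)) (∑-- n f g)) (lemma (∑ n f) (∑ n g) (f n) (g n))
    where
    lemma : ∀ a b c d → a - b + (c - d) ≡ a + c - (b + d)
    lemma = solve-∀ ℚ-ring

  ∑-const : ∀ m x → ∑ m (λ _ → x) ≡ fromℕ m * x
  ∑-const zero    x = sym (*-zeroˡ x)
  ∑-const (suc m) x = trans (cong (_+ x) (∑-const m x)) (trans (lemma (fromℕ m) x) (cong (_* x) (sym (fromℕ-suc m))))
    where
    lemma : ∀ m x → m * x + x ≡ (1ℚ + m) * x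
    lemma = solve-∀ ℚ-ring

  ∑-zero : ∀ n → ∑ n (λ _ → 0ℚ) ≡ 0ℚ
  ∑-zero zero    = refl
  ∑-zero (suc n) = trans (+-identityʳ _) (∑-zero n)

  ∑-front : ∀ n (f : Seq) → ∑ (suc n) f ≡ f 0 + ∑ n (λ i → f (suc i))
  ∑-front zero    f = trans (+-identityˡ (f 0)) (sym (+-identityʳ (f 0)))
  ∑-front (suc n) f = trans (cong (_+ f (suc n)) (∑-front n f)) (lemma (f 0) (∑ n (λ i → f (suc i))) (f (suc n)))
    where
    lemma : ∀ a b c → a + b + c ≡ a + (b + c)
    lemma = solve-∀ ℚ-ring

  ∑-append : ∀ m n (f : Seq) → ∑ (m ℕ.+ n) f ≡ ∑ m f + ∑ n (λ i → f (m ℕ.+ i))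
  ∑-append m zero    f = trans (cong (λ k → ∑ k f) (ℕ.+-identityʳ m)) (sym (+-identityʳ (∑ m f)))
  ∑-append m (suc n) f = begin
    ∑ (m ℕ.+ suc n) f                                     ≡⟨ cong (λ k → ∑ k f) (ℕ.+-suc m n) ⟩
    ∑ (m ℕ.+ n) f + f (m ℕ.+ n)                           ≡⟨ cong (_+ f (m ℕ.+ n)) (∑-append m n f) ⟩
    ∑ m f + ∑ n (λ i → f (m ℕ.+ i)) + f (m ℕ.+ n)         ≡⟨ lemma (∑ m f) (∑ n (λ i → f (m ℕ.+ i))) (f (m ℕ.+ n)) ⟩
    ∑ m f + (∑ n (λ i → f (m ℕ.+ i)) + f (m ℕ.+ n))       ∎
    where
    lemma : ∀ a b c → a + b + c ≡ a + (b + c)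
    lemma = solve-∀ ℚ-ring

  -- Sorts the numbers below c p by their residue j modulo p.
  ∑-blocks : ∀ c p (f : Seq) → ∑ (c ℕ.* p) f ≡ ∑ p (λ j → ∑ c λ i → f (j ℕ.+ i ℕ.* p))
  ∑-blocks zero    p f = sym (∑-zero p)
  ∑-blocks (suc c) p f = begin
    ∑ (p ℕ.+ c ℕ.* p) f
      ≡⟨ cong (λ k → ∑ k f) (ℕ.+-comm p (c ℕ.* p)) ⟩
    ∑ (c ℕ.* p ℕ.+ p) f
      ≡⟨ ∑-append (c ℕ.* p) p f ⟩
    ∑ (c ℕ.* p) f + ∑ p (λ j → f (c ℕ.* p ℕ.+ j))
      ≡⟨ cong₂ _+_ (∑-blocks c p f) (∑-cong p λ j _ → cong f (ℕ.+-comm (c ℕ.* p) j)) ⟩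
    ∑ p (λ j → ∑ c λ i → f (j ℕ.+ i ℕ.* p)) + ∑ p (λ j → f (j ℕ.+ c ℕ.* p))
      ≡⟨ ∑-+ p _ _ ⟨
    ∑ p (λ j → ∑ (suc c) λ i → f (j ℕ.+ i ℕ.* p))  ∎

  -- In terms of exponential generating functions A(z) = Σ aₙ zⁿ/n!: E h is
  -- multiplication by e^{hz}, N is multiplication by z, D h is z ↦ hz, and
  -- P j is e^{jz}.

  E : ℕ → Seq → Seq
  E h a zero    = a zero
  E h a (suc n) = E h (λ k → a (suc k)) n + fromℕ h * E h a n

  N : Seq → Seq
  N a zero    = 0ℚ
  N a (suc n) = fromℕ (suc n) * a n

  D : ℕ → Seq → Seq
  D h a n = fromℕ (h ^ n) * a n

  P : ℕ → Seq
  P j n = fromℕ (j ^ n)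

  P-suc : ∀ j n → P j (suc n) ≡ fromℕ j * P j n
  P-suc j n = fromℕ-* j (j ^ n)

  -- The recursion of `E` is the product rule (e^(hz) A)′ = e^(hz) A′ + h e^(hz) A, since shifting
  -- the sequence differentiates A. The laws of `E` are therefore proved by induction on n for all
  -- sequences at once.
  E-local : ∀ h n {a b : Seq} → (∀ k → k ℕ.≤ n → a k ≡ b k) → E h a n ≡ E h b n
  E-local h zero    eq = eq 0 ℕ.≤-refl
  E-local h (suc n) eq = cong₂ (λ x y → x + fromℕ h * y)
    (E-local h n λ k k≤n → eq (suc k) (s≤s k≤n))
    (E-local h n λ k k≤n → eq k (ℕ.m≤n⇒m≤1+n k≤n))

  E-cong : ∀ h {a b : Seq} → a ≗ b → E h a ≗ E h b
  E-cong h eq n = E-local h n λ k _ → eq k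

  E-+ : ∀ h (a b : Seq) → E h (λ n → a n + b n) ≗ λ n → E h a n + E h b n
  E-+ h a b zero    = refl
  E-+ h a b (suc n) = trans
    (cong₂ (λ x y → x + fromℕ h * y) (E-+ h _ _ n) (E-+ h a b n))
    (lemma (E h (λ k → a (suc k)) n) (E h (λ k → b (suc k)) n) (fromℕ h) (E h a n) (E h b n))
    where
    lemma : ∀ x y h a b → x + y + h * (a + b) ≡ (x + h * a) + (y + h * b)
    lemma = solve-∀ ℚ-ring

  E-* : ∀ h c (a : Seq) → E h (λ n → c * a n) ≗ λ n → c * E h a n
  E-* h c a zero    = refl
  E-* h c a (suc n) = trans
    (cong₂ (λ x y → x + fromℕ h * y) (E-* h c _ n) (E-* h c a n))
    (lemma c (E h (λ k → a (suc k)) n) (fromℕ h) (E h a n))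
    where
    lemma : ∀ c x h a → c * x + h * (c * a) ≡ c * (x + h * a)
    lemma = solve-∀ ℚ-ring

  E-- : ∀ h (a b : Seq) → E h (λ n → a n - b n) ≗ λ n → E h a n - E h b n
  E-- h a b zero    = refl
  E-- h a b (suc n) = trans
    (cong₂ (λ x y → x + fromℕ h * y) (E-- h _ _ n) (E-- h a b n))
    (lemma (E h (λ k → a (suc k)) n) (E h (λ k → b (suc k)) n) (fromℕ h) (E h a n) (E h b n))
    where
    lemma : ∀ x y h a b → x - y + h * (a - b) ≡ (x + h * a) - (y + h * b)
    lemma = solve-∀ ℚ-ring

  E-zero : ∀ h → E h (λ _ → 0ℚ) ≗ λ _ → 0ℚ
  E-zero h zero    = refl
  E-zero h (suc n) = trans (cong (λ x → x + fromℕ h * x) (E-zero h n)) (trans (+-identityˡ _) (*-zeroʳ (fromℕ h)))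

  E-∑ : ∀ h m (a : ℕ → Seq) → E h (λ n → ∑ m λ i → a i n) ≗ λ n → ∑ m λ i → E h (a i) n
  E-∑ h zero    a n = E-zero h n
  E-∑ h (suc m) a n = trans (E-+ h _ (a m) n) (cong (_+ E h (a m) n) (E-∑ h m a n))

  E-E : ∀ h k (a : Seq) → E h (E k a) ≗ E (h ℕ.+ k) a
  E-E h k a zero    = refl
  E-E h k a (suc n) = begin
    E h (λ m → E k σa m + fromℕ k * E k a m) n + fromℕ h * E h (E k a) n
      ≡⟨ cong₂ (λ x y → x + fromℕ h * y)
           (trans (E-+ h _ _ n) (cong₂ _+_ (E-E h k σa n) (trans (E-* h (fromℕ k) _ n) (cong (fromℕ k *_) (E-E h k a n)))))
           (E-E h k a n) ⟩
    E (h ℕ.+ k) σa n + fromℕ k * E (h ℕ.+ k) a n + fromℕ h * E (h ℕ.+ k) a n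
      ≡⟨ lemma (E (h ℕ.+ k) σa n) (fromℕ k) (fromℕ h) (E (h ℕ.+ k) a n) ⟩
    E (h ℕ.+ k) σa n + (fromℕ h + fromℕ k) * E (h ℕ.+ k) a n
      ≡⟨ cong (λ x → E (h ℕ.+ k) σa n + x * E (h ℕ.+ k) a n) (fromℕ-+ h k) ⟨
    E (h ℕ.+ k) a (suc n) ∎
    where
    σa : Seq
    σa m = a (suc m)
    lemma : ∀ x k h y → x + k * y + h * y ≡ x + (h + k) * y
    lemma = solve-∀ ℚ-ring

  E-0 : ∀ (a : Seq) → E 0 a ≗ a
  E-0 a zero    = refl
  E-0 a (suc n) = trans (cong₂ _+_ (E-0 _ n) (*-zeroˡ (E 0 a n))) (+-identityʳ _)

  E-P : ∀ h j → E h (P j) ≗ P (h ℕ.+ j)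
  E-P h j zero    = refl
  E-P h j (suc n) = begin
    E h (λ k → P j (suc k)) n + fromℕ h * E h (P j) n
      ≡⟨ cong (_+ fromℕ h * E h (P j) n) (trans (E-cong h (P-suc j) n) (E-* h (fromℕ j) (P j) n)) ⟩
    fromℕ j * E h (P j) n + fromℕ h * E h (P j) n
      ≡⟨ lemma (fromℕ j) (fromℕ h) (E h (P j) n) ⟩
    (fromℕ h + fromℕ j) * E h (P j) n
      ≡⟨ cong₂ _*_ (sym (fromℕ-+ h j)) (E-P h j n) ⟩
    fromℕ (h ℕ.+ j) * P (h ℕ.+ j) n
      ≡⟨ P-suc (h ℕ.+ j) n ⟨
    P (h ℕ.+ j) (suc n) ∎
    where
    lemma : ∀ x y z → x * z + y * z ≡ (y + x) * z
    lemma = solve-∀ ℚ-ring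

  -- Substituting hz for z in e^(kz) A(z) gives e^(hkz) A(hz).
  E-D : ∀ h k (a : Seq) → E (h ℕ.* k) (D h a) ≗ D h (E k a)
  E-D h k a zero    = refl
  E-D h k a (suc n) = begin
    E (h ℕ.* k) (λ m → D h a (suc m)) n + fromℕ (h ℕ.* k) * E (h ℕ.* k) (D h a) n
      ≡⟨ cong₂ (λ x y → x + fromℕ (h ℕ.* k) * y)
           (trans (E-cong (h ℕ.* k) Dσ n) (trans (E-* (h ℕ.* k) (fromℕ h) _ n) (cong (fromℕ h *_) (E-D h k σa n))))
           (E-D h k a n) ⟩
    fromℕ h * (fromℕ (h ^ n) * E k σa n) + fromℕ (h ℕ.* k) * (fromℕ (h ^ n) * E k a n)
      ≡⟨ cong (λ x → fromℕ h * (fromℕ (h ^ n) * E k σa n) + x * (fromℕ (h ^ n) * E k a n)) (fromℕ-* h k) ⟩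
    fromℕ h * (fromℕ (h ^ n) * E k σa n) + fromℕ h * fromℕ k * (fromℕ (h ^ n) * E k a n)
      ≡⟨ lemma (fromℕ h) (fromℕ (h ^ n)) (E k σa n) (fromℕ k) (E k a n) ⟩
    fromℕ h * fromℕ (h ^ n) * (E k σa n + fromℕ k * E k a n)
      ≡⟨ cong (_* E k a (suc n)) (P-suc h n) ⟨
    D h (E k a) (suc n) ∎
    where
    σa : Seq
    σa m = a (suc m)
    Dσ : ∀ m → D h a (suc m) ≡ fromℕ h * D h σa m
    Dσ m = trans (cong (_* a (suc m)) (P-suc h m)) (assoc (fromℕ h) (P h m) (a (suc m)))
      where
      assoc : ∀ x y z → x * y * z ≡ x * (y * z)
      assoc = solve-∀ ℚ-ring
    lemma : ∀ h q x k y → h * (q * x) + h * k * (q * y) ≡ h * q * (x + k * y)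
    lemma = solve-∀ ℚ-ring

  E-N : ∀ h (a : Seq) → E h (N a) ≗ N (E h a)
  E-N h a zero    = refl
  E-N h a (suc n) = begin
    E h (λ m → N a (suc m)) n + fromℕ h * E h (N a) n
      ≡⟨ cong₂ (λ x y → x + fromℕ h * y) (trans (E-cong h σN n) (E-+ h (N σa) a n)) (E-N h a n) ⟩
    E h (N σa) n + E h a n + fromℕ h * N (E h a) n
      ≡⟨ cong (λ x → x + E h a n + fromℕ h * N (E h a) n) (E-N h σa n) ⟩
    N (E h σa) n + E h a n + fromℕ h * N (E h a) n
      ≡⟨ collect n ⟩
    fromℕ (suc n) * E h a n ∎
    where
    σa : Seq
    σa m = a (suc m)
    -- The derivative (z A)′ = z A′ + A.
    σN : ∀ m → N a (suc m) ≡ N σa m + a m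
    σN zero    = trans (*-identityˡ (a 0)) (sym (+-identityˡ (a 0)))
    σN (suc m) = trans (cong (_* a (suc m)) (fromℕ-suc (suc m))) (lemma (fromℕ (suc m)) (a (suc m)))
      where
      lemma : ∀ x y → (1ℚ + x) * y ≡ x * y + y
      lemma = solve-∀ ℚ-ring
    collect : ∀ n → N (E h σa) n + E h a n + fromℕ h * N (E h a) n ≡ fromℕ (suc n) * E h a n
    collect zero    = lemma (fromℕ h) (a 0)
      where
      lemma : ∀ h x → 0ℚ + x + h * 0ℚ ≡ 1ℚ * x
      lemma = solve-∀ ℚ-ring
    collect (suc n) = trans
      (lemma (fromℕ (suc n)) (E h σa n) (fromℕ h) (E h a n))
      (cong (_* E h a (suc n)) (sym (fromℕ-suc (suc n))))
      where
      lemma : ∀ k x h y → k * x + (x + h * y) + h * (k * y) ≡ (1ℚ + k) * (x + h * y)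
      lemma = solve-∀ ℚ-ring

  N-injective : ∀ {a b : Seq} → N a ≗ N b → a ≗ b
  N-injective {a} {b} eq n = *-cancelʳ-fromℕ (suc n)
    (trans (*-comm (a n) (fromℕ (suc n))) (trans (eq (suc n)) (*-comm (fromℕ (suc n)) (b n))))

  E-vanish : ∀ h n (a : Seq) → (∀ k → k < n → a k ≡ 0ℚ) → E h a n ≡ a n
  E-vanish h zero    a low = refl
  E-vanish h (suc n) a low = begin
    E h (λ k → a (suc k)) n + fromℕ h * E h a n
      ≡⟨ cong₂ (λ x y → x + fromℕ h * y)
           (E-vanish h n _ λ k k<n → low (suc k) (s<s k<n))
           (trans (E-vanish h n a λ k k<n → low k (ℕ.m<n⇒m<1+n k<n)) (low n ℕ.≤-refl)) ⟩
    a (suc n) + fromℕ h * 0ℚ  ≡⟨ lemma (a (suc n)) (fromℕ h) ⟩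
    a (suc n)                 ∎
    where
    lemma : ∀ x h → x + h * 0ℚ ≡ x
    lemma = solve-∀ ℚ-ring

  -- When A starts in degree n, only the terms 1 and hz of e^(hz) reach degree n + 1; the factor
  -- `suc n` is the binomial coefficient of n + 1 over n.
  E-leading : ∀ h n (a : Seq) → (∀ k → k < n → a k ≡ 0ℚ) →
              E h a (suc n) ≡ a (suc n) + fromℕ (suc n ℕ.* h) * a n
  E-leading h zero    a low = cong (λ k → a 1 + fromℕ k * a 0) (sym (ℕ.+-identityʳ h))
  E-leading h (suc n) a low = begin
    E h (λ k → a (suc k)) (suc n) + fromℕ h * E h a (suc n)
      ≡⟨ cong₂ (λ x y → x + fromℕ h * y)
           (E-leading h n _ λ k k<n → low (suc k) (s<s k<n))
           (E-vanish h (suc n) a low) ⟩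
    a (suc (suc n)) + fromℕ (suc n ℕ.* h) * a (suc n) + fromℕ h * a (suc n)
      ≡⟨ lemma (a (suc (suc n))) (fromℕ (suc n ℕ.* h)) (a (suc n)) (fromℕ h) ⟩
    a (suc (suc n)) + (fromℕ h + fromℕ (suc n ℕ.* h)) * a (suc n)
      ≡⟨ cong (λ x → a (suc (suc n)) + x * a (suc n)) (fromℕ-+ h (suc n ℕ.* h)) ⟨
    a (suc (suc n)) + fromℕ (suc (suc n) ℕ.* h) * a (suc n) ∎
    where
    lemma : ∀ x y z h → x + y * z + h * z ≡ x + (h + y) * z
    lemma = solve-∀ ℚ-ring

-- The functional equation of the Bernoulli generating function.

module BernoulliNumbers where

  open Embedding
  open Sequences
  open import Defs
  open import Data.Fin.Base using (toℕ)
  open import Data.Nat.Base as ℕ using (ℕ; zero; suc; _∸_; _!)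
  import Data.Nat.Properties as ℕ
  open import Data.Rational.Base
  open import Data.Rational.Properties using (+-comm; +-identityʳ; *-zeroˡ; *-zeroʳ; *-identityˡ; *-comm; *-assoc; *-distribˡ-+; +-0-monoid)
  open import Relation.Binary.PropositionalEquality
  open import Tactic.RingSolver using (solve-∀)
  open import Algebra.Properties.Monoid.Sum +-0-monoid using (sum)
  open ≡-Reasoning

  sum≡∑ : ∀ n (f : Seq) → sum {n} (λ i → f (toℕ i)) ≡ ∑ n f
  sum≡∑ zero    f = refl
  sum≡∑ (suc n) f = trans (cong (f 0 +_) (sum≡∑ n λ i → f (suc i))) (sym (∑-front n f))

  recip-suc! : ∀ n → fromℕ (suc n) * recip (suc n !) ≡ recip (n !)
  recip-suc! n = *-cancelʳ-fromℕ (n !) {{n ℕ.!≢0}} (begin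
    fromℕ (suc n) * recip (suc n !) * fromℕ (n !)    ≡⟨ lemma (fromℕ (suc n)) (recip (suc n !)) (fromℕ (n !)) ⟩
    fromℕ (suc n) * fromℕ (n !) * recip (suc n !)    ≡⟨ cong (_* recip (suc n !)) (fromℕ-* (suc n) (n !)) ⟨
    fromℕ (suc n !) * recip (suc n !)                ≡⟨ fromℕ*recip (suc n !) {{suc n ℕ.!≢0}} ⟩
    1ℚ                                               ≡⟨ fromℕ*recip (n !) {{n ℕ.!≢0}} ⟨
    fromℕ (n !) * recip (n !)                        ≡⟨ *-comm (fromℕ (n !)) (recip (n !)) ⟩
    recip (n !) * fromℕ (n !)                        ∎)
    where
    lemma : ∀ a b c → a * b * c ≡ a * c * b
    lemma = solve-∀ ℚ-ring

  private

    exp⊛egf : Seq → Seq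
    exp⊛egf a n = ∑ (suc n) λ i → recip (i !) * egf a (n ∸ i)

    -- Leibniz rule for the product e^z · A(z).
    exp⊛egf-suc : ∀ (a : Seq) n →
                  fromℕ (suc n) * exp⊛egf a (suc n) ≡ exp⊛egf (λ k → a (suc k)) n + exp⊛egf a n
    exp⊛egf-suc a n = begin
      fromℕ (suc n) * ∑ (2 ℕ.+ n) t
        ≡⟨ ∑-* (2 ℕ.+ n) (fromℕ (suc n)) t ⟨
      ∑ (2 ℕ.+ n) (λ i → fromℕ (suc n) * t i)
        ≡⟨ ∑-cong (2 ℕ.+ n) split ⟩
      ∑ (2 ℕ.+ n) (λ i → fromℕ i * t i + fromℕ (suc n ∸ i) * t i)
        ≡⟨ ∑-+ (2 ℕ.+ n) _ _ ⟩
      ∑ (2 ℕ.+ n) (λ i → fromℕ i * t i) + ∑ (2 ℕ.+ n) (λ i → fromℕ (suc n ∸ i) * t i)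
        ≡⟨ cong₂ _+_ left right ⟩
      exp⊛egf a n + exp⊛egf (λ k → a (suc k)) n
        ≡⟨ +-comm (exp⊛egf a n) (exp⊛egf (λ k → a (suc k)) n) ⟩
      exp⊛egf (λ k → a (suc k)) n + exp⊛egf a n ∎
      where
      drop-zero : ∀ x y → 0ℚ * x + y ≡ y
      drop-zero = solve-∀ ℚ-ring
      t : Seq
      t i = recip (i !) * egf a (suc n ∸ i)
      -- The factor n + 1 comes from differentiating the product. Written as i + (n + 1 - i), its
      -- first part differentiates e^z and its second part A.
      split : ∀ i → i ℕ.< 2 ℕ.+ n → fromℕ (suc n) * t i ≡ fromℕ i * t i + fromℕ (suc n ∸ i) * t i
      split i (ℕ.s≤s i≤1+n) = begin
        fromℕ (suc n) * t i                        ≡⟨ cong (λ k → fromℕ k * t i) (ℕ.m+[n∸m]≡n i≤1+n) ⟨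
        fromℕ (i ℕ.+ (suc n ∸ i)) * t i            ≡⟨ cong (_* t i) (fromℕ-+ i (suc n ∸ i)) ⟩
        (fromℕ i + fromℕ (suc n ∸ i)) * t i        ≡⟨ distrib (fromℕ i) (fromℕ (suc n ∸ i)) (t i) ⟩
        fromℕ i * t i + fromℕ (suc n ∸ i) * t i    ∎
        where
        distrib : ∀ x y z → (x + y) * z ≡ x * z + y * z
        distrib = solve-∀ ℚ-ring
      left : ∑ (2 ℕ.+ n) (λ i → fromℕ i * t i) ≡ exp⊛egf a n
      left = begin
        ∑ (2 ℕ.+ n) (λ i → fromℕ i * t i)
          ≡⟨ ∑-front (suc n) _ ⟩
        0ℚ * t 0 + ∑ (suc n) (λ i → fromℕ (suc i) * t (suc i))
          ≡⟨ drop-zero (t 0) _ ⟩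
        ∑ (suc n) (λ i → fromℕ (suc i) * (recip (suc i !) * egf a (n ∸ i)))
          ≡⟨ ∑-cong (suc n) (λ i _ → trans (sym (*-assoc (fromℕ (suc i)) _ _)) (cong (_* egf a (n ∸ i)) (recip-suc! i))) ⟩
        exp⊛egf a n ∎
      right : ∑ (2 ℕ.+ n) (λ i → fromℕ (suc n ∸ i) * t i) ≡ exp⊛egf (λ k → a (suc k)) n
      right = begin
        ∑ (suc n) (λ i → fromℕ (suc n ∸ i) * t i) + fromℕ (n ∸ n) * t (suc n)
          ≡⟨ cong (λ k → ∑ (suc n) (λ i → fromℕ (suc n ∸ i) * t i) + fromℕ k * t (suc n)) (ℕ.n∸n≡0 n) ⟩
        ∑ (suc n) (λ i → fromℕ (suc n ∸ i) * t i) + 0ℚ * t (suc n)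
          ≡⟨ trans (cong (∑ (suc n) (λ i → fromℕ (suc n ∸ i) * t i) +_) (*-zeroˡ (t (suc n)))) (+-identityʳ _) ⟩
        ∑ (suc n) (λ i → fromℕ (suc n ∸ i) * t i)
          ≡⟨ ∑-cong (suc n) term ⟩
        exp⊛egf (λ k → a (suc k)) n ∎
        where
        rearrange : ∀ k r x s → k * (r * (x * s)) ≡ r * (x * (k * s))
        rearrange = solve-∀ ℚ-ring
        term : ∀ i → i ℕ.< suc n → fromℕ (suc n ∸ i) * t i ≡ recip (i !) * egf (λ k → a (suc k)) (n ∸ i)
        term i (ℕ.s≤s i≤n) = begin
          fromℕ (suc n ∸ i) * (recip (i !) * egf a (suc n ∸ i))
            ≡⟨ cong (λ k → fromℕ k * (recip (i !) * egf a k)) (ℕ.+-∸-assoc 1 i≤n) ⟩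
          fromℕ (suc k) * (recip (i !) * (a (suc k) * recip (suc k !)))
            ≡⟨ rearrange (fromℕ (suc k)) (recip (i !)) (a (suc k)) (recip (suc k !)) ⟩
          recip (i !) * (a (suc k) * (fromℕ (suc k) * recip (suc k !)))
            ≡⟨ cong (λ x → recip (i !) * (a (suc k) * x)) (recip-suc! k) ⟩
          recip (i !) * (a (suc k) * recip (k !)) ∎
          where k = n ∸ i

    -- Connects the convolution in which `bernoulli-egf` is stated with the recursive `E`: both obey
    -- the same product rule.
    exp⊛egf≗E : ∀ (a : Seq) n → fromℕ (n !) * exp⊛egf a n ≡ E 1 a n
    exp⊛egf≗E a zero    = lemma (a 0)
      where
      lemma : ∀ x → 1ℚ * (0ℚ + 1ℚ * (x * 1ℚ)) ≡ x
      lemma = solve-∀ ℚ-ring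
    exp⊛egf≗E a (suc n) = begin
      fromℕ (suc n !) * exp⊛egf a (suc n)
        ≡⟨ cong (_* exp⊛egf a (suc n)) (fromℕ-* (suc n) (n !)) ⟩
      fromℕ (suc n) * fromℕ (n !) * exp⊛egf a (suc n)
        ≡⟨ rearrange (fromℕ (suc n)) (fromℕ (n !)) (exp⊛egf a (suc n)) ⟩
      fromℕ (n !) * (fromℕ (suc n) * exp⊛egf a (suc n))
        ≡⟨ cong (fromℕ (n !) *_) (exp⊛egf-suc a n) ⟩
      fromℕ (n !) * (exp⊛egf (λ k → a (suc k)) n + exp⊛egf a n)
        ≡⟨ *-distribˡ-+ (fromℕ (n !)) _ _ ⟩
      fromℕ (n !) * exp⊛egf (λ k → a (suc k)) n + fromℕ (n !) * exp⊛egf a n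
        ≡⟨ cong₂ _+_ (exp⊛egf≗E _ n) (trans (exp⊛egf≗E a n) (sym (*-identityˡ (E 1 a n)))) ⟩
      E 1 a (suc n) ∎
      where
      rearrange : ∀ x y z → x * y * z ≡ y * (x * z)
      rearrange = solve-∀ ℚ-ring

  -- This is e^z B(z) = B(z) + z for B(z) = z/(e^z - 1); the series z is `N (P 0)`, because 0^0 = 1.
  E-bernoulli : ∀ n → E 1 bernoulli n ≡ bernoulli n + N (P 0) n
  E-bernoulli n = begin
    E 1 bernoulli n
      ≡⟨ exp⊛egf≗E bernoulli n ⟨
    fromℕ (n !) * ∑ (suc n) (λ i → recip (i !) * egf bernoulli (n ∸ i))
      ≡⟨ cong (fromℕ (n !) *_) (∑-front n _) ⟩
    fromℕ (n !) * (1ℚ * egf bernoulli n + rest)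
      -- e^z and e^z - 1 differ in the constant term only, so the summand of index 0 is split off
      -- and replaced by one with coefficient 0.
      ≡⟨ lemma (fromℕ (n !)) (egf bernoulli n) rest ⟩
    fromℕ (n !) * egf bernoulli n + fromℕ (n !) * (0ℚ * egf bernoulli n + rest)
      ≡⟨ cong₂ _+_ clear (cong (fromℕ (n !) *_) (trans (sym (∑-front n f)) (trans (sym (sum≡∑ (suc n) f)) (bernoulli-egf n)))) ⟩
    bernoulli n + fromℕ (n !) * Z n
      ≡⟨ cong (bernoulli n +_) (z n) ⟩
    bernoulli n + N (P 0) n ∎
    where
    rest = ∑ n λ i → recip (suc i !) * egf bernoulli (n ∸ suc i)
    f : Seq
    f i = expMinusOne i * egf bernoulli (n ∸ i)
    lemma : ∀ f x y → f * (1ℚ * x + y) ≡ f * x + f * (0ℚ * x + y)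
    lemma = solve-∀ ℚ-ring
    clear : fromℕ (n !) * egf bernoulli n ≡ bernoulli n
    clear = trans (swap (fromℕ (n !)) (bernoulli n) (recip (n !)))
      (trans (cong (_* bernoulli n) (fromℕ*recip (n !) {{n ℕ.!≢0}})) (*-identityˡ (bernoulli n)))
      where
      swap : ∀ x y z → x * (y * z) ≡ x * z * y
      swap = solve-∀ ℚ-ring
    z : ∀ n → fromℕ (n !) * Z n ≡ N (P 0) n
    z zero          = refl
    z (suc zero)    = refl
    z (suc (suc n)) = trans (*-zeroʳ (fromℕ (suc (suc n) !))) (sym (*-zeroʳ (fromℕ (suc (suc n)))))

-- The regularised values and their numerator ρ.

module Regularisation where

  open Embedding
  open Sequences
  open BernoulliNumbers
  open import Defs
  open import Data.Integer.Base as ℤ using (ℤ)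
  open import Data.Nat.Base as ℕ using (ℕ; zero; suc; _^_; NonZero)
  open import Data.Nat.Induction using (<-rec)
  import Data.Nat.Properties as ℕ
  open import Data.Rational.Base hiding (NonZero)
  open import Data.Rational.Properties using (+-comm; +-identityʳ; +-identityˡ; *-zeroʳ; *-identityˡ; *-identityʳ; *-comm)
  open import Relation.Binary.PropositionalEquality
  open import Tactic.RingSolver using (solve-∀)
  open ≡-Reasoning

  private

    -‿cancel : ∀ x y → x - y ≡ 0ℚ → x ≡ y
    -‿cancel x y eq = trans (lemma x y) (trans (cong (_+ y) eq) (+-identityˡ y))
      where
      lemma : ∀ x y → x ≡ x - y + y
      lemma = solve-∀ ℚ-ring

  -- e^(hz) - 1 is not a zero divisor: if a vanishes below n, the product has the coefficient (n +
  -- 1) h aₙ in degree n + 1 by `E-leading`, which forces aₙ = 0.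
  E-fixed : ∀ h .{{_ : NonZero h}} (a : Seq) → (∀ n → E h a n ≡ a n) → ∀ n → a n ≡ 0ℚ
  E-fixed h a fix = <-rec _ λ n low →
    *-cancelʳ-fromℕ (suc n ℕ.* h) {{ℕ.m*n≢0 (suc n) h}} (begin
      a n * fromℕ (suc n ℕ.* h)                                         ≡⟨ lemma (a n) (fromℕ (suc n ℕ.* h)) (a (suc n)) ⟩
      a (suc n) + fromℕ (suc n ℕ.* h) * a n - a (suc n)                 ≡⟨ cong (_- a (suc n)) (E-leading h n a λ k k<n → low k<n) ⟨
      E h a (suc n) - a (suc n)                                         ≡⟨ cong (_- a (suc n)) (fix (suc n)) ⟩
      a (suc n) - a (suc n)                                             ≡⟨ zeros (a (suc n)) (fromℕ (suc n ℕ.* h)) ⟩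
      0ℚ * fromℕ (suc n ℕ.* h)                                          ∎)
    where
    lemma : ∀ x k y → x * k ≡ y + k * x - y
    lemma = solve-∀ ℚ-ring
    zeros : ∀ x k → x - x ≡ 0ℚ * k
    zeros = solve-∀ ℚ-ring

  N-∑ : ∀ m (a : ℕ → Seq) → N (λ n → ∑ m λ i → a i n) ≗ λ n → ∑ m λ i → N (a i) n
  N-∑ m a (suc n) = sym (∑-* m (fromℕ (suc n)) λ i → a i n)
  N-∑ m a zero    = sym (∑-zero m)

  private

    N-* : ∀ c (a : Seq) → N (λ n → c * a n) ≗ λ n → c * N a n
    N-* c a zero    = sym (*-zeroʳ c)
    N-* c a (suc n) = lemma (fromℕ (suc n)) c (a n)
      where
      lemma : ∀ k c x → k * (c * x) ≡ c * (k * x)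
      lemma = solve-∀ ℚ-ring

    N-- : ∀ (a b : Seq) → N (λ n → a n - b n) ≗ λ n → N a n - N b n
    N-- a b zero    = refl
    N-- a b (suc n) = lemma (fromℕ (suc n)) (a n) (b n)
      where
      lemma : ∀ k x y → k * (x - y) ≡ k * x - k * y
      lemma = solve-∀ ℚ-ring

    N-+ : ∀ (a b : Seq) → N (λ n → a n + b n) ≗ λ n → N a n + N b n
    N-+ a b zero    = refl
    N-+ a b (suc n) = lemma (fromℕ (suc n)) (a n) (b n)
      where
      lemma : ∀ k x y → k * (x + y) ≡ k * x + k * y
      lemma = solve-∀ ℚ-ring

    P-scale : ∀ h i n → P h n * P i n ≡ P (h ℕ.* i) n
    P-scale h i n = trans (sym (fromℕ-* (h ^ n) (i ^ n))) (cong fromℕ (^-distribʳ-* n))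
      where
      ^-distribʳ-* : ∀ n → h ^ n ℕ.* i ^ n ≡ (h ℕ.* i) ^ n
      ^-distribʳ-* zero    = refl
      ^-distribʳ-* (suc n) = trans (ℕ.[m*n]*[o*p]≡[m*o]*[n*p] h (h ^ n) i (i ^ n)) (cong (h ℕ.* i ℕ.*_) (^-distribʳ-* n))

    D-NP : ∀ h i n → D h (N (P i)) n ≡ fromℕ h * N (P (h ℕ.* i)) n
    D-NP h i zero    = trans (*-identityˡ 0ℚ) (sym (*-zeroʳ (fromℕ h)))
    D-NP h i (suc n) = begin
      P h (suc n) * (fromℕ (suc n) * P i n)            ≡⟨ cong (_* (fromℕ (suc n) * P i n)) (P-suc h n) ⟩
      fromℕ h * P h n * (fromℕ (suc n) * P i n)        ≡⟨ lemma (fromℕ h) (P h n) (fromℕ (suc n)) (P i n) ⟩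
      fromℕ h * (fromℕ (suc n) * (P h n * P i n))      ≡⟨ cong (λ x → fromℕ h * (fromℕ (suc n) * x)) (P-scale h i n) ⟩
      fromℕ h * (fromℕ (suc n) * P (h ℕ.* i) n)        ∎
      where
      lemma : ∀ h x k y → h * x * (k * y) ≡ h * (k * (x * y))
      lemma = solve-∀ ℚ-ring

  -- Iterating e^z B(z) = B(z) + z writes (e^(mz) - 1) B(z) as z times a geometric sum, free of
  -- denominators.
  E-bernoulli-∑ : ∀ m n → E m bernoulli n ≡ bernoulli n + ∑ m (λ i → N (P i) n)
  E-bernoulli-∑ zero    n = trans (E-0 bernoulli n) (sym (+-identityʳ _))
  E-bernoulli-∑ (suc m) n = begin
    E (suc m) bernoulli n
      ≡⟨ cong (λ k → E k bernoulli n) (ℕ.+-comm 1 m) ⟩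
    E (m ℕ.+ 1) bernoulli n
      ≡⟨ E-E m 1 bernoulli n ⟨
    E m (E 1 bernoulli) n
      ≡⟨ E-cong m E-bernoulli n ⟩
    E m (λ n → bernoulli n + N (P 0) n) n
      ≡⟨ E-+ m bernoulli (N (P 0)) n ⟩
    E m bernoulli n + E m (N (P 0)) n
      ≡⟨ cong₂ _+_ (E-bernoulli-∑ m n) (trans (E-N m (P 0) n) (N-cong m n)) ⟩
    bernoulli n + ∑ m (λ i → N (P i) n) + N (P m) n
      ≡⟨ assoc (bernoulli n) (∑ m (λ i → N (P i) n)) (N (P m) n) ⟩
    bernoulli n + ∑ (suc m) (λ i → N (P i) n) ∎
    where
    assoc : ∀ x y z → x + y + z ≡ x + (y + z)
    assoc = solve-∀ ℚ-ring
    N-cong : ∀ m n → N (E m (P 0)) n ≡ N (P m) n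
    N-cong m zero    = refl
    N-cong m (suc n) = cong (fromℕ (suc n) *_) (trans (E-P m 0 n) (cong (λ k → P k n) (ℕ.+-identityʳ m)))

  E-D-bernoulli : ∀ h m n → E (h ℕ.* m) (D h bernoulli) n ≡
                  D h bernoulli n + fromℕ h * ∑ m (λ i → N (P (h ℕ.* i)) n)
  E-D-bernoulli h m n = begin
    E (h ℕ.* m) (D h bernoulli) n
      ≡⟨ E-D h m bernoulli n ⟩
    P h n * E m bernoulli n
      ≡⟨ cong (P h n *_) (E-bernoulli-∑ m n) ⟩
    P h n * (bernoulli n + ∑ m (λ i → N (P i) n))
      ≡⟨ distrib (P h n) (bernoulli n) _ ⟩
    D h bernoulli n + P h n * ∑ m (λ i → N (P i) n)
      ≡⟨ cong (D h bernoulli n +_) (sym (∑-* m (P h n) λ i → N (P i) n)) ⟩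
    D h bernoulli n + ∑ m (λ i → D h (N (P i)) n)
      ≡⟨ cong (D h bernoulli n +_) (trans (∑-cong m λ i _ → D-NP h i n) (∑-* m (fromℕ h) λ i → N (P (h ℕ.* i)) n)) ⟩
    D h bernoulli n + fromℕ h * ∑ m (λ i → N (P (h ℕ.* i)) n) ∎
    where
    distrib : ∀ x y z → x * (y + z) ≡ x * y + x * z
    distrib = solve-∀ ℚ-ring

  -- (c^l − 1)(1 − p^{l−1}), as a function of n = l − 1.
  unit : (c p n : ℕ) → ℤ
  unit c p n = (ℤ.+ (c ^ suc n) ℤ.- ℤ.+ 1) ℤ.* (ℤ.+ 1 ℤ.- ℤ.+ (p ^ n))

  -- The moments of the c-regularised Bernoulli measure on the units of ℤₚ.
  B* : (c p : ℕ) → Seq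
  B* c p n = B̂ (suc n) * ι (unit c p n)

  -- The series e^(rz) (1 + y + ⋯ + y^(q-1)) with y = e^(pz), that is, the quotient of e^((r+qp)z) -
  -- e^(rz) by y - 1.
  chain : (p r q : ℕ) → Seq
  chain p r q n = ∑ q λ k → P (r ℕ.+ k ℕ.* p) n

  module _ (c p′ : ℕ) where

    private
      p = suc p′
      β = bernoulli

    -- Multiplication by z turns B̂(n) into Bₙ, and the factor p turns p^(n-1) into p^n. The result
    -- is p B(cz) - p B(z) - B(pcz) + B(pz), in which all four series are dilations of B.
    N-B* : ∀ n → fromℕ p * N (B* c p) n ≡
           fromℕ p * D c β n - fromℕ p * β n - D (p ℕ.* c) β n + D p β n
    N-B* zero    = lemma (fromℕ p) (β 0)
      where
      lemma : ∀ p b → p * 0ℚ ≡ p * (1ℚ * b) - p * b - 1ℚ * b + 1ℚ * b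
      lemma = solve-∀ ℚ-ring
    N-B* (suc n) = begin
      fromℕ p * (fromℕ (suc n) * (b * recip (suc n) * ι (unit c p n)))
        ≡⟨ cong (λ x → fromℕ p * (fromℕ (suc n) * (b * recip (suc n) * x))) ι-unit ⟩
      fromℕ p * (fromℕ (suc n) * (b * recip (suc n) * ((P c (suc n) - 1ℚ) * (1ℚ - P p n))))
        ≡⟨ rearrange (fromℕ p) (fromℕ (suc n)) b (recip (suc n)) (P c (suc n)) (P p n) ⟩
      fromℕ (suc n) * recip (suc n) * body
        ≡⟨ trans (cong (_* body) (fromℕ*recip (suc n))) (*-identityˡ body) ⟩
      body
        ≡⟨⟩
      fromℕ p * (P c (suc n) * b) - fromℕ p * b - fromℕ p * P p n * P c (suc n) * b + fromℕ p * P p n * b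
        ≡⟨ cong₂ (λ x y → fromℕ p * (P c (suc n) * b) - fromℕ p * b - x * b + y * b)
             (trans (cong (_* P c (suc n)) (sym (P-suc p n))) (P-scale p c (suc n))) (sym (P-suc p n)) ⟩
      fromℕ p * D c β (suc n) - fromℕ p * b - D (p ℕ.* c) β (suc n) + D p β (suc n) ∎
      where
      b = β (suc n)
      body = fromℕ p * (P c (suc n) * b) - fromℕ p * b - fromℕ p * P p n * P c (suc n) * b + fromℕ p * P p n * b
      ι-unit : ι (unit c p n) ≡ (P c (suc n) - 1ℚ) * (1ℚ - P p n)
      ι-unit = trans (ι-* (ℤ.+ (c ^ suc n) ℤ.- ℤ.+ 1) (ℤ.+ 1 ℤ.- ℤ.+ (p ^ n)))
        (cong₂ _*_ (ι-- (ℤ.+ (c ^ suc n)) (ℤ.+ 1)) (ι-- (ℤ.+ 1) (ℤ.+ (p ^ n))))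
      rearrange : ∀ p k b r c q → p * (k * (b * r * ((c - 1ℚ) * (1ℚ - q)))) ≡
                  k * r * (p * (c * b) - p * b - p * q * c * b + p * q * b)
      rearrange = solve-∀ ℚ-ring

    private
      R : Seq
      R n = fromℕ c * ∑ p (λ i → P (c ℕ.* i) n) - ∑ (c ℕ.* p) (λ i → P i n) - fromℕ c * P 0 n + ∑ c (λ i → P (p ℕ.* i) n)

    N-R : ∀ n → N R n ≡ fromℕ c * ∑ p (λ i → N (P (c ℕ.* i)) n) - ∑ (c ℕ.* p) (λ i → N (P i) n)
                        - fromℕ c * N (P 0) n + ∑ c (λ i → N (P (p ℕ.* i)) n)
    N-R n = begin
      N R n
        ≡⟨ N-+ (λ n → t₁ n - t₂ n - t₃ n) t₄ n ⟩
      N (λ n → t₁ n - t₂ n - t₃ n) n + N t₄ n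
        ≡⟨ cong (_+ N t₄ n) (trans (N-- (λ n → t₁ n - t₂ n) t₃ n) (cong (_- N t₃ n) (N-- t₁ t₂ n))) ⟩
      N t₁ n - N t₂ n - N t₃ n + N t₄ n
        ≡⟨ cong₂ (λ x y → x - N t₂ n - y + N t₄ n)
             (trans (N-* (fromℕ c) (λ n → ∑ p λ i → P (c ℕ.* i) n) n) (cong (fromℕ c *_) (N-∑ p (λ i → P (c ℕ.* i)) n)))
             (N-* (fromℕ c) (P 0) n) ⟩
      fromℕ c * ∑ p (λ i → N (P (c ℕ.* i)) n) - N t₂ n - fromℕ c * N (P 0) n + N t₄ n
        ≡⟨ cong₂ (λ x y → fromℕ c * ∑ p (λ i → N (P (c ℕ.* i)) n) - x - fromℕ c * N (P 0) n + y)
             (N-∑ (c ℕ.* p) P n) (N-∑ c (λ i → P (p ℕ.* i)) n) ⟩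
      _ ∎
      where
      t₁ t₂ t₃ t₄ : Seq
      t₁ n = fromℕ c * ∑ p (λ i → P (c ℕ.* i) n)
      t₂ n = ∑ (c ℕ.* p) (λ i → P i n)
      t₃ n = fromℕ c * P 0 n
      t₄ n = ∑ c (λ i → P (p ℕ.* i) n)

    -- As c p is a multiple of 1, c, p and p c, multiplication by e^(cpz) - 1 clears the
    -- denominators of the four series in `N-B*` at once. The common factors z and p are cancelled
    -- afterwards.
    E-B* : ∀ n → E (c ℕ.* p) (B* c p) n - B* c p n ≡ R n
    E-B* = N-injective λ n → *-cancelʳ-fromℕ p (begin
      N (λ n → E d a n - a n) n * fromℕ p
        ≡⟨ trans (*-comm _ (fromℕ p)) (cong (fromℕ p *_) (N-- (E d a) a n)) ⟩
      fromℕ p * (N (E d a) n - N a n)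
        ≡⟨ cong (λ x → fromℕ p * (x - N a n)) (sym (E-N d a n)) ⟩
      fromℕ p * (E d (N a) n - N a n)
        ≡⟨ distrib (fromℕ p) (E d (N a) n) (N a n) ⟩
      fromℕ p * E d (N a) n - fromℕ p * N a n
        ≡⟨ cong₂ _-_ (trans (sym (E-* d (fromℕ p) (N a) n)) (trans (E-cong d N-B* n) (expand n))) (N-B* n) ⟩
      (fromℕ p * E d (D c β) n - fromℕ p * E d β n - E d (D (p ℕ.* c) β) n + E d (D p β) n)
        - (fromℕ p * D c β n - fromℕ p * β n - D (p ℕ.* c) β n + D p β n)
        ≡⟨ cong₂ _-_ (cong₂ _+_ (cong₂ _-_ (cong₂ _-_ (cong (fromℕ p *_) (E-D-bernoulli c p n))
             (cong (fromℕ p *_) (E-bernoulli-∑ d n))) (E-pc n)) (E-p n)) refl ⟩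
      (fromℕ p * (D c β n + fromℕ c * ∑ p (λ i → N (P (c ℕ.* i)) n)) - fromℕ p * (β n + ∑ d (λ i → N (P i) n))
        - (D (p ℕ.* c) β n + fromℕ p * fromℕ c * N (P 0) n) + (D p β n + fromℕ p * ∑ c (λ i → N (P (p ℕ.* i)) n)))
        - (fromℕ p * D c β n - fromℕ p * β n - D (p ℕ.* c) β n + D p β n)
        ≡⟨ collect (fromℕ p) (fromℕ c) (D c β n) (β n) (D (p ℕ.* c) β n) (D p β n)
             (∑ p (λ i → N (P (c ℕ.* i)) n)) (∑ d (λ i → N (P i) n)) (N (P 0) n) (∑ c (λ i → N (P (p ℕ.* i)) n)) ⟩
      (fromℕ c * ∑ p (λ i → N (P (c ℕ.* i)) n) - ∑ d (λ i → N (P i) n) - fromℕ c * N (P 0) n + ∑ c (λ i → N (P (p ℕ.* i)) n)) * fromℕ p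
        ≡⟨ cong (_* fromℕ p) (N-R n) ⟨
      N R n * fromℕ p ∎)
      where
      d = c ℕ.* p
      a = B* c p
      distrib : ∀ p x y → p * (x - y) ≡ p * x - p * y
      distrib = solve-∀ ℚ-ring
      expand : ∀ n → E d (λ n → fromℕ p * D c β n - fromℕ p * β n - D (p ℕ.* c) β n + D p β n) n ≡
               fromℕ p * E d (D c β) n - fromℕ p * E d β n - E d (D (p ℕ.* c) β) n + E d (D p β) n
      expand n = trans (E-+ d (λ n → fromℕ p * D c β n - fromℕ p * β n - D (p ℕ.* c) β n) (D p β) n)
        (cong (_+ E d (D p β) n) (trans (E-- d (λ n → fromℕ p * D c β n - fromℕ p * β n) (D (p ℕ.* c) β) n)
          (cong (_- E d (D (p ℕ.* c) β) n) (trans (E-- d (λ n → fromℕ p * D c β n) (λ n → fromℕ p * β n) n)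
            (cong₂ _-_ (E-* d (fromℕ p) (D c β) n) (E-* d (fromℕ p) β n))))))
      E-pc : ∀ n → E d (D (p ℕ.* c) β) n ≡ D (p ℕ.* c) β n + fromℕ p * fromℕ c * N (P 0) n
      E-pc n = begin
        E d (D (p ℕ.* c) β) n
          ≡⟨ cong (λ k → E k (D (p ℕ.* c) β) n) (trans (ℕ.*-comm c p) (sym (ℕ.*-identityʳ (p ℕ.* c)))) ⟩
        E (p ℕ.* c ℕ.* 1) (D (p ℕ.* c) β) n
          ≡⟨ E-D-bernoulli (p ℕ.* c) 1 n ⟩
        D (p ℕ.* c) β n + fromℕ (p ℕ.* c) * (0ℚ + N (P (p ℕ.* c ℕ.* 0)) n)
          ≡⟨ cong₂ (λ x y → D (p ℕ.* c) β n + x * y) (fromℕ-* p c)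
               (trans (+-identityˡ _) (cong (λ k → N (P k) n) (ℕ.*-zeroʳ (p ℕ.* c)))) ⟩
        D (p ℕ.* c) β n + fromℕ p * fromℕ c * N (P 0) n ∎
      E-p : ∀ n → E d (D p β) n ≡ D p β n + fromℕ p * ∑ c (λ i → N (P (p ℕ.* i)) n)
      E-p n = trans (cong (λ k → E k (D p β) n) (ℕ.*-comm c p)) (E-D-bernoulli p c n)
      collect : ∀ p c x b y z s t u v →
        (p * (x + c * s) - p * (b + t) - (y + p * c * u) + (z + p * v)) - (p * x - p * b - y + z) ≡
        (c * s - t - c * u + v) * p
      collect = solve-∀ ℚ-ring

    -- Multiplication by 1 + y + ⋯ + y^(c-1), which is (e^(cpz) - 1)/(y - 1) for y = e^(pz).
    Φ : Seq → Seq
    Φ a n = ∑ c λ i → E (i ℕ.* p) a n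

    telescope : ∀ m (a : Seq) n → E p (λ n → ∑ m λ i → E (i ℕ.* p) a n) n - ∑ m (λ i → E (i ℕ.* p) a n) ≡
                E (m ℕ.* p) a n - a n
    telescope zero    a n = trans (cong (_- 0ℚ) (E-zero p n)) (sym (trans (cong (_- a n) (E-0 a n)) (x-x (a n))))
      where
      x-x : ∀ x → x - x ≡ 0ℚ - 0ℚ
      x-x = solve-∀ ℚ-ring
    telescope (suc m) a n = begin
      E p (λ n → s n + e n) n - (s n + e n)        ≡⟨ cong (_- (s n + e n)) (E-+ p s e n) ⟩
      E p s n + E p e n - (s n + e n)              ≡⟨ regroup (E p s n) (E p e n) (s n) (e n) ⟩
      E p s n - s n + (E p e n - e n)              ≡⟨ cong₂ (λ x y → x + (y - e n)) (telescope m a n) (E-E p (m ℕ.* p) a n) ⟩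
      e n - a n + (E (suc m ℕ.* p) a n - e n)      ≡⟨ cancel (e n) (a n) (E (suc m ℕ.* p) a n) ⟩
      E (suc m ℕ.* p) a n - a n                    ∎
      where
      s e : Seq
      s n = ∑ m λ i → E (i ℕ.* p) a n
      e = E (m ℕ.* p) a
      regroup : ∀ x y z w → x + y - (z + w) ≡ x - z + (y - w)
      regroup = solve-∀ ℚ-ring
      cancel : ∀ x y z → x - y + (z - x) ≡ z - y
      cancel = solve-∀ ℚ-ring

    E-chain : ∀ r q n → E p (chain p r q) n - chain p r q n ≡ P (r ℕ.+ q ℕ.* p) n - P r n
    E-chain r q n = begin
      E p (chain p r q) n - chain p r q n
        ≡⟨ cong₂ _-_ (E-cong p chain≗ n) (chain≗ n) ⟩
      E p (λ n → ∑ q λ i → E (i ℕ.* p) (P r) n) n - ∑ q (λ i → E (i ℕ.* p) (P r) n)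
        ≡⟨ telescope q (P r) n ⟩
      E (q ℕ.* p) (P r) n - P r n
        ≡⟨ cong (_- P r n) (trans (E-P (q ℕ.* p) r n) (cong (λ k → P k n) (ℕ.+-comm (q ℕ.* p) r))) ⟩
      P (r ℕ.+ q ℕ.* p) n - P r n ∎
      where
      chain≗ : ∀ n → chain p r q n ≡ ∑ q (λ i → E (i ℕ.* p) (P r) n)
      chain≗ n = ∑-cong q λ i _ → trans (cong (λ k → P k n) (ℕ.+-comm r (i ℕ.* p))) (sym (E-P (i ℕ.* p) r n))

    -- Multiplication by c permutes the residues modulo p; r and q are the
    -- remainder and quotient of c j by p.
    module _ (r q : ℕ → ℕ) (r0 : r 0 ≡ 0) (q0 : q 0 ≡ 0)
             (division : ∀ j → j ℕ.< p → c ℕ.* j ≡ r j ℕ.+ q j ℕ.* p)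
             (permutes : ∀ (f : Seq) → ∑ p f ≡ ∑ p (λ j → f (r j)))
             where

      -- The terms of R in the residue class of r j form e^(rz) (c y^q - 1 - y - ⋯ - y^(c-1)), with
      -- r = r j and q = q j. The bracket vanishes at y = 1; this is its quotient by y - 1, written
      -- with chains.
      ρ-term : ℕ → Seq
      ρ-term j n = fromℕ c * chain p (r j) (q j) n - ∑ c (λ i → chain p (r j) i n)

      ρ : Seq
      ρ n = ∑ p′ λ j → ρ-term (suc j) n

      private
        R-term : ℕ → Seq
        R-term j n = fromℕ c * P (r j ℕ.+ q j ℕ.* p) n - ∑ c (λ i → P (r j ℕ.+ i ℕ.* p) n)

      E-ρ-term : ∀ j n → E p (ρ-term j) n - ρ-term j n ≡ R-term j n
      E-ρ-term j n = begin
        E p (ρ-term j) n - ρ-term j n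
          ≡⟨ cong (_- ρ-term j n) (trans (E-- p _ _ n) (cong₂ _-_ (E-* p (fromℕ c) _ n) (E-∑ p c _ n))) ⟩
        fromℕ c * E p x n - ∑ c (λ i → E p (y i) n) - (fromℕ c * x n - ∑ c (λ i → y i n))
          ≡⟨ regroup (fromℕ c) (E p x n) (∑ c (λ i → E p (y i) n)) (x n) (∑ c (λ i → y i n)) ⟩
        fromℕ c * (E p x n - x n) - (∑ c (λ i → E p (y i) n) - ∑ c (λ i → y i n))
          ≡⟨ cong₂ (λ u v → fromℕ c * u - v) (E-chain (r j) (q j) n)
               (trans (sym (∑-- c _ _)) (trans (∑-cong c λ i _ → E-chain (r j) i n) (∑-- c _ _))) ⟩
        fromℕ c * (P (r j ℕ.+ q j ℕ.* p) n - P (r j) n) - (∑ c (λ i → P (r j ℕ.+ i ℕ.* p) n) - ∑ c (λ _ → P (r j) n))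
          ≡⟨ cong (λ z → fromℕ c * (P (r j ℕ.+ q j ℕ.* p) n - P (r j) n) - (∑ c (λ i → P (r j ℕ.+ i ℕ.* p) n) - z)) (∑-const c (P (r j) n)) ⟩
        fromℕ c * (P (r j ℕ.+ q j ℕ.* p) n - P (r j) n) - (∑ c (λ i → P (r j ℕ.+ i ℕ.* p) n) - fromℕ c * P (r j) n)
          ≡⟨ cancel (fromℕ c) (P (r j ℕ.+ q j ℕ.* p) n) (P (r j) n) (∑ c (λ i → P (r j ℕ.+ i ℕ.* p) n)) ⟩
        R-term j n ∎
        where
        x : Seq
        x = chain p (r j) (q j)
        y : ℕ → Seq
        y i = chain p (r j) i
        regroup : ∀ c a b x y → c * a - b - (c * x - y) ≡ c * (a - x) - (b - y)
        regroup = solve-∀ ℚ-ring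
        cancel : ∀ c a b s → c * (a - b) - (s - c * b) ≡ c * a - s
        cancel = solve-∀ ℚ-ring

      -- Once the exponents are sorted by residues modulo p, the last two summands of R, which stem
      -- from the Euler factor 1 - p^(l-1), cancel exactly the class of 0. This confines ρ to
      -- exponents prime to p.
      R≡∑R-term : ∀ n → R n ≡ ∑ p′ λ j → R-term (suc j) n
      R≡∑R-term n = begin
        R n
          ≡⟨ cong₂ (λ x y → fromℕ c * ∑ p (λ i → P (c ℕ.* i) n) - x - fromℕ c * P 0 n + y) blocks multiples ⟩
        fromℕ c * ∑ p (λ i → P (c ℕ.* i) n) - ∑ p g - fromℕ c * P 0 n + g 0
          ≡⟨ cong (λ x → x - ∑ p g - fromℕ c * P 0 n + g 0)
               (trans (sym (∑-* p (fromℕ c) _)) (∑-cong p λ j j<p → cong (λ k → fromℕ c * P k n) (division j j<p))) ⟩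
        ∑ p (λ j → fromℕ c * P (r j ℕ.+ q j ℕ.* p) n) - ∑ p g - fromℕ c * P 0 n + g 0
          ≡⟨ cong (λ x → ∑ p (λ j → fromℕ c * P (r j ℕ.+ q j ℕ.* p) n) - x - fromℕ c * P 0 n + g 0) (permutes g) ⟩
        ∑ p (λ j → fromℕ c * P (r j ℕ.+ q j ℕ.* p) n) - ∑ p (λ j → g (r j)) - fromℕ c * P 0 n + g 0
          ≡⟨ cong (λ x → x - fromℕ c * P 0 n + g 0) (trans (sym (∑-- p _ _)) (∑-front p′ _)) ⟩
        (fromℕ c * P (r 0 ℕ.+ q 0 ℕ.* p) n - g (r 0)) + ∑ p′ (λ j → R-term (suc j) n) - fromℕ c * P 0 n + g 0
          ≡⟨ cong₂ (λ x y → (fromℕ c * P (x ℕ.+ y ℕ.* p) n - g x) + ∑ p′ (λ j → R-term (suc j) n) - fromℕ c * P 0 n + g 0) r0 q0 ⟩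
        (fromℕ c * P 0 n - g 0) + ∑ p′ (λ j → R-term (suc j) n) - fromℕ c * P 0 n + g 0
          ≡⟨ cancel (fromℕ c * P 0 n) (g 0) _ ⟩
        ∑ p′ (λ j → R-term (suc j) n) ∎
        where
        g : Seq
        g j = ∑ c λ i → P (j ℕ.+ i ℕ.* p) n
        blocks : ∑ (c ℕ.* p) (λ i → P i n) ≡ ∑ p g
        blocks = ∑-blocks c p λ i → P i n
        multiples : ∑ c (λ i → P (p ℕ.* i) n) ≡ g 0
        multiples = ∑-cong c λ i _ → cong (λ k → P k n) (ℕ.*-comm p i)
        cancel : ∀ x y z → (x - y) + z - x + y ≡ z
        cancel = solve-∀ ℚ-ring

      -- Both sides agree after multiplication by e^{pz} − 1, which is not a zero divisor.
      Φ-B* : ∀ n → Φ (B* c p) n ≡ ρ n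
      Φ-B* n = -‿cancel _ _ (E-fixed p (λ n → Φ (B* c p) n - ρ n) fixed n)
        where
        E-ρ : ∀ n → E p ρ n - ρ n ≡ R n
        E-ρ n = begin
          E p ρ n - ρ n
            ≡⟨ cong (_- ρ n) (E-∑ p p′ _ n) ⟩
          ∑ p′ (λ j → E p (ρ-term (suc j)) n) - ρ n
            ≡⟨ ∑-- p′ _ _ ⟨
          ∑ p′ (λ j → E p (ρ-term (suc j)) n - ρ-term (suc j) n)
            ≡⟨ ∑-cong p′ (λ j _ → E-ρ-term (suc j) n) ⟩
          ∑ p′ (λ j → R-term (suc j) n)
            ≡⟨ R≡∑R-term n ⟨
          R n ∎
        fixed : ∀ n → E p (λ n → Φ (B* c p) n - ρ n) n ≡ Φ (B* c p) n - ρ n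
        fixed n = -‿cancel _ _ (begin
          E p (λ n → Φ (B* c p) n - ρ n) n - (Φ (B* c p) n - ρ n)
            ≡⟨ cong (_- (Φ (B* c p) n - ρ n)) (E-- p (Φ (B* c p)) ρ n) ⟩
          E p (Φ (B* c p)) n - E p ρ n - (Φ (B* c p) n - ρ n)
            ≡⟨ regroup (E p (Φ (B* c p)) n) (E p ρ n) (Φ (B* c p) n) (ρ n) ⟩
          (E p (Φ (B* c p)) n - Φ (B* c p) n) - (E p ρ n - ρ n)
            ≡⟨ cong₂ _-_ (trans (telescope c (B* c p) n) (E-B* n)) (E-ρ n) ⟩
          R n - R n
            ≡⟨ x-x (R n) ⟩
          0ℚ ∎)
          where
          regroup : ∀ a b c d → a - b - (c - d) ≡ (a - c) - (b - d)
          regroup = solve-∀ ℚ-ring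
          x-x : ∀ x → x - x ≡ 0ℚ
          x-x = solve-∀ ℚ-ring

-- Congruences between integers and arithmetic modulo a prime.

module Congruences where

  open import Data.Integer.Base hiding (suc)
  open import Data.Integer.Divisibility.Signed
  open import Data.Integer.DivMod using (a≡a%ℕn+[a/ℕn]*n; n%ℕd<d; _%ℕ_; _/ℕ_)
  open import Data.Integer.Properties
  open import Data.Integer.Tactic.RingSolver using (solve-∀)
  open import Data.Nat.Base as ℕ using (ℕ; zero; suc)
  open import Data.Nat.Coprimality using (coprime-Bézout; prime⇒coprime)
  import Data.Nat.Divisibility as ℕ
  open import Data.Nat.GCD using (module Bézout)
  open import Data.Nat.Primality using (Prime; euclidsLemma; prime⇒nonTrivial; prime⇒nonZero)
  import Data.Nat.Properties as ℕ
  open import Data.Product.Base using (∃; _,_)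
  open import Data.Sum.Base using (_⊎_; inj₁; inj₂)
  open import Relation.Binary.PropositionalEquality
  open import Relation.Nullary.Negation using (¬_; contradiction)

  infix 4 _≋_[_]

  -- With x alone on the left, matching the equation with `refl` eliminates x, and each law reduces
  -- to a polynomial identity in the quotients. The quotients themselves are reused in later
  -- computations.
  record _≋_[_] (x y m : ℤ) : Set where
    constructor modulo
    field
      quotient : ℤ
      equality : x ≡ y + m * quotient

  ≡⇒≋ : ∀ {m x y} → x ≡ y → x ≋ y [ m ]
  ≡⇒≋ {m} {x} refl = modulo 0ℤ (lemma x m)
    where
    lemma : ∀ x m → x ≡ x + m * 0ℤ
    lemma = solve-∀

  ≋-sym : ∀ {m x y} → x ≋ y [ m ] → y ≋ x [ m ]
  ≋-sym {m} {x} {y} (modulo q refl) = modulo (- q) (lemma y m q)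
    where
    lemma : ∀ y m q → y ≡ y + m * q + m * - q
    lemma = solve-∀

  ≋-trans : ∀ {m x y z} → x ≋ y [ m ] → y ≋ z [ m ] → x ≋ z [ m ]
  ≋-trans {m} {z = z} (modulo q refl) (modulo r refl) = modulo (r + q) (lemma z m q r)
    where
    lemma : ∀ z m q r → z + m * r + m * q ≡ z + m * (r + q)
    lemma = solve-∀

  ≋-+ : ∀ {m x x′ y y′} → x ≋ x′ [ m ] → y ≋ y′ [ m ] → x + y ≋ x′ + y′ [ m ]
  ≋-+ {m} {x′ = x} {y′ = y} (modulo q refl) (modulo r refl) = modulo (q + r) (lemma x y m q r)
    where
    lemma : ∀ x y m q r → x + m * q + (y + m * r) ≡ x + y + m * (q + r)
    lemma = solve-∀

  ≋-neg : ∀ {m x y} → x ≋ y [ m ] → - x ≋ - y [ m ]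
  ≋-neg {m} {y = y} (modulo q refl) = modulo (- q) (lemma y m q)
    where
    lemma : ∀ y m q → - (y + m * q) ≡ - y + m * - q
    lemma = solve-∀

  ≋-* : ∀ {m x x′ y y′} → x ≋ x′ [ m ] → y ≋ y′ [ m ] → x * y ≋ x′ * y′ [ m ]
  ≋-* {m} {x′ = x} {y′ = y} (modulo q refl) (modulo r refl) = modulo (x * r + y * q + m * q * r) (lemma x y m q r)
    where
    lemma : ∀ x y m q r → (x + m * q) * (y + m * r) ≡ x * y + m * (x * r + y * q + m * q * r)
    lemma = solve-∀

  ≋-^ : ∀ {m x y} n → x ≋ y [ m ] → x ^ n ≋ y ^ n [ m ]
  ≋-^ zero    eq = ≡⇒≋ refl
  ≋-^ (suc n) eq = ≋-* eq (≋-^ n eq)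

  ≋0⇒∣ : ∀ {m x} → x ≋ 0ℤ [ m ] → m ∣ x
  ≋0⇒∣ {m} (modulo q eq) = divides q (trans eq (lemma m q))
    where
    lemma : ∀ m q → 0ℤ + m * q ≡ q * m
    lemma = solve-∀

  ∣⇒≋0 : ∀ {m x} → m ∣ x → x ≋ 0ℤ [ m ]
  ∣⇒≋0 {m} (divides q eq) = modulo q (trans eq (lemma m q))
    where
    lemma : ∀ m q → q * m ≡ 0ℤ + m * q
    lemma = solve-∀

  ∣-resp-≋ : ∀ {m x y} → x ≋ y [ m ] → m ∣ x → m ∣ y
  ∣-resp-≋ x≋y m∣x = ≋0⇒∣ (≋-trans (≋-sym x≋y) (∣⇒≋0 m∣x))

  pos-^ : ∀ j n → + (j ℕ.^ n) ≡ (+ j) ^ n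
  pos-^ j zero    = refl
  pos-^ j (suc n) = trans (pos-* j (j ℕ.^ n)) (cong (+ j *_) (pos-^ j n))

  ≋-residue : ∀ p .{{_ : ℕ.NonZero p}} a → a ≋ + (a %ℕ p) [ + p ]
  ≋-residue p a = modulo (a /ℕ p) (trans (a≡a%ℕn+[a/ℕn]*n a p) (cong (λ x → + (a %ℕ p) + x) (*-comm (a /ℕ p) (+ p))))

  ≋⇒≡ : ∀ {p a b} → a ℕ.< p → b ℕ.< p → + a ≋ + b [ + p ] → a ≡ b
  ≋⇒≡ {p} {a} {b} a<p b<p (modulo q eq) = go q eq
    where
    lemma₀ : ∀ b p → b + p * 0ℤ ≡ b
    lemma₀ = solve-∀
    lemma : ∀ b x → x ≡ b + x - b
    lemma = solve-∀
    ∣a-b∣<p : ∣ a ⊖ b ∣ ℕ.< p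
    ∣a-b∣<p = ℕ.≤-<-trans (∣m⊝n∣≤m⊔n a b) (ℕ.⊔-lub a<p b<p)
    ∣a-b∣ : ∀ q → + a ≡ + b + + p * q → p ℕ.* ∣ q ∣ ≡ ∣ a ⊖ b ∣
    ∣a-b∣ q eq = trans (sym (abs-* (+ p) q)) (cong ∣_∣ (trans (lemma (+ b) (+ p * q))
      (trans (cong (_- + b) (sym eq)) ([+m]-[+n]≡m⊖n a b))))
    large : ∀ q k → ∣ q ∣ ≡ suc k → ¬ + a ≡ + b + + p * q
    large q k ∣q∣≡ eq = ℕ.<⇒≱ ∣a-b∣<p (begin
      p                ≤⟨ ℕ.m≤m*n p (suc k) ⟩
      p ℕ.* suc k      ≡⟨ cong (p ℕ.*_) ∣q∣≡ ⟨
      p ℕ.* ∣ q ∣      ≡⟨ ∣a-b∣ q eq ⟩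
      ∣ a ⊖ b ∣        ∎)
      where open ℕ.≤-Reasoning
    go : ∀ q → + a ≡ + b + + p * q → a ≡ b
    go (+ zero)        eq = +-injective (trans eq (lemma₀ (+ b) (+ p)))
    go q@(+ suc k)     eq = contradiction eq (large q k refl)
    go q@(-[1+ k ])    eq = contradiction eq (large q k refl)

  module _ {p} (p-prime : Prime p) where

    private
      instance
        p≢0 : ℕ.NonZero p
        p≢0 = prime⇒nonZero p-prime

    euclid : ∀ x y → + p ∣ x * y → (+ p ∣ x) ⊎ (+ p ∣ y)
    euclid x y p∣xy with euclidsLemma ∣ x ∣ ∣ y ∣ p-prime (subst (p ℕ.∣_) (abs-* x y) (∣⇒∣ᵤ p∣xy))
    ... | inj₁ p∣x = inj₁ (∣ᵤ⇒∣ p∣x)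
    ... | inj₂ p∣y = inj₂ (∣ᵤ⇒∣ p∣y)

    ∤-* : ∀ {x y} → ¬ + p ∣ x → ¬ + p ∣ y → ¬ + p ∣ x * y
    ∤-* {x} {y} p∤x p∤y p∣xy with euclid x y p∣xy
    ... | inj₁ p∣x = p∤x p∣x
    ... | inj₂ p∣y = p∤y p∣y

    ∤1 : ¬ + p ∣ 1ℤ
    ∤1 p∣1 = ℕ.<⇒≱ (ℕ.nonTrivial⇒n>1 p {{prime⇒nonTrivial p-prime}}) (ℕ.∣⇒≤ (∣⇒∣ᵤ p∣1))

    ∤-^ : ∀ {x} n → ¬ + p ∣ x → ¬ + p ∣ x ^ n
    ∤-^ zero    p∤x = ∤1
    ∤-^ (suc n) p∤x = ∤-* p∤x (∤-^ n p∤x)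

    -- Euclid's lemma yields one factor p of x at a time; the induction divides it out.
    ^∣-cancel : ∀ n x y → ¬ + p ∣ y → (+ p) ^ n ∣ x * y → (+ p) ^ n ∣ x
    ^∣-cancel zero    x y p∤y pⁿ∣xy = divides x (sym (*-identityʳ x))
    ^∣-cancel (suc n) x y p∤y pⁿ∣xy with euclid x y (∣-trans (∣m⇒∣m*n ((+ p) ^ n) ∣-refl) pⁿ∣xy)
    ... | inj₂ p∣y = contradiction p∣y p∤y
    ... | inj₁ (divides x′ refl) = subst ((+ p) ^ suc n ∣_) (*-comm (+ p) x′)
          (*-monoʳ-∣ (+ p) (^∣-cancel n x′ y p∤y
            (*-cancelˡ-∣ (+ p) (subst ((+ p) ^ suc n ∣_) (lemma x′ (+ p) y) pⁿ∣xy))))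
      where
      lemma : ∀ x p y → x * p * y ≡ p * (x * y)
      lemma = solve-∀

    private

      inverse-ℕ : ∀ a .{{_ : ℕ.NonZero a}} → a ℕ.< p → ∃ λ b → + a * b ≋ 1ℤ [ + p ]
      inverse-ℕ a a<p with coprime-Bézout (prime⇒coprime p-prime a<p)
      -- In this case Bézout's identity reads 1 + y a = x p, so the inverse of a is -y.
      ... | Bézout.+- x y eq = - + y , modulo (- + x) (let open ≡-Reasoning in begin
        + a * - + y                  ≡⟨ lemma (+ a) (+ y) ⟩
        1ℤ - (1ℤ + + y * + a)        ≡⟨ cong (λ z → 1ℤ - z) (trans (cong (λ z → 1ℤ + z) (sym (pos-* y a))) (trans (cong +_ eq) (pos-* x p))) ⟩
        1ℤ - + x * + p               ≡⟨ lemma′ (+ x) (+ p) ⟩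
        1ℤ + + p * - + x             ∎)
        where
        lemma : ∀ a y → a * - y ≡ 1ℤ - (1ℤ + y * a)
        lemma = solve-∀
        lemma′ : ∀ x p → 1ℤ - x * p ≡ 1ℤ + p * - x
        lemma′ = solve-∀
      ... | Bézout.-+ x y eq = + y , modulo (+ x) (let open ≡-Reasoning in begin
        + a * + y                    ≡⟨ *-comm (+ a) (+ y) ⟩
        + y * + a                    ≡⟨ trans (sym (pos-* y a)) (trans (cong +_ (sym eq)) (cong (λ z → 1ℤ + z) (pos-* x p))) ⟩
        1ℤ + + x * + p               ≡⟨ cong (λ z → 1ℤ + z) (*-comm (+ x) (+ p)) ⟩
        1ℤ + + p * + x               ∎)

    inverse : ∀ a → ¬ + p ∣ a → ∃ λ b → a * b ≋ 1ℤ [ + p ]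
    inverse a p∤a with a %ℕ p in r≡ | ≋-residue p a | n%ℕd<d a p
    ... | zero  | a≋r | _   = contradiction (≋0⇒∣ a≋r) p∤a
    ... | suc r | a≋r | r<p with inverse-ℕ (suc r) r<p
    ... | b , rb≋1 = b , ≋-trans (≋-* a≋r (≡⇒≋ refl)) rb≋1

    ≋-cancelʳ : ∀ {a x y} → ¬ + p ∣ a → x * a ≋ y * a [ + p ] → x ≋ y [ + p ]
    ≋-cancelʳ {a} {x} {y} p∤a eq with inverse a p∤a
    ... | b , ab≋1 = ≋-trans (≋-sym (unit x)) (≋-trans (≋-* eq (≡⇒≋ refl)) (unit y))
      where
      unit : ∀ x → x * a * b ≋ x [ + p ]
      unit x = ≋-trans (≡⇒≋ (*-assoc x a b)) (≋-trans (≋-* (≡⇒≋ {x = x} refl) ab≋1) (≡⇒≋ (*-identityʳ x)))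

-- Fermat's theorem and powers of 1 + p q.

module FermatLittle where

  open Congruences
  open import Algebra.Bundles using (CommutativeMonoid)
  import Algebra.Properties.CommutativeMonoid.Sum as Sum
  open import Data.Fin.Base using (Fin; zero; suc; toℕ; fromℕ<)
  open import Data.Fin.Permutation using (Permutation; permutation)
  open import Data.Fin.Properties using (toℕ-fromℕ<; toℕ-injective; toℕ<n)
  open import Data.Integer.Base hiding (suc; NonZero; _%_; _/_)
  open import Data.Integer.Divisibility.Signed
  open import Data.Integer.DivMod using (_%ℕ_)
  open import Data.Integer.Properties
  open import Data.Integer.Tactic.RingSolver using (solve-∀)
  open import Data.Nat.Base as ℕ using (ℕ; zero; suc; NonZero; _%_)
  open import Data.Nat.DivMod using (m%n<n)
  import Data.Nat.Divisibility as ℕ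
  open import Data.Nat.Primality using (Prime; prime⇒nonTrivial)
  import Data.Nat.Properties as ℕ
  open import Data.Product.Base using (∃; _,_; proj₁; proj₂)
  open import Data.Sum.Base using (inj₁; inj₂)
  open import Relation.Binary.PropositionalEquality
  open import Relation.Nullary.Negation using (¬_; contradiction)

  %-≋ : ∀ n p .{{_ : NonZero p}} → + (n % p) ≋ + n [ + p ]
  %-≋ n p = ≋-sym (≋-residue p (+ n))

  module _ {p′} (p-prime : Prime (suc p′)) where

    private
      p = suc p′

      inverse-% : ∀ c c′ → + c * + c′ ≋ 1ℤ [ + p ] → ∀ i → i ℕ.< p → (c ℕ.* ((c′ ℕ.* i) % p)) % p ≡ i
      inverse-% c c′ cc′≋1 i i<p = ≋⇒≡ (m%n<n (c ℕ.* ((c′ ℕ.* i) % p)) p) i<p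
        (≋-trans (%-≋ (c ℕ.* ((c′ ℕ.* i) % p)) p)
        (≋-trans (≡⇒≋ (pos-* c ((c′ ℕ.* i) % p)))
        (≋-trans (≋-* (≡⇒≋ {x = + c} refl) (≋-trans (%-≋ (c′ ℕ.* i) p) (≡⇒≋ (pos-* c′ i))))
        (≋-trans (≡⇒≋ (sym (*-assoc (+ c) (+ c′) (+ i))))
        (≋-trans (≋-* cc′≋1 (≡⇒≋ {x = + i} refl)) (≡⇒≋ (*-identityˡ (+ i))))))))

    multiplication : ∀ c → ¬ + p ∣ + c → Permutation p p
    multiplication c p∤c = permutation (times c) (times c′)
      (inverts c c′ cc′≋1) (inverts c′ c (≋-trans (≡⇒≋ (*-comm (+ c′) (+ c))) cc′≋1))
      where
      times : ℕ → Fin p → Fin p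
      times c i = fromℕ< (m%n<n (c ℕ.* toℕ i) p)
      b = proj₁ (inverse p-prime (+ c) p∤c)
      c′ = b %ℕ p
      cc′≋1 : + c * + c′ ≋ 1ℤ [ + p ]
      cc′≋1 = ≋-trans (≋-* (≡⇒≋ {x = + c} refl) (≋-sym (≋-residue p b))) (proj₂ (inverse p-prime (+ c) p∤c))
      inverts : ∀ c c′ → + c * + c′ ≋ 1ℤ [ + p ] → ∀ i → times c (times c′ i) ≡ i
      inverts c c′ cc′≋1 i = toℕ-injective (begin
        toℕ (times c (times c′ i))                ≡⟨ toℕ-fromℕ< _ ⟩
        (c ℕ.* toℕ (times c′ i)) % p              ≡⟨ cong (λ k → (c ℕ.* k) % p) (toℕ-fromℕ< _) ⟩
        (c ℕ.* ((c′ ℕ.* toℕ i) % p)) % p          ≡⟨ inverse-% c c′ cc′≋1 (toℕ i) (toℕ<n i) ⟩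
        toℕ i                                     ∎)
        where open ≡-Reasoning

    module _ {a ℓ} (M : CommutativeMonoid a ℓ) where
      open CommutativeMonoid M using (Carrier; _≈_; reflexive) renaming (trans to ≈-trans)
      open Sum M using (sum; sum-permute; sum-cong-≗)

      -- The generality of a commutative monoid serves two purposes: products of integers in
      -- Fermat's theorem and sums of rationals in the construction of ρ.
      sum-multiplication : ∀ c → ¬ + p ∣ + c → ∀ (f : ℕ → Carrier) →
                           sum {p} (λ i → f (toℕ i)) ≈ sum {p} (λ i → f ((c ℕ.* toℕ i) % p))
      sum-multiplication c p∤c f = ≈-trans (sum-permute (λ i → f (toℕ i)) (multiplication c p∤c))
        (reflexive (sum-cong-≗ {p} λ i → cong f (toℕ-fromℕ< (m%n<n (c ℕ.* toℕ i) p))))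

    pos-∤ : ∀ j → suc j ℕ.< p → ¬ + p ∣ + suc j
    pos-∤ j j<p p∣j = ℕ.<⇒≱ j<p (ℕ.∣⇒≤ (∣⇒∣ᵤ p∣j))

    private
      open Sum *-1-commutativeMonoid using () renaming (sum to ∏)

      ∏-∤ : ∀ {n} (f : Fin n → ℤ) → (∀ i → ¬ + p ∣ f i) → ¬ + p ∣ ∏ f
      ∏-∤ {zero}  f p∤f = ∤1 p-prime
      ∏-∤ {suc n} f p∤f = ∤-* p-prime (p∤f zero) (∏-∤ (λ i → f (suc i)) λ i → p∤f (suc i))

      ∏-scale : ∀ {n} c (f g : Fin n → ℤ) → (∀ i → f i ≋ c * g i [ + p ]) → ∏ f ≋ c ^ n * ∏ g [ + p ]
      ∏-scale {zero}  c f g f≋cg = ≡⇒≋ refl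
      ∏-scale {suc n} c f g f≋cg = ≋-trans (≋-* (f≋cg zero) (∏-scale c (λ i → f (suc i)) (λ i → g (suc i)) λ i → f≋cg (suc i)))
        (≡⇒≋ (lemma c (g zero) (c ^ n) (∏ λ i → g (suc i))))
        where
        lemma : ∀ c x d y → c * x * (d * y) ≡ c * d * (x * y)
        lemma = solve-∀

    fermat : ∀ c → ¬ + p ∣ + c → (+ c) ^ p′ ≋ 1ℤ [ + p ]
    fermat c p∤c = ≋-cancelʳ p-prime (∏-∤ (λ i → h (suc (toℕ i))) p∤h)
      (≋-sym (≋-trans (≡⇒≋ products) (∏-scale (+ c) (λ i → h (r (suc (toℕ i)))) (λ i → h (suc (toℕ i))) hr)))
      where
      -- The permutation acts on all residues, 0 included; the value 1 there keeps it out of the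
      -- product.
      h : ℕ → ℤ
      h zero    = 1ℤ
      h (suc j) = + suc j
      r : ℕ → ℕ
      r j = (c ℕ.* j) % p
      p∤h : ∀ (i : Fin p′) → ¬ + p ∣ h (suc (toℕ i))
      p∤h i = pos-∤ (toℕ i) (ℕ.s<s (toℕ<n i))
      r≋ : ∀ j → + r j ≋ + c * + j [ + p ]
      r≋ j = ≋-trans (%-≋ (c ℕ.* j) p) (≡⇒≋ (pos-* c j))
      hr : ∀ (i : Fin p′) → h (r (suc (toℕ i))) ≋ + c * h (suc (toℕ i)) [ + p ]
      hr i with r (suc (toℕ i)) | r≋ (suc (toℕ i))
      ... | zero  | eq = contradiction (≋0⇒∣ (≋-sym eq)) (∤-* p-prime p∤c (p∤h i))
      ... | suc _ | eq = eq
      products : 1ℤ * ∏ {p′} (λ i → h (suc (toℕ i))) ≡ ∏ {p′} (λ i → h (r (suc (toℕ i))))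
      products = trans (sum-multiplication *-1-commutativeMonoid c p∤c h)
        (trans (cong (λ k → h (k % p) * ∏ {p′} (λ i → h (r (suc (toℕ i))))) (ℕ.*-zeroʳ c)) (*-identityˡ _))

  -- The binomial coefficient m (m - 1)/2, free of division.
  triangle : ℕ → ℤ
  triangle zero    = 0ℤ
  triangle (suc m) = triangle m + + m

  2*triangle : ∀ m → + 2 * triangle m ≡ + m * (+ m - 1ℤ)
  2*triangle zero    = refl
  2*triangle (suc m) = trans (lemma (triangle m) (+ m)) (trans (cong (λ x → x + + 2 * + m) (2*triangle m)) (lemma′ (+ m)))
    where
    lemma : ∀ t m → + 2 * (t + m) ≡ + 2 * t + + 2 * m
    lemma = solve-∀
    lemma′ : ∀ m → m * (m - 1ℤ) + + 2 * m ≡ (1ℤ + m) * (1ℤ + m - 1ℤ)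
    lemma′ = solve-∀

  ∣triangle : ∀ {p} → Prime p → ¬ 2 ℕ.∣ p → + p ∣ triangle p
  ∣triangle {p} p-prime p-odd with euclid p-prime (+ 2) (triangle p)
    (subst (+ p ∣_) (sym (2*triangle p)) (∣m⇒∣m*n (+ p - 1ℤ) ∣-refl))
  ... | inj₂ p∣t = p∣t
  ... | inj₁ p∣2 = contradiction (ℕ.∣-reflexive (sym p≡2)) p-odd
    where
    p≡2 : p ≡ 2
    p≡2 = ℕ.≤-antisym (ℕ.∣⇒≤ (∣⇒∣ᵤ p∣2)) (ℕ.nonTrivial⇒n>1 p {{prime⇒nonTrivial p-prime}})

  binomial : ∀ m x → ∃ λ y → (1ℤ + x) ^ m ≡ 1ℤ + + m * x + triangle m * (x * x) + x * x * x * y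
  binomial zero    x = 0ℤ , lemma x
    where
    lemma : ∀ x → 1ℤ ≡ 1ℤ + 0ℤ * x + 0ℤ * (x * x) + x * x * x * 0ℤ
    lemma = solve-∀
  binomial (suc m) x with binomial m x
  ... | y , eq = y + triangle m + x * y , trans (cong ((1ℤ + x) *_) eq) (lemma x (+ m) (triangle m) y)
    where
    lemma : ∀ x m t y → (1ℤ + x) * (1ℤ + m * x + t * (x * x) + x * x * x * y) ≡
            1ℤ + (1ℤ + m) * x + (t + m) * (x * x) + x * x * x * (y + t + x * y)
    lemma = solve-∀

  -- In (1 + x)^p with x = p^(k+1) q′, the cubic remainder is divisible by p^(3k+3), enough for the
  -- modulus p^(k+3). The square contributes only p^(2k+2), too little at k = 0; the missing factor
  -- is supplied by p ∣ p (p - 1)/2, which holds because p is odd.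
  power-lifting : ∀ {p} → Prime p → ¬ 2 ℕ.∣ p → ∀ q k →
    (1ℤ + + p * q) ^ (p ℕ.^ k) ≋ 1ℤ + (+ p) ^ suc k * q [ (+ p) ^ suc (suc k) ]
  power-lifting {p} p-prime p-odd q zero    = ≡⇒≋ (lemma (+ p) q)
    where
    lemma : ∀ p q → (1ℤ + p * q) * 1ℤ ≡ 1ℤ + p * 1ℤ * q
    lemma = solve-∀
  power-lifting {p} p-prime p-odd q (suc k)
    with power-lifting p-prime p-odd q k | ∣triangle p-prime p-odd
  ... | modulo e eq | divides τ t≡ with binomial p (+ p * (+ p) ^ k * (q + + p * e))
  ... | y , b = modulo (e + (+ p) ^ k * τ * (q′ * q′) + (+ p) ^ k * (+ p) ^ k * (q′ * q′ * q′) * y) (begin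
    (1ℤ + + p * q) ^ (p ℕ.* p ℕ.^ k)                            ≡⟨ cong ((1ℤ + + p * q) ^_) (ℕ.*-comm p (p ℕ.^ k)) ⟩
    (1ℤ + + p * q) ^ (p ℕ.^ k ℕ.* p)                            ≡⟨ ^-*-assoc (1ℤ + + p * q) (p ℕ.^ k) p ⟨
    ((1ℤ + + p * q) ^ (p ℕ.^ k)) ^ p                            ≡⟨ cong (_^ p) (trans eq (collect (+ p) ((+ p) ^ k) q e)) ⟩
    (1ℤ + x) ^ p                                                ≡⟨ b ⟩
    1ℤ + + p * x + triangle p * (x * x) + x * x * x * y         ≡⟨ cong (λ t → 1ℤ + + p * x + t * (x * x) + x * x * x * y) t≡ ⟩
    1ℤ + + p * x + τ * + p * (x * x) + x * x * x * y            ≡⟨ expand (+ p) ((+ p) ^ k) q e τ y ⟩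
    _                                                           ∎)
    where
    open ≡-Reasoning
    q′ = q + + p * e
    x = + p * (+ p) ^ k * q′
    collect : ∀ p P q e → 1ℤ + p * P * q + p * (p * P) * e ≡ 1ℤ + p * P * (q + p * e)
    collect = solve-∀
    expand : ∀ p P q e τ y →
      1ℤ + p * (p * P * (q + p * e)) + τ * p * (p * P * (q + p * e) * (p * P * (q + p * e)))
        + p * P * (q + p * e) * (p * P * (q + p * e)) * (p * P * (q + p * e)) * y ≡
      1ℤ + p * (p * P) * q + p * (p * (p * P)) *
        (e + P * τ * ((q + p * e) * (q + p * e)) + P * P * ((q + p * e) * (q + p * e) * (q + p * e)) * y)
    expand = solve-∀

-- Finite integral measures on the integers prime to p and their moments.

module Measures where

  open Embedding
  open Sequences
  open Regularisation
  open Congruences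
  open FermatLittle
  open import Defs
  open import Data.Integer.Base as ℤ using (ℤ)
  open import Data.Integer.Divisibility.Signed as ℤ using () renaming (_∣_ to _∣ᶻ_)
  import Data.Integer.Properties as ℤ
  import Data.Integer.Tactic.RingSolver as ℤ
  open import Data.Nat.Base as ℕ using (ℕ; zero; suc; _<_; _^_)
  import Data.Nat.Divisibility as ℕ
  import Data.Nat.Properties as ℕ
  open import Data.Product.Base using (_,_)
  open import Data.Rational.Base hiding (_<_; NonZero)
  open import Data.Rational.Properties using (+-comm; +-identityʳ; *-zeroʳ)
  open import Relation.Binary.PropositionalEquality hiding (J)
  open import Relation.Nullary.Negation using (¬_)
  open import Tactic.RingSolver using (solve-∀)

  infix 4 _≅_[_]

  -- Congruence modulo the subgroup m ℤ of ℚ. The two sides need not be integral themselves, hence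
  -- `≅-*` multiplies by integers only.
  record _≅_[_] (x y : ℚ) (m : ℤ) : Set where
    constructor modulo
    field
      quotient : ℤ
      equality : x ≡ y + ι (m ℤ.* quotient)

  ≋⇒≅ : ∀ {m x y} → x ≋ y [ m ] → ι x ≅ ι y [ m ]
  ≋⇒≅ {m} {y = y} (modulo q refl) = modulo q (ι-+ y (m ℤ.* q))

  ≅⇒≋ : ∀ {m x y} → ι x ≅ ι y [ m ] → x ≋ y [ m ]
  ≅⇒≋ {m} {y = y} (modulo q eq) = modulo q (ι-injective (trans eq (sym (ι-+ y (m ℤ.* q)))))

  ≡⇒≅ : ∀ {m x y} → x ≡ y → x ≅ y [ m ]
  ≡⇒≅ {m} {x} refl = modulo ℤ.0ℤ (sym (trans (cong (λ z → x + ι z) (ℤ.*-zeroʳ m)) (+-identityʳ x)))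

  ≅-trans : ∀ {m x y z} → x ≅ y [ m ] → y ≅ z [ m ] → x ≅ z [ m ]
  ≅-trans {m} {z = z} (modulo q refl) (modulo r refl) = modulo (r ℤ.+ q)
    (trans (assoc z _ _) (cong (z +_) (trans (sym (ι-+ (m ℤ.* r) (m ℤ.* q))) (cong ι (sym (ℤ.*-distribˡ-+ m r q))))))
    where
    assoc : ∀ x y z → x + y + z ≡ x + (y + z)
    assoc = solve-∀ ℚ-ring

  ≅-+ : ∀ {m x x′ y y′} → x ≅ x′ [ m ] → y ≅ y′ [ m ] → x + y ≅ x′ + y′ [ m ]
  ≅-+ {m} {x′ = x} {y′ = y} (modulo q refl) (modulo r refl) = modulo (q ℤ.+ r)
    (trans (regroup x y _ _) (cong (x + y +_) (trans (sym (ι-+ (m ℤ.* q) (m ℤ.* r))) (cong ι (sym (ℤ.*-distribˡ-+ m q r))))))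
    where
    regroup : ∀ x y a b → x + a + (y + b) ≡ x + y + (a + b)
    regroup = solve-∀ ℚ-ring

  ≅-* : ∀ {m x y} z → x ≅ y [ m ] → ι z * x ≅ ι z * y [ m ]
  ≅-* {m} {y = y} z (modulo q refl) = modulo (z ℤ.* q)
    (trans (distrib (ι z) y _) (cong (ι z * y +_) (trans (sym (ι-* z (m ℤ.* q))) (cong ι (swap z m q)))))
    where
    distrib : ∀ x y z → x * (y + z) ≡ x * y + x * z
    distrib = solve-∀ ℚ-ring
    swap : ∀ z m q → z ℤ.* (m ℤ.* q) ≡ m ℤ.* (z ℤ.* q)
    swap = ℤ.solve-∀

  ≅-- : ∀ {m x x′ y y′} → x ≅ x′ [ m ] → y ≅ y′ [ m ] → x - y ≅ x′ - y′ [ m ]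
  ≅-- {x = x} {x′} {y} {y′} x≅ y≅ = ≅-trans (≡⇒≅ (minus x y)) (≅-trans (≅-+ x≅ (≅-* ℤ.-1ℤ y≅)) (≡⇒≅ (sym (minus x′ y′))))
    where
    minus : ∀ x y → x - y ≡ x + (- 1ℚ) * y
    minus = solve-∀ ℚ-ring

  ≅-∑ : ∀ {m} n {f g : Seq} → (∀ i → i < n → f i ≅ g i [ m ]) → ∑ n f ≅ ∑ n g [ m ]
  ≅-∑ zero    f≅g = ≡⇒≅ refl
  ≅-∑ (suc n) f≅g = ≅-+ (≅-∑ n λ i i<n → f≅g i (ℕ.m<n⇒m<1+n i<n)) (f≅g n ℕ.≤-refl)

  -- Moment sequences of finite integral measures on the integers prime to p.
  data Span (p : ℕ) : Seq → Set where
    power : ∀ {X} j → ¬ ℤ.+ p ∣ᶻ ℤ.+ j → X ≗ P j → Span p X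
    null  : ∀ {X} → X ≗ (λ _ → 0ℚ) → Span p X
    plus  : ∀ {X Y Z} → Span p X → Span p Y → Z ≗ (λ n → X n + Y n) → Span p Z
    scale : ∀ {X Z} z → Span p X → Z ≗ (λ n → ι z * X n) → Span p Z

  minus : ∀ {p X Y} → Span p X → Span p Y → Span p (λ n → X n - Y n)
  minus {X = X} {Y} x y = plus x (scale ℤ.-1ℤ y λ _ → refl) λ n → lemma (X n) (Y n)
    where
    lemma : ∀ x y → x - y ≡ x + (- 1ℚ) * y
    lemma = solve-∀ ℚ-ring

  Span-∑ : ∀ {p} m (a : ℕ → Seq) → (∀ i → i < m → Span p (a i)) → Span p (λ n → ∑ m λ i → a i n)
  Span-∑ zero    a s = null λ _ → refl
  Span-∑ (suc m) a s = plus (Span-∑ m a λ i i<m → s i (ℕ.m<n⇒m<1+n i<m)) (s m ℕ.≤-refl) λ _ → refl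

  module _ {p : ℕ} where

    +-multiple : ∀ m j → ℤ.+ (m ℕ.* p ℕ.+ j) ≋ ℤ.+ j [ ℤ.+ p ]
    +-multiple m j = modulo (ℤ.+ m) (trans (cong (ℤ._+ ℤ.+ j) (ℤ.pos-* m p)) (lemma (ℤ.+ m) (ℤ.+ p) (ℤ.+ j)))
      where
      lemma : ∀ m p j → m ℤ.* p ℤ.+ j ≡ j ℤ.+ p ℤ.* m
      lemma = ℤ.solve-∀

    P-shift : ∀ m j n → P (m ℕ.* p ℕ.+ j) n ≅ P j n [ ℤ.+ p ]
    P-shift m j n = ≋⇒≅ (≋-trans (≡⇒≋ (pos-^ (m ℕ.* p ℕ.+ j) n))
      (≋-trans (≋-^ n (+-multiple m j)) (≡⇒≋ (sym (pos-^ j n)))))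

    Span-E : ∀ {X} m → Span p X → Span p (E (m ℕ.* p) X)
    Span-E m (power j p∤j eq) = power (m ℕ.* p ℕ.+ j) (λ p∣ → p∤j (∣-resp-≋ (+-multiple m j) p∣))
      λ n → trans (E-cong (m ℕ.* p) eq n) (E-P (m ℕ.* p) j n)
    Span-E m (null eq) = null λ n → trans (E-cong (m ℕ.* p) eq n) (E-zero (m ℕ.* p) n)
    Span-E m (plus x y eq) = plus (Span-E m x) (Span-E m y) λ n → trans (E-cong (m ℕ.* p) eq n) (E-+ (m ℕ.* p) _ _ n)
    Span-E m (scale z x eq) = scale z (Span-E m x) λ n → trans (E-cong (m ℕ.* p) eq n) (E-* (m ℕ.* p) (ι z) _ n)

    -- Moving each point j of the measure to j + m p changes j^n by a multiple of p, and the weights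
    -- are integers.
    Span-shift : ∀ {X} m → Span p X → ∀ n → E (m ℕ.* p) X n ≅ X n [ ℤ.+ p ]
    Span-shift m (power j p∤j eq) n = ≅-trans (≡⇒≅ (trans (E-cong (m ℕ.* p) eq n) (E-P (m ℕ.* p) j n)))
      (≅-trans (P-shift m j n) (≡⇒≅ (sym (eq n))))
    Span-shift m (null eq) n = ≡⇒≅ (trans (E-cong (m ℕ.* p) eq n) (trans (E-zero (m ℕ.* p) n) (sym (eq n))))
    Span-shift m (plus x y eq) n = ≅-trans (≡⇒≅ (trans (E-cong (m ℕ.* p) eq n) (E-+ (m ℕ.* p) _ _ n)))
      (≅-trans (≅-+ (Span-shift m x n) (Span-shift m y n)) (≡⇒≅ (sym (eq n))))
    Span-shift m (scale z x eq) n = ≅-trans (≡⇒≅ (trans (E-cong (m ℕ.* p) eq n) (E-* (m ℕ.* p) (ι z) _ n)))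
      (≅-trans (≅-* z (Span-shift m x n)) (≡⇒≅ (sym (eq n))))

    Span-chain : ∀ r q → ¬ ℤ.+ p ∣ᶻ ℤ.+ r → Span p (chain p r q)
    Span-chain r q p∤r = Span-∑ q _ λ k _ →
      power (r ℕ.+ k ℕ.* p) (λ p∣ → p∤r (∣-resp-≋ (+-multiple k r) (subst (λ j → ℤ.+ p ∣ᶻ ℤ.+ j) (ℕ.+-comm r (k ℕ.* p)) p∣))) λ _ → refl

  -- Since Σ_{i<c} e^{ipz} has constant term c, the equation Σ_{i<c} e^{ipz} A = ρ
  -- determines c^m times the first m coefficients of A recursively.
  module _ {p c : ℕ} (a ρ : Seq) (ρ-span : Span p ρ)
           (equation : ∀ n → ∑ c (λ i → E (i ℕ.* p) a n) ≡ ρ n) where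

    -- The recursion is c A = ρ - Σ_{i<c} (y^i - 1) A multiplied by c^m. As y^i - 1 has no constant
    -- term, knowing c^m A below degree m gives the right-hand side up to degree m. No division
    -- occurs, so the weights stay integral.
    approximation : ℕ → Seq
    approximation zero    n = 0ℚ
    approximation (suc m) n =
      fromℕ (c ^ m) * ρ n - ∑ c (λ i → E (i ℕ.* p) (approximation m) n - approximation m n)

    approximation-span : ∀ m → Span p (approximation m)
    approximation-span zero    = null λ _ → refl
    approximation-span (suc m) = minus (scale (ℤ.+ (c ^ m)) ρ-span λ _ → refl)
      (Span-∑ c _ λ i _ → minus (Span-E i (approximation-span m)) (approximation-span m))

    -- By `Span-shift`, multiplication by y^i - 1 gives multiples of p, so only the leading term of
    -- the recursion survives.
    approximation-mod : ∀ m n → approximation (suc m) n ≅ fromℕ (c ^ m) * ρ n [ ℤ.+ p ]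
    approximation-mod m n = ≅-trans
      (≅-- {x = fromℕ (c ^ m) * ρ n} (≡⇒≅ refl) (≅-∑ c {g = λ _ → 0ℚ} λ i _ →
        ≅-trans (≅-- (Span-shift i (approximation-span m) n) (≡⇒≅ refl)) (≡⇒≅ (x-x (approximation m n)))))
      (≡⇒≅ (trans (cong (λ z → fromℕ (c ^ m) * ρ n - z) (∑-zero c)) (x-0 (fromℕ (c ^ m) * ρ n))))
      where
      x-x : ∀ x → x - x ≡ 0ℚ
      x-x = solve-∀ ℚ-ring
      x-0 : ∀ x → x - 0ℚ ≡ x
      x-0 = solve-∀ ℚ-ring

    approximation-exact : ∀ m n → n < m → fromℕ (c ^ m) * a n ≡ approximation m n
    approximation-exact (suc m) n (ℕ.s≤s n≤m) = sym (begin
      C * ρ n - ∑ c (λ i → E (i ℕ.* p) W n - W n)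
        ≡⟨ cong (λ z → C * ρ n - z) (∑-cong c λ i _ → difference i) ⟩
      C * ρ n - ∑ c (λ i → C * (E (i ℕ.* p) a n - a n))
        ≡⟨ cong (λ z → C * ρ n - z) (trans (∑-* c C _) (cong (C *_) (∑-- c _ _))) ⟩
      C * ρ n - C * (∑ c (λ i → E (i ℕ.* p) a n) - ∑ c (λ _ → a n))
        ≡⟨ cong₂ (λ x y → C * ρ n - C * (x - y)) (equation n) (∑-const c (a n)) ⟩
      C * ρ n - C * (ρ n - fromℕ c * a n)
        ≡⟨ cancel C (ρ n) (fromℕ c) (a n) ⟩
      fromℕ c * C * a n
        ≡⟨ cong (_* a n) (fromℕ-* c (c ^ m)) ⟨
      fromℕ (c ^ suc m) * a n ∎)
      where
      open ≡-Reasoning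
      C = fromℕ (c ^ m)
      W : Seq
      W = approximation m
      -- The series with coefficients C a - W starts in degree n or later, so e^(hz) leaves its n-th
      -- coefficient unchanged. This includes n = m, where W need not yet agree with C a.
      difference : ∀ i → E (i ℕ.* p) W n - W n ≡ C * (E (i ℕ.* p) a n - a n)
      difference i = begin
        E h W n - W n
          ≡⟨ solve₁ (E h W n) (W n) (C * E h a n) (C * a n) ⟩
        C * E h a n - C * a n + (C * a n - W n) - (C * E h a n - E h W n)
          ≡⟨ cong (λ x → C * E h a n - C * a n + (C * a n - W n) - x)
               (trans (sym (trans (E-- h (λ k → C * a k) W n) (cong (_- E h W n) (E-* h C a n)))) (E-vanish h n _ low)) ⟩
        C * E h a n - C * a n + (C * a n - W n) - (C * a n - W n)
          ≡⟨ solve₂ C (E h a n) (a n) (W n) ⟩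
        C * (E h a n - a n) ∎
        where
        h = i ℕ.* p
        low : ∀ k → k < n → C * a k - W k ≡ 0ℚ
        low k k<n = trans (cong (_- W k) (approximation-exact m k (ℕ.<-≤-trans k<n n≤m))) (x-x (W k))
          where
          x-x : ∀ x → x - x ≡ 0ℚ
          x-x = solve-∀ ℚ-ring
        solve₁ : ∀ x y z w → x - y ≡ z - w + (w - y) - (z - x)
        solve₁ = solve-∀ ℚ-ring
        solve₂ : ∀ c x y z → c * x - c * y + (c * y - z) - (c * y - z) ≡ c * (x - y)
        solve₂ = solve-∀ ℚ-ring
      cancel : ∀ c r k x → c * r - c * (r - k * x) ≡ k * c * x
      cancel = solve-∀ ℚ-ring

-- First-order Kummer congruences for moments.

module SlopeCongruence where

  open Embedding
  open Regularisation
  open Congruences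
  open FermatLittle
  open Measures
  open import Defs
  open import Data.Integer.Base as ℤ using (ℤ)
  open import Data.Integer.Divisibility.Signed as ℤ using () renaming (_∣_ to _∣ᶻ_)
  import Data.Integer.Properties as ℤ
  import Data.Integer.Tactic.RingSolver as ℤ
  open import Data.Nat.Base as ℕ using (ℕ; suc; _^_)
  import Data.Nat.Divisibility as ℕ
  open import Data.Nat.Primality using (Prime)
  import Data.Nat.Properties as ℕ
  open import Data.Product.Base using (∃; _×_; _,_; proj₁; proj₂)
  open import Data.Rational.Base hiding (_<_; NonZero)
  open import Relation.Binary.PropositionalEquality hiding (J)
  open import Relation.Nullary.Negation using (¬_)
  open import Tactic.RingSolver using (solve-∀)

  -- Here π is p and Q is p^k. Since v ≡ 1 modulo p, it alters the increment p^(k+1) J q only by a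
  -- multiple of p^(k+2); this makes the slope independent of t.
  slope-step : ∀ {π Q v w} J q → w ≋ ℤ.1ℤ ℤ.+ π ℤ.* Q ℤ.* q [ π ℤ.* (π ℤ.* Q) ] → v ≋ ℤ.1ℤ [ π ] →
               J ℤ.* (v ℤ.* w) ≋ J ℤ.* v ℤ.+ π ℤ.* Q ℤ.* (J ℤ.* q) [ π ℤ.* (π ℤ.* Q) ]
  slope-step {π} {Q} J q (modulo e refl) (modulo f refl) = modulo
    (J ℤ.* (f ℤ.* q ℤ.+ (ℤ.1ℤ ℤ.+ π ℤ.* f) ℤ.* e)) (lemma J π Q q e f)
    where
    lemma : ∀ J p Q q e f →
      J ℤ.* ((ℤ.1ℤ ℤ.+ p ℤ.* f) ℤ.* (ℤ.1ℤ ℤ.+ p ℤ.* Q ℤ.* q ℤ.+ p ℤ.* (p ℤ.* Q) ℤ.* e)) ≡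
      J ℤ.* (ℤ.1ℤ ℤ.+ p ℤ.* f) ℤ.+ p ℤ.* Q ℤ.* (J ℤ.* q) ℤ.+ p ℤ.* (p ℤ.* Q) ℤ.* (J ℤ.* (f ℤ.* q ℤ.+ (ℤ.1ℤ ℤ.+ p ℤ.* f) ℤ.* e))
    lemma = ℤ.solve-∀

  -- With p′ = p − 1: A (r + p′ t) depends on t, to first order at every scale
  -- p^k, like an affine function of slope p K.
  Kummer : (p p′ : ℕ) → (ℕ → ℤ) → Set
  Kummer p p′ A = ∀ r → ∃ λ K → ∀ k t →
    A (r ℕ.+ p′ ℕ.* (t ℕ.+ p ^ k)) ≋ A (r ℕ.+ p′ ℕ.* t) ℤ.+ (ℤ.+ p) ℤ.^ suc k ℤ.* K [ (ℤ.+ p) ℤ.^ suc (suc k) ]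

  module _ {p p′ : ℕ} (p-prime : Prime p) (p-odd : ¬ 2 ℕ.∣ p)
           (fermat : ∀ j → ¬ ℤ.+ p ∣ᶻ ℤ.+ j → (ℤ.+ j) ℤ.^ p′ ≋ ℤ.1ℤ [ ℤ.+ p ]) where

    -- The slope is j^r times the Fermat quotient q given by j^p′ = 1 + p q.
    power-Kummer : ∀ j → ¬ ℤ.+ p ∣ᶻ ℤ.+ j → Kummer p p′ (λ n → ℤ.+ (j ^ n))
    power-Kummer j p∤j r = J ℤ.* q , congruence
      where
      open _≋_[_] (fermat j p∤j) renaming (quotient to q; equality to fermat-q)
      J = (ℤ.+ j) ℤ.^ r
      u = ℤ.1ℤ ℤ.+ ℤ.+ p ℤ.* q
      split : ∀ s → ℤ.+ (j ^ (r ℕ.+ p′ ℕ.* s)) ≡ J ℤ.* u ℤ.^ s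
      split s = begin
        ℤ.+ (j ^ (r ℕ.+ p′ ℕ.* s))                ≡⟨ pos-^ j (r ℕ.+ p′ ℕ.* s) ⟩
        (ℤ.+ j) ℤ.^ (r ℕ.+ p′ ℕ.* s)              ≡⟨ ℤ.^-distribˡ-+-* (ℤ.+ j) r (p′ ℕ.* s) ⟩
        J ℤ.* (ℤ.+ j) ℤ.^ (p′ ℕ.* s)              ≡⟨ cong (J ℤ.*_) (ℤ.^-*-assoc (ℤ.+ j) p′ s) ⟨
        J ℤ.* ((ℤ.+ j) ℤ.^ p′) ℤ.^ s              ≡⟨ cong (λ x → J ℤ.* x ℤ.^ s) fermat-q ⟩
        J ℤ.* u ℤ.^ s                             ∎
        where open ≡-Reasoning
      u^t≋1 : ∀ t → u ℤ.^ t ≋ ℤ.1ℤ [ ℤ.+ p ]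
      u^t≋1 t = ≋-trans (≋-^ t (modulo q refl)) (≡⇒≋ (ℤ.^-zeroˡ t))
      congruence : ∀ k t → ℤ.+ (j ^ (r ℕ.+ p′ ℕ.* (t ℕ.+ p ^ k))) ≋
                   ℤ.+ (j ^ (r ℕ.+ p′ ℕ.* t)) ℤ.+ (ℤ.+ p) ℤ.^ suc k ℤ.* (J ℤ.* q) [ (ℤ.+ p) ℤ.^ suc (suc k) ]
      congruence k t =
        ≋-trans (≡⇒≋ (trans (split (t ℕ.+ p ^ k)) (cong (J ℤ.*_) (ℤ.^-distribˡ-+-* u t (p ^ k)))))
        (≋-trans (slope-step {ℤ.+ p} {(ℤ.+ p) ℤ.^ k} {u ℤ.^ t} {u ℤ.^ (p ^ k)} J q (power-lifting p-prime p-odd q k) (u^t≋1 t))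
                 (≡⇒≋ (cong (λ x → x ℤ.+ (ℤ.+ p) ℤ.^ suc k ℤ.* (J ℤ.* q)) (sym (split t)))))

    -- The slope K depends linearly on the measure, so the congruence extends from single powers to
    -- integral combinations.
    Span-Kummer : ∀ {X} → Span p X → ∃ λ A → (∀ n → X n ≡ ι (A n)) × Kummer p p′ A
    Span-Kummer (power j p∤j eq) = (λ n → ℤ.+ (j ^ n)) , eq , power-Kummer j p∤j
    Span-Kummer (null eq) = (λ _ → ℤ.0ℤ) , eq , λ r → ℤ.0ℤ , λ k t → ≡⇒≋ (lemma ((ℤ.+ p) ℤ.^ suc k))
      where
      lemma : ∀ x → ℤ.0ℤ ≡ ℤ.0ℤ ℤ.+ x ℤ.* ℤ.0ℤ
      lemma = ℤ.solve-∀
    Span-Kummer (plus {X} {Y} {Z} x y eq) with Span-Kummer x | Span-Kummer y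
    ... | A , A≡ , A-K | B , B≡ , B-K =
      (λ n → A n ℤ.+ B n) , (λ n → trans (eq n) (trans (cong₂ _+_ (A≡ n) (B≡ n)) (sym (ι-+ (A n) (B n))))) ,
      λ r → proj₁ (A-K r) ℤ.+ proj₁ (B-K r) , λ k t →
        ≋-trans (≋-+ (proj₂ (A-K r) k t) (proj₂ (B-K r) k t))
          (≡⇒≋ (regroup (A (r ℕ.+ p′ ℕ.* t)) (B (r ℕ.+ p′ ℕ.* t)) ((ℤ.+ p) ℤ.^ suc k) (proj₁ (A-K r)) (proj₁ (B-K r))))
      where
      regroup : ∀ a b q k l → a ℤ.+ q ℤ.* k ℤ.+ (b ℤ.+ q ℤ.* l) ≡ a ℤ.+ b ℤ.+ q ℤ.* (k ℤ.+ l)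
      regroup = ℤ.solve-∀
    Span-Kummer (scale z x eq) with Span-Kummer x
    ... | A , A≡ , A-K =
      (λ n → z ℤ.* A n) , (λ n → trans (eq n) (trans (cong (ι z *_) (A≡ n)) (sym (ι-* z (A n))))) ,
      λ r → z ℤ.* proj₁ (A-K r) , λ k t →
        ≋-trans (≋-* (≡⇒≋ {x = z} refl) (proj₂ (A-K r) k t))
          (≡⇒≋ (distrib z (A (r ℕ.+ p′ ℕ.* t)) ((ℤ.+ p) ℤ.^ suc k) (proj₁ (A-K r))))
      where
      distrib : ∀ z a q k → z ℤ.* (a ℤ.+ q ℤ.* k) ≡ z ℤ.* a ℤ.+ q ℤ.* (z ℤ.* k)
      distrib = ℤ.solve-∀

-- Integrality of the regularised values.

module IntegralValues where

  open Embedding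
  open Sequences
  open BernoulliNumbers
  open Regularisation
  open Congruences
  open FermatLittle
  open Measures
  open SlopeCongruence
  open import Defs
  open import Data.Integer.Base as ℤ using (ℤ)
  open import Data.Integer.Divisibility.Signed as ℤ using () renaming (_∣_ to _∣ᶻ_)
  import Data.Integer.Properties as ℤ
  import Data.Integer.Tactic.RingSolver as ℤ
  open import Data.Nat.Base as ℕ using (ℕ; zero; suc; _<_; _^_; _%_; _/_)
  import Data.Nat.DivMod as ℕ
  import Data.Nat.Divisibility as ℕ
  open import Data.Nat.Primality using (Prime)
  import Data.Nat.Properties as ℕ
  open import Data.Product.Base using (∃; _×_; _,_)
  open import Data.Rational.Base hiding (_<_; NonZero; _/_)
  open import Data.Rational.Properties using (*-zeroˡ; *-identityʳ; +-0-commutativeMonoid)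
  open import Relation.Binary.PropositionalEquality
  open import Relation.Nullary.Negation using (¬_)
  open import Tactic.RingSolver using (solve-∀)

  private

    combine : ∀ c j y t → ι c * (ι j * ι y) - ι t * ι y ≡ ι ((c ℤ.* j ℤ.- t) ℤ.* y)
    combine c j y t = begin
      ι c * (ι j * ι y) - ι t * ι y      ≡⟨ factor (ι c) (ι j) (ι y) (ι t) ⟩
      (ι c * ι j - ι t) * ι y            ≡⟨ cong (λ z → (z - ι t) * ι y) (ι-* c j) ⟨
      (ι (c ℤ.* j) - ι t) * ι y          ≡⟨ cong (_* ι y) (ι-- (c ℤ.* j) t) ⟨
      ι (c ℤ.* j ℤ.- t) * ι y            ≡⟨ ι-* (c ℤ.* j ℤ.- t) y ⟨
      ι ((c ℤ.* j ℤ.- t) ℤ.* y)          ∎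
      where
      open ≡-Reasoning
      factor : ∀ c j x t → c * (j * x) - t * x ≡ (c * j - t) * x
      factor = solve-∀ ℚ-ring

    weight : ∀ p j y t → t ≋ ℤ.0ℤ [ p ] → ((ℤ.1ℤ ℤ.+ p) ℤ.* j ℤ.- (t ℤ.+ p)) ℤ.* y ≋ j ℤ.* y [ p ]
    weight p j y _ (modulo τ refl) = modulo ((j ℤ.- τ ℤ.- ℤ.1ℤ) ℤ.* y) (lemma p j y τ)
      where
      lemma : ∀ p j y τ → ((ℤ.1ℤ ℤ.+ p) ℤ.* j ℤ.- (ℤ.0ℤ ℤ.+ p ℤ.* τ ℤ.+ p)) ℤ.* y ≡ j ℤ.* y ℤ.+ p ℤ.* ((j ℤ.- τ ℤ.- ℤ.1ℤ) ℤ.* y)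
      lemma = ℤ.solve-∀

  module _ {p : ℕ} where

    chain-mod : ∀ r q n → chain p r q n ≅ fromℕ q * P r n [ ℤ.+ p ]
    chain-mod r q n = ≅-trans
      (≅-∑ q λ k _ → ≅-trans (≡⇒≅ (cong (λ j → P j n) (ℕ.+-comm r (k ℕ.* p)))) (P-shift k r n))
      (≡⇒≅ (∑-const q (P r n)))

    ∑-triangle : ∀ c x → ∑ c (λ i → fromℕ i * x) ≡ ι (triangle c) * x
    ∑-triangle zero    x = sym (*-zeroˡ x)
    ∑-triangle (suc c) x = trans (cong (_+ fromℕ c * x) (∑-triangle c x))
      (trans (distrib (ι (triangle c)) (fromℕ c) x) (cong (_* x) (sym (ι-+ (triangle c) (ℤ.+ c)))))
      where
      distrib : ∀ t c x → t * x + c * x ≡ (t + c) * x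
      distrib = solve-∀ ℚ-ring

    -- For c = p + 1 both remainder and quotient of c j by p are j. Modulo p a chain of q terms is q
    -- j^n, so the total weight of j^n is (p + 1) j - p (p + 1)/2 ≡ j, as p is odd.
    ρ-term-mod : Prime p → ¬ 2 ℕ.∣ p → ∀ j n →
                 fromℕ (suc p) * chain p j j n - ∑ (suc p) (λ i → chain p j i n) ≅ ι (ℤ.+ (j ^ suc n)) [ ℤ.+ p ]
    ρ-term-mod p-prime p-odd j n =
      ≅-trans (≅-- (≅-* (ℤ.+ suc p) (chain-mod j j n)) (≅-∑ (suc p) λ i _ → chain-mod j i n))
      (≅-trans (≡⇒≅ (cong (λ z → fromℕ (suc p) * (fromℕ j * P j n) - z) (∑-triangle (suc p) (P j n))))
      (≅-trans (≡⇒≅ (combine (ℤ.+ suc p) (ℤ.+ j) (ℤ.+ (j ^ n)) (triangle (suc p))))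
      (≅-trans (≋⇒≅ (weight (ℤ.+ p) (ℤ.+ j) (ℤ.+ (j ^ n)) (triangle p) (∣⇒≋0 (∣triangle p-prime p-odd))))
      (≡⇒≅ (cong ι (sym (ℤ.pos-* j (j ^ n))))))))

    power-mod : ∀ {p′} j s → (ℤ.+ j) ℤ.^ p′ ≋ ℤ.1ℤ [ ℤ.+ p ] → ℤ.+ (j ^ (s ℕ.* p′)) ≋ ℤ.1ℤ [ ℤ.+ p ]
    power-mod {p′} j s fermat-j = ≋-trans (≡⇒≋ (trans (cong (λ k → ℤ.+ (j ^ k)) (ℕ.*-comm s p′))
        (trans (pos-^ j (p′ ℕ.* s)) (sym (ℤ.^-*-assoc (ℤ.+ j) p′ s)))))
      (≋-trans (≋-^ s fermat-j) (≡⇒≋ (ℤ.^-zeroˡ s)))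

  module _ {p′ : ℕ} (p-prime : Prime (suc p′)) (p-odd : ¬ 2 ℕ.∣ suc p′) where

    private
      p = suc p′

    module _ (c : ℕ) (p∤c : ¬ ℤ.+ p ∣ᶻ ℤ.+ c) where

      private
        r q : ℕ → ℕ
        r j = (c ℕ.* j) % p
        q j = (c ℕ.* j) / p

        r0 : r 0 ≡ 0
        r0 = cong (_% p) (ℕ.*-zeroʳ c)

        q0 : q 0 ≡ 0
        q0 = cong (_/ p) (ℕ.*-zeroʳ c)

        division : ∀ j → j < p → c ℕ.* j ≡ r j ℕ.+ q j ℕ.* p
        division j _ = ℕ.m≡m%n+[m/n]*n (c ℕ.* j) p

        permutes : ∀ (f : Seq) → ∑ p f ≡ ∑ p (λ j → f (r j))
        permutes f = trans (sym (sum≡∑ p f))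
          (trans (sum-multiplication p-prime +-0-commutativeMonoid c p∤c f) (sum≡∑ p λ j → f (r j)))

        p∤r : ∀ j → j < p′ → ¬ ℤ.+ p ∣ᶻ ℤ.+ r (suc j)
        p∤r j j<p′ p∣r = ∤-* p-prime p∤c (pos-∤ p-prime j (ℕ.s<s j<p′))
          (∣-resp-≋ (≋-trans (%-≋ (c ℕ.* suc j) p) (≡⇒≋ (ℤ.pos-* c (suc j)))) p∣r)

        ρ′ : Seq
        ρ′ = ρ c p′ r q r0 q0 division permutes

        ρ-span : Span p ρ′
        ρ-span = Span-∑ p′ _ λ j j<p′ → minus
          (scale (ℤ.+ c) (Span-chain (r (suc j)) (q (suc j)) (p∤r j j<p′)) λ _ → refl)
          (Span-∑ c _ λ i _ → Span-chain (r (suc j)) i (p∤r j j<p′))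

      integral-values : ∀ M → ∃ λ A → (∀ n → n < M → fromℕ (c ^ M) * B* c p n ≡ ι (A n)) ×
                                      Kummer p p′ A
      integral-values M =
        let A , A≡ , kummer = Span-Kummer {p} {p′} p-prime p-odd (fermat p-prime) (approximation-span (B* c p) ρ′ ρ-span equation M)
        in A , (λ n n<M → trans (approximation-exact (B* c p) ρ′ ρ-span equation M n n<M) (A≡ n)) , kummer
        where
        equation : ∀ n → ∑ c (λ i → E (i ℕ.* p) (B* c p) n) ≡ ρ′ n
        equation = Φ-B* c p′ r q r0 q0 division permutes

    -- Here p − 1 divides l = n + 1 and c = p + 1, so that no residue is permuted.
    integral-values-exceptional : ∀ m n s → n < suc m → suc n ≡ s ℕ.* p′ →
      ∃ λ z → fromℕ (suc p ^ suc m) * B* (suc p) p n ≡ ι z × z ≋ ℤ.-1ℤ [ ℤ.+ p ]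
    integral-values-exceptional m n s n≤m l≡ =
      let A , A≡ , _ = Span-Kummer {p} {p′} p-prime p-odd (fermat p-prime) (approximation-span a ρ′ ρ-span equation (suc m))
      in A n , trans (approximation-exact a ρ′ ρ-span equation (suc m) n n≤m) (A≡ n) ,
         ≅⇒≋ (≅-trans (≡⇒≅ (sym (A≡ n)))
           (≅-trans (approximation-mod a ρ′ ρ-span equation m n)
           (≅-trans (≅-* (ℤ.+ (suc p ^ m)) ρ-mod)
           (≅-trans (≡⇒≅ (sym (ι-* (ℤ.+ (suc p ^ m)) ℤ.-1ℤ))) (≋⇒≅ c^m≋1)))))
      where
      a : Seq
      a = B* (suc p) p
      division : ∀ j → j < p → suc p ℕ.* j ≡ j ℕ.+ j ℕ.* p
      division j _ = cong (j ℕ.+_) (ℕ.*-comm p j)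
      ρ′ : Seq
      ρ′ = ρ (suc p) p′ (λ j → j) (λ j → j) refl refl division (λ _ → refl)
      equation : ∀ n → ∑ (suc p) (λ i → E (i ℕ.* p) a n) ≡ ρ′ n
      equation = Φ-B* (suc p) p′ (λ j → j) (λ j → j) refl refl division (λ _ → refl)
      ρ-span : Span p ρ′
      ρ-span = Span-∑ p′ _ λ j j<p′ → minus
        (scale (ℤ.+ suc p) (Span-chain (suc j) (suc j) (pos-∤ p-prime j (ℕ.s<s j<p′))) λ _ → refl)
        (Span-∑ (suc p) _ λ i _ → Span-chain (suc j) i (pos-∤ p-prime j (ℕ.s<s j<p′)))
      -- By Fermat each of the p - 1 summands j^l is 1 modulo p.
      ρ-mod : ρ′ n ≅ ι ℤ.-1ℤ [ ℤ.+ p ]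
      ρ-mod = ≅-trans
        (≅-∑ p′ {g = λ _ → 1ℚ} λ j j<p′ → ≅-trans (ρ-term-mod p-prime p-odd (suc j) n)
          (≅-trans (≡⇒≅ (cong (λ k → P (suc j) k) l≡)) (≋⇒≅ (power-mod (suc j) s (fermat p-prime (suc j) (pos-∤ p-prime j (ℕ.s<s j<p′)))))))
        (≅-trans (≡⇒≅ (trans (∑-const p′ 1ℚ) (*-identityʳ (fromℕ p′)))) (≋⇒≅ (p′≋-1 (ℤ.+ p′))))
        where
        p′≋-1 : ∀ x → x ≋ ℤ.-1ℤ [ ℤ.1ℤ ℤ.+ x ]
        p′≋-1 x = modulo ℤ.1ℤ (lemma x)
          where
          lemma : ∀ x → x ≡ ℤ.-1ℤ ℤ.+ (ℤ.1ℤ ℤ.+ x) ℤ.* ℤ.1ℤ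
          lemma = ℤ.solve-∀
      c^m≋1 : ℤ.+ (suc p ^ m) ℤ.* ℤ.-1ℤ ≋ ℤ.-1ℤ [ ℤ.+ p ]
      c^m≋1 = ≋-* (≋-trans (≡⇒≋ (pos-^ (suc p) m)) (≋-trans (≋-^ m (c≋1 (ℤ.+ p))) (≡⇒≋ (ℤ.^-zeroˡ m)))) (≡⇒≋ refl)
        where
        c≋1 : ∀ x → ℤ.1ℤ ℤ.+ x ≋ ℤ.1ℤ [ x ]
        c≋1 x = modulo ℤ.1ℤ (cong (ℤ._+_ ℤ.1ℤ) (sym (ℤ.*-identityʳ x)))

-- A multiplier c with c^l ≢ 1 modulo p.

module Nonresidue where

  open Embedding
  open Sequences
  open Congruences
  open Measures
  open FermatLittle
  open import Defs
  open import Data.Fin.Base using (zero; suc; toℕ; fromℕ<)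
  open import Data.Fin.Properties using (all?; ¬∀⟶∃¬; toℕ<n; toℕ-fromℕ<)
  open import Data.Integer.Base as ℤ using (ℤ)
  open import Data.Integer.Divisibility.Signed as ℤ using () renaming (_∣_ to _∣ᶻ_; _∣?_ to _∣ᶻ?_)
  import Data.Integer.Properties as ℤ
  import Data.Integer.Tactic.RingSolver as ℤ
  open import Data.Nat.Base as ℕ using (ℕ; zero; suc; _<_; _≤_; _^_; _!)
  open import Data.Nat.Primality using (Prime)
  import Data.Nat.Properties as ℕ
  open import Data.Product.Base using (∃; _×_; _,_)
  open import Data.Rational.Base hiding (_<_; _≤_; NonZero)
  open import Data.Rational.Properties using (*-identityʳ)
  open import Relation.Binary.PropositionalEquality
  open import Relation.Nullary.Decidable using (yes; no)
  open import Relation.Nullary.Negation using (¬_; contradiction)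
  open import Tactic.RingSolver using (solve-∀)

  -- The k-th forward difference of x ↦ x^n at j. As a sequence in n it is the series e^(jz) (e^z -
  -- 1)^k, which starts with k! · z^k/k!.
  finiteDifference : (k j : ℕ) → Seq
  finiteDifference zero    j n = P j n
  finiteDifference (suc k) j n = finiteDifference k (suc j) n - finiteDifference k j n

  E-finiteDifference : ∀ k j n → E 1 (finiteDifference k j) n ≡ finiteDifference k (suc j) n
  E-finiteDifference zero    j n = E-P 1 j n
  E-finiteDifference (suc k) j n = trans (E-- 1 (finiteDifference k (suc j)) (finiteDifference k j) n)
    (cong₂ _-_ (E-finiteDifference k (suc j) n) (E-finiteDifference k j n))

  finiteDifference-vanish : ∀ k j n → n < k → finiteDifference k j n ≡ 0ℚ
  finiteDifference-vanish (suc k) j n (ℕ.s≤s n≤k) = trans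
    (cong (_- finiteDifference k j n) (trans (sym (E-finiteDifference k j n))
      (E-vanish 1 n (finiteDifference k j) λ i i<n → finiteDifference-vanish k j i (ℕ.<-≤-trans i<n n≤k))))
    (x-x (finiteDifference k j n))
    where
    x-x : ∀ x → x - x ≡ 0ℚ
    x-x = solve-∀ ℚ-ring

  finiteDifference-top : ∀ k j → finiteDifference k j k ≡ fromℕ (k !)
  finiteDifference-top zero    j = refl
  finiteDifference-top (suc k) j = begin
    finiteDifference k (suc j) (suc k) - a (suc k)          ≡⟨ cong (_- a (suc k)) (E-finiteDifference k j (suc k)) ⟨
    E 1 a (suc k) - a (suc k)                               ≡⟨ cong (_- a (suc k)) (E-leading 1 k a (finiteDifference-vanish k j)) ⟩
    a (suc k) + fromℕ (suc k ℕ.* 1) * a k - a (suc k)       ≡⟨ cancel (a (suc k)) (fromℕ (suc k ℕ.* 1) * a k) ⟩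
    fromℕ (suc k ℕ.* 1) * a k                               ≡⟨ cong₂ (λ x y → fromℕ x * y) (ℕ.*-identityʳ (suc k)) (finiteDifference-top k j) ⟩
    fromℕ (suc k) * fromℕ (k !)                             ≡⟨ fromℕ-* (suc k) (k !) ⟨
    fromℕ (suc k !)                                         ∎
    where
    open ≡-Reasoning
    a : Seq
    a = finiteDifference k j
    cancel : ∀ x y → x + y - x ≡ y
    cancel = solve-∀ ℚ-ring

  module _ {p′ : ℕ} (p-prime : Prime (suc p′)) where

    private
      p = suc p′

    ∤-! : ∀ k → k < p → ¬ ℤ.+ p ∣ᶻ ℤ.+ (k !)
    ∤-! zero    _   = ∤1 p-prime
    ∤-! (suc k) k<p p∣k! = ∤-* p-prime (pos-∤ p-prime k k<p) (∤-! k (ℕ.<-trans (ℕ.n<1+n k) k<p))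
      (subst (ℤ.+ p ∣ᶻ_) (ℤ.pos-* (suc k) (k !)) p∣k!)

    -- The k-th difference at j involves only the points j, ..., j + k, all of them roots of x^l - 1
    -- modulo p; so x^l may be replaced by x^0, whose differences of positive order vanish.
    finiteDifference-mod : ∀ l → (∀ j → 0 < j → j ≤ p′ → ℤ.+ (j ^ l) ≋ ℤ.1ℤ [ ℤ.+ p ]) →
      ∀ k j → 0 < j → k ℕ.+ j ≤ p′ → finiteDifference k j l ≅ finiteDifference k j 0 [ ℤ.+ p ]
    finiteDifference-mod l roots zero    j 0<j j≤p′ = ≋⇒≅ (roots j 0<j j≤p′)
    finiteDifference-mod l roots (suc k) j 0<j k+j<p′ = ≅--
      (finiteDifference-mod l roots k (suc j) ℕ.z<s (ℕ.≤-trans (ℕ.≤-reflexive (ℕ.+-suc k j)) k+j<p′))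
      (finiteDifference-mod l roots k j 0<j (ℕ.≤-trans (ℕ.n≤1+n _) k+j<p′))

    -- The polynomial x^l − 1 of degree l < p − 1 cannot vanish at 1, …, l + 1
    -- modulo p, because its l-th difference is l!.
    nonresidue : ∀ l → 0 < l → l < p′ → ∃ λ c → ¬ ℤ.+ p ∣ᶻ ℤ.+ c × ¬ ℤ.+ p ∣ᶻ (ℤ.+ c) ℤ.^ l ℤ.- ℤ.1ℤ
    nonresidue l@(suc l-1) 0<l l<p′ with all? {n = p′} (λ i → ℤ.+ p ∣ᶻ? (ℤ.+ suc (toℕ i)) ℤ.^ l ℤ.- ℤ.1ℤ)
    ... | no  ¬roots = let i , ¬root = ¬∀⟶∃¬ p′ _ (λ i → ℤ.+ p ∣ᶻ? (ℤ.+ suc (toℕ i)) ℤ.^ l ℤ.- ℤ.1ℤ) ¬roots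
                       in suc (toℕ i) , pos-∤ p-prime (toℕ i) (ℕ.s<s (toℕ<n i)) , ¬root
    ... | yes roots  = contradiction (≋0⇒∣ (≅⇒≋ l!≅0)) (∤-! l (ℕ.m<n⇒m<1+n l<p′))
      where
      cancel : ∀ x → x ℤ.- ℤ.1ℤ ℤ.+ ℤ.1ℤ ≡ x
      cancel = ℤ.solve-∀
      root : ∀ j → 0 < j → j ≤ p′ → ℤ.+ (j ^ l) ≋ ℤ.1ℤ [ ℤ.+ p ]
      root (suc j) _ j<p′ = ≋-trans (≡⇒≋ (trans (pos-^ (suc j) l) (sym (cancel ((ℤ.+ suc j) ℤ.^ l)))))
        (≋-trans (≋-+ (∣⇒≋0 (subst (λ k → ℤ.+ p ∣ᶻ (ℤ.+ suc k) ℤ.^ l ℤ.- ℤ.1ℤ) (toℕ-fromℕ< j<p′) (roots (fromℕ< j<p′)))) (≡⇒≋ {x = ℤ.1ℤ} refl))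
          (≡⇒≋ refl))
      l!≅0 : ι (ℤ.+ (l !)) ≅ ι ℤ.0ℤ [ ℤ.+ p ]
      l!≅0 = ≅-trans (≡⇒≅ (sym (finiteDifference-top l 1)))
        (≅-trans (finiteDifference-mod l root l 1 ℕ.z<s (ℕ.≤-trans (ℕ.≤-reflexive (ℕ.+-comm l 1)) l<p′))
          (≡⇒≅ (finiteDifference-vanish l 1 0 0<l)))

-- Euler's function at prime powers.

module Totient where

  open import Defs
  open import Data.List.Base using ([]; _∷_; _∷ʳ_; _++_; applyUpTo; filter; length)
  open import Data.List.Properties using (filter-≐; filter-++; length-++; applyUpTo-∷ʳ; filter-accept; filter-reject)
  open import Data.Nat.Base
  open import Data.Nat.Coprimality using (Coprime; coprime?; coprime-divisor)
  open import Data.Nat.Divisibility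
  open import Data.Nat.Primality using (Prime; prime⇒irreducible; prime⇒nonTrivial)
  open import Data.Nat.Properties
  open import Data.Product.Base using (_,_)
  open import Data.Sum.Base using (inj₁; inj₂)
  open import Relation.Binary.PropositionalEquality
  open import Relation.Nullary.Decidable using (¬?)
  open import Relation.Nullary.Negation using (¬_; contradiction)

  module _ {p′ : ℕ} (p-prime : Prime (suc p′)) where

    private
      p = suc p′

      ∤1ℕ : ¬ p ∣ 1
      ∤1ℕ p∣1 = <⇒≱ (nonTrivial⇒n>1 p {{prime⇒nonTrivial p-prime}}) (∣⇒≤ p∣1)

    coprime⇒∤ : ∀ k m → Coprime m (p ^ suc k) → ¬ p ∣ m
    coprime⇒∤ k m coprime p∣m = ∤1ℕ (∣-reflexive (coprime (p∣m , m∣m*n (p ^ k))))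

    ∤⇒coprime : ∀ k m → ¬ p ∣ m → Coprime m (p ^ k)
    ∤⇒coprime zero    m p∤m (_ , d∣1) = ∣1⇒≡1 d∣1
    ∤⇒coprime (suc k) m p∤m {d} (d∣m , d∣p^1+k) = ∤⇒coprime k m p∤m (d∣m , coprime-divisor coprime-dp d∣p^1+k)
      where
      coprime-dp : Coprime d p
      coprime-dp (e∣d , e∣p) with prime⇒irreducible p-prime e∣p
      ... | inj₁ e≡1  = e≡1
      ... | inj₂ refl = contradiction (∣-trans e∣d d∣m) p∤m

    private
      count : ℕ → ℕ
      count m = length (filter (λ k → ¬? (p ∣? k)) (applyUpTo suc m))

      count-suc : ∀ m → count (suc m) ≡ count m + length (filter (λ k → ¬? (p ∣? k)) (suc m ∷ []))
      count-suc m = trans (cong (λ xs → length (filter P? xs)) (sym (applyUpTo-∷ʳ suc m)))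
        (trans (cong length (filter-++ P? (applyUpTo suc m) (suc m ∷ []))) (length-++ (filter P? (applyUpTo suc m))))
        where P? = λ k → ¬? (p ∣? k)

      count-∤ : ∀ m → ¬ p ∣ suc m → count (suc m) ≡ suc (count m)
      count-∤ m p∤ = trans (count-suc m)
        (trans (cong (λ xs → count m + length xs) (filter-accept (λ k → ¬? (p ∣? k)) p∤)) (+-comm (count m) 1))

      count-∣ : ∀ m → p ∣ suc m → count (suc m) ≡ count m
      count-∣ m p∣ = trans (count-suc m)
        (trans (cong (λ xs → count m + length xs) (filter-reject (λ k → ¬? (p ∣? k)) λ p∤ → p∤ p∣)) (+-identityʳ (count m)))

      count-block : ∀ m i → i ≤ p′ → count (m * p + i) ≡ count (m * p) + i
      count-block m zero    _    = trans (cong count (+-identityʳ (m * p))) (sym (+-identityʳ (count (m * p))))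
      count-block m (suc i) i<p′ = begin
        count (m * p + suc i)      ≡⟨ cong count (+-suc (m * p) i) ⟩
        count (suc (m * p + i))    ≡⟨ count-∤ (m * p + i) p∤ ⟩
        suc (count (m * p + i))    ≡⟨ cong suc (count-block m i (<⇒≤ i<p′)) ⟩
        suc (count (m * p) + i)    ≡⟨ +-suc (count (m * p)) i ⟨
        count (m * p) + suc i      ∎
        where
        open ≡-Reasoning
        p∤ : ¬ p ∣ suc (m * p + i)
        p∤ p∣ = <⇒≱ (s≤s i<p′) (∣⇒≤ (∣m+n∣m⇒∣n (subst (p ∣_) (sym (+-suc (m * p) i)) p∣) (n∣m*n m)))

      count-multiple : ∀ m → count (m * p) ≡ p′ * m
      count-multiple zero    = sym (*-zeroʳ p′)
      count-multiple (suc m) = begin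
        count (p + m * p)          ≡⟨ cong count (trans (+-comm p (m * p)) (+-suc (m * p) p′)) ⟩
        count (suc (m * p + p′))   ≡⟨ count-∣ (m * p + p′) (subst (p ∣_) (+-suc (m * p) p′) (∣m∣n⇒∣m+n (n∣m*n m) ∣-refl)) ⟩
        count (m * p + p′)         ≡⟨ count-block m p′ ≤-refl ⟩
        count (m * p) + p′         ≡⟨ cong (_+ p′) (count-multiple m) ⟩
        p′ * m + p′                ≡⟨ +-comm (p′ * m) p′ ⟩
        p′ + p′ * m                ≡⟨ *-suc p′ m ⟨
        p′ * suc m                 ∎
        where open ≡-Reasoning

    φ-^-suc : ∀ k → φ (p ^ suc k) ≡ p′ * p ^ k
    φ-^-suc k = begin
      φ (p ^ suc k)      ≡⟨ cong length (filter-≐ (λ m → coprime? m (p ^ suc k)) (λ m → ¬? (p ∣? m))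
                              ((λ {m} → coprime⇒∤ k m) , (λ {m} → ∤⇒coprime (suc k) m)) (applyUpTo suc (p ^ suc k))) ⟩
      count (p ^ suc k)  ≡⟨ cong count (*-comm p (p ^ k)) ⟩
      count (p ^ k * p)  ≡⟨ count-multiple (p ^ k) ⟩
      p′ * p ^ k         ∎
      where open ≡-Reasoning

  φ-^ : ∀ {p p′} → p ≡ suc p′ → Prime p → ∀ k → φ (p ^ suc k) ≡ p′ * p ^ k
  φ-^ refl = φ-^-suc

-- Reading divisibility and Δ off an integral model; lifting roots.

module LocalModel where

  open Embedding
  open Congruences
  open import Defs hiding (i)
  open import Data.Integer.Base as ℤ using (ℤ)
  open import Data.Integer.Divisibility.Signed as ℤ using (divides) renaming (_∣_ to _∣ᶻ_)
  open import Data.Integer.DivMod using (_%ℕ_; n%ℕd<d)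
  import Data.Integer.Properties as ℤ
  import Data.Integer.Tactic.RingSolver as ℤ
  open import Data.List.Base using ([]; _∷_; find; upTo; applyUpTo)
  open import Data.Maybe.Base using (fromMaybe; just)
  open import Data.Nat.Base as ℕ using (ℕ; zero; suc; _<_; _≤_; _^_)
  open import Data.Nat.Coprimality using (recompute)
  open import Data.Nat.Divisibility using (_∣_; ∣-reflexive; ∣-trans)
  open import Data.Nat.Primality using (Prime; prime⇒nonZero)
  import Data.Nat.Properties as ℕ
  open import Data.Product.Base using (∃; _×_; _,_; proj₁; proj₂)
  open import Data.Rational.Base hiding (_<_; _≤_; NonZero)
  open import Data.Rational.Properties using (*-identityʳ; *-identityˡ; *-comm; *-assoc; +-identityˡ)
  open import Relation.Binary.PropositionalEquality
  open import Relation.Nullary.Decidable using (yes; no)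
  open import Relation.Nullary.Negation using (¬_; contradiction)
  import Data.Sum.Base as Sum
  open import Relation.Unary using (Decidable)
  open import Tactic.RingSolver using (solve-∀)

  -- `residue` is a search, so two residues agree as soon as the same d satisfy both congruences.
  find-cong : ∀ {P Q : ℕ → Set} (P? : Decidable P) (Q? : Decidable Q) →
              (∀ x → P x → Q x) → (∀ x → Q x → P x) → ∀ xs → find P? xs ≡ find Q? xs
  find-cong P? Q? P⇒Q Q⇒P []       = refl
  find-cong P? Q? P⇒Q Q⇒P (x ∷ xs) with P? x | Q? x
  ... | yes Px | yes Qx = refl
  ... | yes Px | no ¬Qx = contradiction (P⇒Q x Px) ¬Qx
  ... | no ¬Px | yes Qx = contradiction (Q⇒P x Qx) ¬Px
  ... | no ¬Px | no ¬Qx = find-cong P? Q? P⇒Q Q⇒P xs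

  find-accept : ∀ {P : ℕ → Set} (P? : Decidable P) x xs → P x → find P? (x ∷ xs) ≡ just x
  find-accept P? x xs Px with P? x
  ... | yes _  = refl
  ... | no ¬Px = contradiction Px ¬Px

  residue-0 : ∀ p .{{_ : ℕ.NonZero p}} q → Congruent p (fromℕ 0) q → residue p q ≡ 0
  residue-0 (suc p′) q 0≡q =
    cong (fromMaybe 0) (find-accept (λ d → congruent? (suc p′) (fromℕ d) q) 0 (applyUpTo suc p′) 0≡q)

  module _ {p} (p-prime : Prime p) where

    private
      instance
        p≢0 : ℕ.NonZero p
        p≢0 = prime⇒nonZero p-prime

      numerator-coprime : ∀ q → ℤ.+ p ∣ᶻ ↥ q → ¬ ℤ.+ p ∣ᶻ ↧ q
      numerator-coprime (mkℚ _ _ coprime) p∣↥ p∣↧ = ∤1 p-prime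
        (ℤ.∣ᵤ⇒∣ (∣-reflexive (recompute coprime (ℤ.∣⇒∣ᵤ p∣↥ , ℤ.∣⇒∣ᵤ p∣↧))))

    -- A reduced numerator divisible by p leaves a denominator prime to p, which can be cancelled
    -- from z ↧q = ↥q u. Here u may be any integer, as required for the exceptional indices, where
    -- it is divisible by p.
    ^∣ℚ⇒^∣ : ∀ k q {u z} → q * ι u ≡ ι z → (p ^ suc k) ∣ℚ q → (ℤ.+ p) ℤ.^ suc k ∣ᶻ z
    ^∣ℚ⇒^∣ k q {u} {z} eq p^k∣q = ^∣-cancel p-prime (suc k) z (↧ q)
      (numerator-coprime q (ℤ.∣-trans (ℤ.∣m⇒∣m*n ((ℤ.+ p) ℤ.^ k) ℤ.∣-refl) p^k∣↥))
      (subst ((ℤ.+ p) ℤ.^ suc k ∣ᶻ_) (cross-multiply q u z eq) (ℤ.∣m⇒∣m*n u p^k∣↥))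
      where
      p^k∣↥ : (ℤ.+ p) ℤ.^ suc k ∣ᶻ ↥ q
      p^k∣↥ = subst (_∣ᶻ ↥ q) (pos-^ p (suc k)) (ℤ.∣ᵤ⇒∣ p^k∣q)

    ^∣⇒^∣ℚ : ∀ k q {u z} → q * ι u ≡ ι z → ¬ ℤ.+ p ∣ᶻ u → (ℤ.+ p) ℤ.^ k ∣ᶻ z → (p ^ k) ∣ℚ q
    ^∣⇒^∣ℚ k q {u} {z} eq p∤u p^k∣z = ℤ.∣⇒∣ᵤ (subst (_∣ᶻ ↥ q) (sym (pos-^ p k))
      (^∣-cancel p-prime k (↥ q) u p∤u (subst ((ℤ.+ p) ℤ.^ k ∣ᶻ_) (sym (cross-multiply q u z eq)) (ℤ.∣m⇒∣m*n (↧ q) p^k∣z))))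

    integral : ∀ q {u z} → q * ι u ≡ ι z → ¬ ℤ.+ p ∣ᶻ u → p Integral q
    integral q {u} {z} eq p∤u p∣ᵤ↧ = Sum.[ (λ p∣↥ → numerator-coprime q p∣↥ p∣↧) , p∤u ]
      (euclid p-prime (↥ q) u (subst (ℤ.+ p ∣ᶻ_) (sym (cross-multiply q u z eq)) (ℤ.∣n⇒∣m*n z p∣↧)))
      where
      p∣↧ : ℤ.+ p ∣ᶻ ↧ q
      p∣↧ = ℤ.∣ᵤ⇒∣ p∣ᵤ↧

    private

      difference : ∀ d q u z → q * ι u ≡ ι z → (fromℕ d - q) * ι u ≡ ι (ℤ.+ d ℤ.* u ℤ.- z)
      difference d q u z eq = trans (distrib (fromℕ d) q (ι u))
        (trans (cong₂ _-_ (sym (ι-* (ℤ.+ d) u)) eq) (sym (ι-- (ℤ.+ d ℤ.* u) z)))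
        where
        distrib : ∀ x y z → (x - y) * z ≡ x * z - y * z
        distrib = solve-∀ ℚ-ring

    congruent⇒≋ : ∀ q d {u z} → q * ι u ≡ ι z → Congruent p (fromℕ d) q → ℤ.+ d ℤ.* u ≋ z [ ℤ.+ p ]
    congruent⇒≋ q d {u} {z} eq (_ , _ , p∣d-q) = ≋-trans
      (≡⇒≋ (lemma (ℤ.+ d ℤ.* u) z)) (≋-trans (≋-+ (∣⇒≋0 p∣du-z) (≡⇒≋ {x = z} refl)) (≡⇒≋ (ℤ.+-identityˡ z)))
      where
      lemma : ∀ x z → x ≡ x ℤ.- z ℤ.+ z
      lemma = ℤ.solve-∀
      p∣du-z : ℤ.+ p ∣ᶻ ℤ.+ d ℤ.* u ℤ.- z
      p∣du-z = subst (_∣ᶻ ℤ.+ d ℤ.* u ℤ.- z) (ℤ.*-identityʳ (ℤ.+ p))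
        (^∣ℚ⇒^∣ 0 (fromℕ d - q) {u} {ℤ.+ d ℤ.* u ℤ.- z} (difference d q u z eq) (subst (_∣ℚ fromℕ d - q) (sym (ℕ.*-identityʳ p)) p∣d-q))

    ≋⇒congruent : ∀ q d {u z} → q * ι u ≡ ι z → ¬ ℤ.+ p ∣ᶻ u → ℤ.+ d ℤ.* u ≋ z [ ℤ.+ p ] → Congruent p (fromℕ d) q
    ≋⇒congruent q d {u} {z} eq p∤u du≋z =
      integral (fromℕ d) {ℤ.1ℤ} {ℤ.+ d} (*-identityʳ (fromℕ d)) (∤1 p-prime) ,
      integral q {u} {z} eq p∤u ,
      subst (_∣ℚ fromℕ d - q) (ℕ.*-identityʳ p) (^∣⇒^∣ℚ 1 (fromℕ d - q) {u} {ℤ.+ d ℤ.* u ℤ.- z} (difference d q u z eq) p∤u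
        (subst (_∣ᶻ ℤ.+ d ℤ.* u ℤ.- z) (sym (ℤ.*-identityʳ (ℤ.+ p)))
          (≋0⇒∣ (≋-trans (≋-+ du≋z (≡⇒≋ {x = ℤ.- z} refl)) (≡⇒≋ (ℤ.+-inverseʳ z))))))

  -- Multiplying b t by the p-adic unit U t gives the integer A t, and A satisfies
  -- the congruences of Kummer to first order at every scale p^k.
  record Model (p : ℕ) (b : ℕ → ℚ) (M : ℕ) : Set where
    field
      A U    : ℕ → ℤ
      V K    : ℤ
      value  : ∀ t → t < M → b t * ι (U t) ≡ ι (A t)
      U≋V    : ∀ t → U t ≋ V [ ℤ.+ p ]
      p∤V    : ¬ ℤ.+ p ∣ᶻ V
      slope  : ∀ k t → A (t ℕ.+ p ^ k) ≋ A t ℤ.+ (ℤ.+ p) ℤ.^ suc k ℤ.* K [ (ℤ.+ p) ℤ.^ suc (suc k) ]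

    p∤U : ∀ t → ¬ ℤ.+ p ∣ᶻ U t
    p∤U t p∣U = p∤V (∣-resp-≋ (U≋V t) p∣U)

    -- Because K is the same at every t, s steps of length p^k simply add up.
    slopes : ∀ k t s → A (t ℕ.+ s ℕ.* p ^ k) ≋ A t ℤ.+ (ℤ.+ p) ℤ.^ suc k ℤ.* (ℤ.+ s ℤ.* K) [ (ℤ.+ p) ℤ.^ suc (suc k) ]
    slopes k t zero    = ≡⇒≋ (trans (cong A (ℕ.+-identityʳ t)) (lemma (A t) ((ℤ.+ p) ℤ.^ suc k)))
      where
      lemma : ∀ a q → a ≡ a ℤ.+ q ℤ.* ℤ.0ℤ
      lemma = ℤ.solve-∀
    slopes k t (suc s) = ≋-trans (≡⇒≋ (cong A reassociate))
      (≋-trans (slope k (t ℕ.+ s ℕ.* p ^ k))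
      (≋-trans (≋-+ (slopes k t s) (≡⇒≋ refl)) (≡⇒≋ (lemma (A t) ((ℤ.+ p) ℤ.^ suc k) (ℤ.+ s) K))))
      where
      reassociate : t ℕ.+ (p ^ k ℕ.+ s ℕ.* p ^ k) ≡ t ℕ.+ s ℕ.* p ^ k ℕ.+ p ^ k
      reassociate = trans (cong (t ℕ.+_) (ℕ.+-comm (p ^ k) (s ℕ.* p ^ k))) (sym (ℕ.+-assoc t (s ℕ.* p ^ k) (p ^ k)))
      lemma : ∀ a q s K → a ℤ.+ q ℤ.* (s ℤ.* K) ℤ.+ q ℤ.* K ≡ a ℤ.+ q ℤ.* ((ℤ.1ℤ ℤ.+ s) ℤ.* K)
      lemma = ℤ.solve-∀

  module ModelProperties {p} (p-prime : Prime p) {b : ℕ → ℚ} {M : ℕ} (model : Model p b M) where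

    open Model model

    private
      instance
        p≢0 : ℕ.NonZero p
        p≢0 = prime⇒nonZero p-prime

    difference-quotient : ℕ → ℕ → ℚ
    difference-quotient k t = recip (p ^ suc k) * (b (t ℕ.+ p ^ k) - b t)

    numerator-divides : ∀ k t → t < M → (p ^ suc k) ∣ℚ b t → (ℤ.+ p) ℤ.^ suc k ∣ᶻ A t
    numerator-divides k t t<M = ^∣ℚ⇒^∣ p-prime k (b t) {U t} {A t} (value t t<M)

    divides-numerator : ∀ k t → t < M → (ℤ.+ p) ℤ.^ k ∣ᶻ A t → (p ^ k) ∣ℚ b t
    divides-numerator k t t<M = ^∣⇒^∣ℚ p-prime k (b t) {U t} {A t} (value t t<M) (p∤U t)

    private

      clear-denominators : ∀ {t t′ a u u′ k q e f} →
        b t * ι u ≡ ι (a ℤ.* q) → b t′ * ι u′ ≡ ι (a ℤ.* q ℤ.+ q ℤ.* k ℤ.+ ℤ.+ p ℤ.* q ℤ.* e) → u′ ≡ u ℤ.+ f →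
        (b t′ - b t) * ι (u′ ℤ.* u) ≡ ι (((k ℤ.+ ℤ.+ p ℤ.* e) ℤ.* u ℤ.- a ℤ.* f) ℤ.* q)
      clear-denominators {t} {t′} {a} {u} {u′} {k} {q} {e} {f} eq eq′ refl = begin
        (b t′ - b t) * ι (u′ ℤ.* u)
          ≡⟨ cong ((b t′ - b t) *_) (ι-* u′ u) ⟩
        (b t′ - b t) * (ι u′ * ι u)
          ≡⟨ distrib (b t′) (b t) (ι u′) (ι u) ⟩
        b t′ * ι u′ * ι u - b t * ι u * ι u′
          ≡⟨ cong₂ (λ x y → x * ι u - y * ι u′) eq′ eq ⟩
        ι a′ * ι u - ι (a ℤ.* q) * ι u′
          ≡⟨ cong₂ _-_ (ι-* a′ u) (ι-* (a ℤ.* q) u′) ⟨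
        ι (a′ ℤ.* u) - ι (a ℤ.* q ℤ.* u′)
          ≡⟨ ι-- (a′ ℤ.* u) (a ℤ.* q ℤ.* u′) ⟨
        ι (a′ ℤ.* u ℤ.- a ℤ.* q ℤ.* u′)
          ≡⟨ cong ι (collect a q k (ℤ.+ p) e u f) ⟩
        ι (((k ℤ.+ ℤ.+ p ℤ.* e) ℤ.* u ℤ.- a ℤ.* f) ℤ.* q) ∎
        where
        open ≡-Reasoning
        a′ = a ℤ.* q ℤ.+ q ℤ.* k ℤ.+ ℤ.+ p ℤ.* q ℤ.* e
        distrib : ∀ x y v u → (x - y) * (v * u) ≡ x * v * u - y * u * v
        distrib = solve-∀ ℚ-ring
        collect : ∀ a q k p e u f →
          (a ℤ.* q ℤ.+ q ℤ.* k ℤ.+ p ℤ.* q ℤ.* e) ℤ.* u ℤ.- a ℤ.* q ℤ.* (u ℤ.+ f) ≡ ((k ℤ.+ p ℤ.* e) ℤ.* u ℤ.- a ℤ.* f) ℤ.* q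
        collect = ℤ.solve-∀

    -- The variation of the unit U enters through the product A(t) (U(t + p^k) - U(t)). As p^(k+1) ∣
    -- A(t) and p divides the other factor, it disappears modulo p after division by p^(k+1), and
    -- the slope alone remains.
    difference-quotient-value : ∀ k t → t ℕ.+ p ^ k < M → (p ^ suc k) ∣ℚ b t →
      ∃ λ z → difference-quotient k t * ι (U (t ℕ.+ p ^ k) ℤ.* U t) ≡ ι z × z ≋ K ℤ.* V [ ℤ.+ p ]
    difference-quotient-value k t t+p^k<M p^k∣b =
      z , *-cancelʳ-fromℕ (p ^ suc k) {{ℕ.m^n≢0 p (suc k)}} scaled , z≋KV
      where
      open ≡-Reasoning
      open _∣ᶻ_ (numerator-divides k t (ℕ.≤-<-trans (ℕ.m≤m+n t (p ^ k)) t+p^k<M) p^k∣b)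
        renaming (quotient to a; equality to A≡)
      open _≋_[_] (slope k t) renaming (quotient to e; equality to A′≡)
      open _≋_[_] (≋-trans (U≋V (t ℕ.+ p ^ k)) (≋-sym (U≋V t))) renaming (quotient to f; equality to U′≡)
      t′ = t ℕ.+ p ^ k
      q = (ℤ.+ p) ℤ.^ suc k
      z = (K ℤ.+ ℤ.+ p ℤ.* e) ℤ.* U t ℤ.- a ℤ.* (ℤ.+ p ℤ.* f)
      cancel-recip : ∀ x y → recip (p ^ suc k) * x * y * fromℕ (p ^ suc k) ≡ x * y
      cancel-recip x y = trans (lemma (recip (p ^ suc k)) x y (fromℕ (p ^ suc k)))
        (trans (cong (_* (x * y)) (fromℕ*recip (p ^ suc k) {{ℕ.m^n≢0 p (suc k)}})) (*-identityˡ (x * y)))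
        where
        lemma : ∀ r x y f → r * x * y * f ≡ f * r * (x * y)
        lemma = solve-∀ ℚ-ring
      scaled : difference-quotient k t * ι (U t′ ℤ.* U t) * fromℕ (p ^ suc k) ≡ ι z * fromℕ (p ^ suc k)
      scaled = begin
        difference-quotient k t * ι (U t′ ℤ.* U t) * fromℕ (p ^ suc k)
          ≡⟨ cancel-recip (b t′ - b t) (ι (U t′ ℤ.* U t)) ⟩
        (b t′ - b t) * ι (U t′ ℤ.* U t)
          ≡⟨ clear-denominators {t} {t′} {a} {U t} {U t′} {K} {q} {e} {ℤ.+ p ℤ.* f}
               (trans (value t (ℕ.≤-<-trans (ℕ.m≤m+n t (p ^ k)) t+p^k<M)) (cong ι A≡))
               (trans (value t′ t+p^k<M) (cong ι (trans A′≡ (cong (λ x → x ℤ.+ q ℤ.* K ℤ.+ ℤ.+ p ℤ.* q ℤ.* e) A≡))))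
               U′≡ ⟩
        ι (z ℤ.* q)
          ≡⟨ ι-* z q ⟩
        ι z * ι q
          ≡⟨ cong (λ x → ι z * ι x) (pos-^ p (suc k)) ⟨
        ι z * fromℕ (p ^ suc k) ∎
      z≋KV : z ≋ K ℤ.* V [ ℤ.+ p ]
      z≋KV = ≋-trans (modulo (e ℤ.* U t ℤ.- a ℤ.* f) (lemma K (ℤ.+ p) e (U t) a f)) (≋-* (≡⇒≋ {x = K} refl) (U≋V t))
        where
        lemma : ∀ K p e u a f → (K ℤ.+ p ℤ.* e) ℤ.* u ℤ.- a ℤ.* (p ℤ.* f) ≡ K ℤ.* u ℤ.+ p ℤ.* (e ℤ.* u ℤ.- a ℤ.* f)
        lemma = ℤ.solve-∀

    module _ (k t : ℕ) (t+p^k<M : t ℕ.+ p ^ k < M) (p^k∣b : (p ^ suc k) ∣ℚ b t) where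

      private
        z = proj₁ (difference-quotient-value k t t+p^k<M p^k∣b)
        u = U (t ℕ.+ p ^ k) ℤ.* U t
        q = difference-quotient k t

        qu≡z : q * ι u ≡ ι z
        qu≡z = proj₁ (proj₂ (difference-quotient-value k t t+p^k<M p^k∣b))

        z≋KV : z ≋ K ℤ.* V [ ℤ.+ p ]
        z≋KV = proj₂ (proj₂ (difference-quotient-value k t t+p^k<M p^k∣b))

        du≋dVV : ∀ d → ℤ.+ d ℤ.* u ≋ ℤ.+ d ℤ.* V ℤ.* V [ ℤ.+ p ]
        du≋dVV d = ≋-trans (≋-* (≡⇒≋ {x = ℤ.+ d} refl) (≋-* (U≋V (t ℕ.+ p ^ k)) (U≋V t))) (≡⇒≋ (sym (ℤ.*-assoc (ℤ.+ d) V V)))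

      -- Clearing denominators gives d V² ≡ K V. In the resulting condition d V ≡ K neither k nor t
      -- occurs, which is why Δ is the same at all orders.
      congruent⇒slope : ∀ d → Congruent p (fromℕ d) q → ℤ.+ d ℤ.* V ≋ K [ ℤ.+ p ]
      congruent⇒slope d d≡q = ≋-cancelʳ p-prime p∤V
        (≋-trans (≋-sym (du≋dVV d)) (≋-trans (congruent⇒≋ p-prime q d {u} {z} qu≡z d≡q) z≋KV))

      slope⇒congruent : ∀ d → ℤ.+ d ℤ.* V ≋ K [ ℤ.+ p ] → Congruent p (fromℕ d) q
      slope⇒congruent d dV≋K = ≋⇒congruent p-prime q d {u} {z} qu≡z (∤-* p-prime (p∤U (t ℕ.+ p ^ k)) (p∤U t))
        (≋-trans (du≋dVV d) (≋-trans (≋-* dV≋K (≡⇒≋ {x = V} refl)) (≋-sym z≋KV)))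

      slope-nonzero : residue p q ≢ 0 → ¬ ℤ.+ p ∣ᶻ K
      slope-nonzero Δ≢0 p∣K = Δ≢0 (residue-0 p q (slope⇒congruent 0 (≋-trans (≡⇒≋ (ℤ.*-zeroˡ V)) (≋-sym (∣⇒≋0 p∣K)))))

    residue-constant : ∀ k t → t ℕ.+ p ^ k < M → (p ^ suc k) ∣ℚ b t →
                       ∀ k′ t′ → t′ ℕ.+ p ^ k′ < M → (p ^ suc k′) ∣ℚ b t′ →
                       residue p (difference-quotient k t) ≡ residue p (difference-quotient k′ t′)
    residue-constant k t t<M p∣b k′ t′ t′<M p∣b′ = cong (fromMaybe 0) (find-cong _ _
      (λ d d≡q → slope⇒congruent k′ t′ t′<M p∣b′ d (congruent⇒slope k t t<M p∣b d d≡q))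
      (λ d d≡q → slope⇒congruent k t t<M p∣b d (congruent⇒slope k′ t′ t′<M p∣b′ d d≡q))
      (upTo p))

    private

      A-shift : ∀ k t s → A (t ℕ.+ s ℕ.* p ^ k) ≋ A t [ (ℤ.+ p) ℤ.^ suc k ]
      A-shift k t s = let modulo e eq = slopes k t s in
        modulo (ℤ.+ s ℤ.* K ℤ.+ ℤ.+ p ℤ.* e) (trans eq (lemma (A t) ((ℤ.+ p) ℤ.^ suc k) (ℤ.+ s ℤ.* K) (ℤ.+ p) e))
        where
        lemma : ∀ a q x p e → a ℤ.+ q ℤ.* x ℤ.+ p ℤ.* q ℤ.* e ≡ a ℤ.+ q ℤ.* (x ℤ.+ p ℤ.* e)
        lemma = ℤ.solve-∀

    unshift-divides : ∀ k t s → t < M → t ℕ.+ s ℕ.* p ^ k < M → (p ^ suc k) ∣ℚ b (t ℕ.+ s ℕ.* p ^ k) → (p ^ suc k) ∣ℚ b t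
    unshift-divides k t s t<M ts<M p∣b = divides-numerator (suc k) t t<M
      (∣-resp-≋ (A-shift k t s) (numerator-divides k (t ℕ.+ s ℕ.* p ^ k) ts<M p∣b))

    private

      -- Reduces divisibility by p^(k+2) to the linear congruence a + s K ≡ 0 modulo p for the next
      -- digit s.
      A-lift : ∀ k t s (a : ℤ) → A t ≡ a ℤ.* (ℤ.+ p) ℤ.^ suc k →
               ∃ λ e → A (t ℕ.+ s ℕ.* p ^ k) ≡ (ℤ.+ p) ℤ.^ suc k ℤ.* (a ℤ.+ ℤ.+ s ℤ.* K ℤ.+ ℤ.+ p ℤ.* e)
      A-lift k t s a A≡ = e , trans eq (trans (cong (λ x → x ℤ.+ q ℤ.* (ℤ.+ s ℤ.* K) ℤ.+ ℤ.+ p ℤ.* q ℤ.* e) A≡)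
        (lemma a q (ℤ.+ s ℤ.* K) (ℤ.+ p) e))
        where
        open _≋_[_] (slopes k t s) renaming (quotient to e; equality to eq)
        q = (ℤ.+ p) ℤ.^ suc k
        lemma : ∀ a q x p e → a ℤ.* q ℤ.+ q ℤ.* x ℤ.+ p ℤ.* q ℤ.* e ≡ q ℤ.* (a ℤ.+ x ℤ.+ p ℤ.* e)
        lemma = ℤ.solve-∀

      p^k≢0 : ∀ k → ℤ.NonZero ((ℤ.+ p) ℤ.^ k)
      p^k≢0 k = subst ℤ.NonZero (pos-^ p k) (ℕ.m^n≢0 p k)

    module _ (p∤K : ¬ ℤ.+ p ∣ᶻ K) (k t : ℕ) (t<M : t < M) (p^k∣b : (p ^ suc k) ∣ℚ b t) where

      open _∣ᶻ_ (numerator-divides k t t<M p^k∣b) renaming (quotient to a; equality to A≡)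

      lift-exists : (∀ s → s < p → t ℕ.+ s ℕ.* p ^ k < M) →
                    ∃ λ s → s < p × (p ^ suc (suc k)) ∣ℚ b (t ℕ.+ s ℕ.* p ^ k)
      lift-exists bounded = s , s<p , divides-numerator (suc (suc k)) (t ℕ.+ s ℕ.* p ^ k) (bounded s s<p)
        (∣-lift (proj₂ (A-lift k t s a A≡)))
        where
        i = proj₁ (inverse p-prime K p∤K)
        -- The solution -a K⁻¹ of the linear congruence for the digit.
        s = (ℤ.- (a ℤ.* i)) %ℕ p
        s<p : s < p
        s<p = n%ℕd<d (ℤ.- (a ℤ.* i)) p
        sK≋-a : ℤ.+ s ℤ.* K ≋ ℤ.- a [ ℤ.+ p ]
        sK≋-a = ≋-trans (≋-* (≋-sym (≋-residue p (ℤ.- (a ℤ.* i)))) (≡⇒≋ {x = K} refl))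
          (≋-trans (≡⇒≋ (lemma a i K)) (≋-trans (≋-* (≡⇒≋ {x = ℤ.- a} refl) (proj₂ (inverse p-prime K p∤K))) (≡⇒≋ (ℤ.*-identityʳ (ℤ.- a)))))
          where
          lemma : ∀ a i K → ℤ.- (a ℤ.* i) ℤ.* K ≡ ℤ.- a ℤ.* (K ℤ.* i)
          lemma = ℤ.solve-∀
        ∣-lift : ∀ {e} → A (t ℕ.+ s ℕ.* p ^ k) ≡ (ℤ.+ p) ℤ.^ suc k ℤ.* (a ℤ.+ ℤ.+ s ℤ.* K ℤ.+ ℤ.+ p ℤ.* e) →
                 (ℤ.+ p) ℤ.^ suc (suc k) ∣ᶻ A (t ℕ.+ s ℕ.* p ^ k)
        ∣-lift {e} eq = divides (f ℤ.+ e) (trans eq (trans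
          (cong (λ x → (ℤ.+ p) ℤ.^ suc k ℤ.* (a ℤ.+ x ℤ.+ ℤ.+ p ℤ.* e)) sK≡) (lemma a (ℤ.+ p) f e ((ℤ.+ p) ℤ.^ suc k))))
          where
          open _≋_[_] sK≋-a renaming (quotient to f; equality to sK≡)
          lemma : ∀ a p f e q → q ℤ.* (a ℤ.+ (ℤ.- a ℤ.+ p ℤ.* f) ℤ.+ p ℤ.* e) ≡ (f ℤ.+ e) ℤ.* (p ℤ.* q)
          lemma = ℤ.solve-∀

      private
        lift-root : ∀ s → t ℕ.+ s ℕ.* p ^ k < M → (p ^ suc (suc k)) ∣ℚ b (t ℕ.+ s ℕ.* p ^ k) → ℤ.+ s ℤ.* K ≋ ℤ.- a [ ℤ.+ p ]
        lift-root s bounded p^k∣ = root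
          (ℤ.*-cancelˡ-∣ ((ℤ.+ p) ℤ.^ suc k) {{p^k≢0 (suc k)}}
            (subst₂ _∣ᶻ_ (ℤ.*-comm (ℤ.+ p) ((ℤ.+ p) ℤ.^ suc k)) (proj₂ (A-lift k t s a A≡))
              (numerator-divides (suc k) (t ℕ.+ s ℕ.* p ^ k) bounded p^k∣)))
          where
          root : ∀ {e} → ℤ.+ p ∣ᶻ a ℤ.+ ℤ.+ s ℤ.* K ℤ.+ ℤ.+ p ℤ.* e → ℤ.+ s ℤ.* K ≋ ℤ.- a [ ℤ.+ p ]
          root {e} (divides f eq) = modulo (f ℤ.- e) (trans (lemma₁ a (ℤ.+ s ℤ.* K) (ℤ.+ p) e)
            (trans (cong (λ x → x ℤ.- a ℤ.- ℤ.+ p ℤ.* e) eq) (lemma₂ a f (ℤ.+ p) e)))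
            where
            lemma₁ : ∀ a x p e → x ≡ a ℤ.+ x ℤ.+ p ℤ.* e ℤ.- a ℤ.- p ℤ.* e
            lemma₁ = ℤ.solve-∀
            lemma₂ : ∀ a f p e → f ℤ.* p ℤ.- a ℤ.- p ℤ.* e ≡ ℤ.- a ℤ.+ p ℤ.* (f ℤ.- e)
            lemma₂ = ℤ.solve-∀

      lift-unique : ∀ {s s′} → s < p → s′ < p → t ℕ.+ s ℕ.* p ^ k < M → t ℕ.+ s′ ℕ.* p ^ k < M →
                    (p ^ suc (suc k)) ∣ℚ b (t ℕ.+ s ℕ.* p ^ k) → (p ^ suc (suc k)) ∣ℚ b (t ℕ.+ s′ ℕ.* p ^ k) → s ≡ s′
      lift-unique {s} {s′} s<p s′<p b b′ d d′ = ≋⇒≡ s<p s′<p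
        (≋-cancelʳ p-prime p∤K (≋-trans (lift-root s b d) (≋-sym (lift-root s′ b′ d′))))

-- The tower of roots of increasing order.

module LiftingTower where

  open LocalModel
  open import Defs hiding (i)
  open import Data.Integer.Base as ℤ using (ℤ)
  open import Data.Integer.Divisibility.Signed as ℤ using () renaming (_∣_ to _∣ᶻ_)
  open import Data.Nat.Base
  open import Data.Nat.DivMod using (m≡m%n+[m/n]*n; m%n<n; m<n*o⇒m/o<n)
  open import Data.Nat.Divisibility using (_∣_; ∣-trans; n∣m*n)
  open import Data.Nat.Primality using (Prime; prime⇒nonZero)
  open import Data.Nat.Properties
  open import Data.Product.Base using (∃; _×_; _,_; proj₁; proj₂)
  import Data.Rational.Base as ℚ
  open import Data.Rational.Base using (ℚ)
  open import Relation.Binary.PropositionalEquality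
  open import Relation.Nullary.Negation using (¬_)

  module Divisible {p} (p-prime : Prime p) (b : ℕ → ℚ) (models : ∀ M → Model p b M) where

    private
      instance
        p≢0 : NonZero p
        p≢0 = prime⇒nonZero p-prime

    difference-residue : ℕ → ℕ → ℕ
    difference-residue k t = residue p (recip (p ^ suc k) ℚ.* (b (t + p ^ k) ℚ.- b t))

    difference-residue-≡ : ∀ k t {x y} → x ≡ b (t + p ^ k) → y ≡ b t →
                           residue p (recip (p ^ suc k) ℚ.* (x ℚ.- y)) ≡ difference-residue k t
    difference-residue-≡ k t refl refl = refl

    ∣-down : ∀ k t → (p ^ suc k) ∣ℚ b t → (p ^ k) ∣ℚ b t
    ∣-down k t = ∣-trans (n∣m*n p)

    ∣-unshift : ∀ k t s → (p ^ suc k) ∣ℚ b (t + s * p ^ k) → (p ^ suc k) ∣ℚ b t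
    ∣-unshift k t s = unshift-divides k t s (s≤s (m≤m+n t (s * p ^ k))) ≤-refl
      where open ModelProperties p-prime (models (suc (t + s * p ^ k)))

    -- Both residues are read off one model whose bound exceeds all arguments, since K may vary with
    -- the bound.
    difference-residue-constant : ∀ {k t k′ t′} → (p ^ suc k) ∣ℚ b t → (p ^ suc k′) ∣ℚ b t′ →
                                  difference-residue k t ≡ difference-residue k′ t′
    difference-residue-constant {k} {t} {k′} {t′} p∣b p∣b′ =
      residue-constant k t (s≤s (m≤m+n (t + p ^ k) (t′ + p ^ k′))) p∣b k′ t′ (s≤s (m≤n+m (t′ + p ^ k′) (t + p ^ k))) p∣b′
      where open ModelProperties p-prime (models (suc ((t + p ^ k) + (t′ + p ^ k′))))

    module Tower (p∣b₀ : (p ^ 1) ∣ℚ b 0) (Δ≢0 : difference-residue 0 0 ≢ 0) where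

      module Step (k t : ℕ) (p^k∣b : (p ^ suc k) ∣ℚ b t) where

        private
          M = suc (t + p * p ^ k)

          t<M : t < M
          t<M = s≤s (m≤m+n t (p * p ^ k))

          bounded : ∀ s → s < p → t + s * p ^ k < M
          bounded s s<p = s≤s (+-monoʳ-≤ t (*-monoˡ-≤ (p ^ k) (<⇒≤ s<p)))

        open ModelProperties p-prime (models M)

        private
          -- This K belongs to the model with the present bound M. That p does not divide it is
          -- recovered from Δ at order one, whose arguments 0 and p^0 lie below M.
          p∤K : ¬ ℤ.+ p ∣ᶻ Model.K (models M)
          p∤K = slope-nonzero 0 0 (s≤s (≤-trans (>-nonZero⁻¹ (p ^ suc k) {{m^n≢0 p (suc k)}}) (m≤n+m (p * p ^ k) t))) p∣b₀ Δ≢0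

        abstract
          exists : ∃ λ s → s < p × (p ^ suc (suc k)) ∣ℚ b (t + s * p ^ k)
          exists = lift-exists p∤K k t t<M p^k∣b bounded

        unique : ∀ {s s′} → s < p → s′ < p →
                 (p ^ suc (suc k)) ∣ℚ b (t + s * p ^ k) → (p ^ suc (suc k)) ∣ℚ b (t + s′ * p ^ k) → s ≡ s′
        unique s<p s′<p = lift-unique p∤K k t t<M p^k∣b s<p s′<p (bounded _ s<p) (bounded _ s′<p)

      abstract

        root : ∀ k → ∃ λ t → t < p ^ k × (p ^ suc k) ∣ℚ b t
        root zero    = 0 , s≤s z≤n , p∣b₀
        root (suc k) =
          let t , t<p^k , p^k∣b = root k
              s , s<p , p^1+k∣b = Step.exists k t p^k∣b
          in t + s * p ^ k , <-≤-trans (+-monoˡ-< (s * p ^ k) t<p^k) (*-monoˡ-≤ (p ^ k) s<p) , p^1+k∣b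

        τ : ℕ → ℕ
        τ k = proj₁ (root k)

        τ<p^ : ∀ k → τ k < p ^ k
        τ<p^ k = proj₁ (proj₂ (root k))

        τ-∣ : ∀ k → (p ^ suc k) ∣ℚ b (τ k)
        τ-∣ k = proj₂ (proj₂ (root k))

        digit : ℕ → ℕ
        digit k = proj₁ (Step.exists k (τ k) (τ-∣ k))

        digit<p : ∀ k → digit k < p
        digit<p k = proj₁ (proj₂ (Step.exists k (τ k) (τ-∣ k)))

        τ-0 : τ 0 ≡ 0
        τ-0 = refl

        τ-suc : ∀ k → τ (suc k) ≡ τ k + digit k * p ^ k
        τ-suc k = refl

      -- Write t = t′ + s p^k with t′ < p^k. Shifts by multiples of p^k preserve divisibility by
      -- p^(k+1), so t′ is a root of the previous order and equals τ k; the digit s is then settled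
      -- by `Step.unique`.
      τ-unique : ∀ k t → t < p ^ k → (p ^ suc k) ∣ℚ b t → t ≡ τ k
      τ-unique zero    t t<1 _ = trans (n≤0⇒n≡0 (≤-pred t<1)) (sym τ-0)
      τ-unique (suc k) t t<p^1+k p^∣b = trans t≡ (trans (cong₂ (λ x y → x + y * p ^ k) t′≡τ s≡digit) (sym (τ-suc k)))
        where
        instance
          p^k≢0 : NonZero (p ^ k)
          p^k≢0 = m^n≢0 p k
        t′ = t % p ^ k
        s = t / p ^ k
        t≡ : t ≡ t′ + s * p ^ k
        t≡ = m≡m%n+[m/n]*n t (p ^ k)
        s<p : s < p
        s<p = m<n*o⇒m/o<n t<p^1+k
        p^∣b′ : (p ^ suc (suc k)) ∣ℚ b (t′ + s * p ^ k)
        p^∣b′ = subst (λ t → (p ^ suc (suc k)) ∣ℚ b t) t≡ p^∣b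
        t′≡τ : t′ ≡ τ k
        t′≡τ = τ-unique k t′ (m%n<n t (p ^ k)) (∣-unshift k t′ s (∣-down (suc k) (t′ + s * p ^ k) p^∣b′))
        s≡digit : s ≡ digit k
        s≡digit = Step.unique k (τ k) (τ-∣ k) s<p (digit<p k)
          (subst (λ t → (p ^ suc (suc k)) ∣ℚ b (t + s * p ^ k)) t′≡τ p^∣b′)
          (subst (λ t → (p ^ suc (suc k)) ∣ℚ b t) (τ-suc k) (τ-∣ (suc k)))

-- Models for the values B̂(l).

module BernoulliModel where

  open Embedding
  open Regularisation
  open Congruences
  open FermatLittle
  open Measures
  open SlopeCongruence
  open IntegralValues
  open Nonresidue
  open LocalModel
  open import Defs hiding (i)
  open import Data.Integer.Base as ℤ using (ℤ)
  open import Data.Integer.Divisibility.Signed as ℤ using () renaming (_∣_ to _∣ᶻ_)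
  import Data.Integer.Properties as ℤ
  import Data.Integer.Tactic.RingSolver as ℤ
  open import Data.Nat.Base as ℕ using (ℕ; suc; _<_; _^_)
  import Data.Nat.Divisibility as ℕ
  open import Data.Nat.Primality using (Prime)
  import Data.Nat.Properties as ℕ
  open import Data.Product.Base using (_,_; proj₁; proj₂)
  open import Data.Rational.Base hiding (_<_; NonZero)
  open import Relation.Binary.PropositionalEquality
  open import Relation.Nullary.Negation using (¬_)
  open import Tactic.RingSolver using (solve-∀)

  private

    absorb-unit : ∀ {c x u z} → ι c * (x * ι u) ≡ ι z → x * ι (c ℤ.* u) ≡ ι z
    absorb-unit {c} {x} {u} eq = trans (cong (x *_) (ι-* c u)) (trans (lemma x (ι c) (ι u)) eq)
      where
      lemma : ∀ x c u → x * (c * u) ≡ c * (x * u)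
      lemma = solve-∀ ℚ-ring

    -- By Fermat, c^l modulo p depends only on l modulo p′, and p^(l-1) ≡ 0 because l ≥ 2.
    unit-mod : ∀ {p p′} c r t → (ℤ.+ c) ℤ.^ p′ ≋ ℤ.1ℤ [ ℤ.+ p ] →
               unit c p (suc r ℕ.+ p′ ℕ.* t) ≋ (ℤ.+ c) ℤ.^ suc (suc r) ℤ.- ℤ.1ℤ [ ℤ.+ p ]
    unit-mod {p} {p′} c r t fermat-c = ≋-trans
      (≋-* (≋-+ power-mod′ (≡⇒≋ {x = ℤ.- ℤ.1ℤ} refl)) (≋-+ (≡⇒≋ {x = ℤ.1ℤ} refl) (≋-neg p^n≋0)))
      (≡⇒≋ (lemma ((ℤ.+ c) ℤ.^ suc (suc r) ℤ.- ℤ.1ℤ)))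
      where
      lemma : ∀ x → x ℤ.* (ℤ.1ℤ ℤ.- ℤ.0ℤ) ≡ x
      lemma = ℤ.solve-∀
      power-mod′ : ℤ.+ (c ^ (suc (suc r) ℕ.+ p′ ℕ.* t)) ≋ (ℤ.+ c) ℤ.^ suc (suc r) [ ℤ.+ p ]
      power-mod′ = ≋-trans (≡⇒≋ (trans (pos-^ c (suc (suc r) ℕ.+ p′ ℕ.* t))
          (trans (ℤ.^-distribˡ-+-* (ℤ.+ c) (suc (suc r)) (p′ ℕ.* t)) (cong ((ℤ.+ c) ℤ.^ suc (suc r) ℤ.*_) (sym (ℤ.^-*-assoc (ℤ.+ c) p′ t))))))
        (≋-trans (≋-* (≡⇒≋ {x = (ℤ.+ c) ℤ.^ suc (suc r)} refl) (≋-trans (≋-^ t fermat-c) (≡⇒≋ (ℤ.^-zeroˡ t)))) (≡⇒≋ (ℤ.*-identityʳ _)))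
      p^n≋0 : ℤ.+ (p ^ (suc r ℕ.+ p′ ℕ.* t)) ≋ ℤ.0ℤ [ ℤ.+ p ]
      p^n≋0 = modulo (ℤ.+ (p ^ (r ℕ.+ p′ ℕ.* t))) (trans (ℤ.pos-* p (p ^ (r ℕ.+ p′ ℕ.* t))) (sym (ℤ.+-identityˡ _)))

    toModel : ∀ {p p′} → Prime p → ∀ c r M C → ¬ ℤ.+ p ∣ᶻ C → (ℤ.+ c) ℤ.^ p′ ≋ ℤ.1ℤ [ ℤ.+ p ] →
              ¬ ℤ.+ p ∣ᶻ (ℤ.+ c) ℤ.^ suc (suc r) ℤ.- ℤ.1ℤ → (A : ℕ → ℤ) →
              (∀ n → n < suc (suc r ℕ.+ p′ ℕ.* M) → ι C * B* c p n ≡ ι (A n)) → Kummer p p′ A →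
              Model p (λ t → B̂ (suc (suc r) ℕ.+ p′ ℕ.* t)) M
    toModel {p} {p′} p-prime c r M C p∤C fermat-c p∤c^l-1 A values kummer = record
      { A     = λ t → A (suc r ℕ.+ p′ ℕ.* t)
      ; U     = λ t → C ℤ.* unit c p (suc r ℕ.+ p′ ℕ.* t)
      ; V     = C ℤ.* ((ℤ.+ c) ℤ.^ suc (suc r) ℤ.- ℤ.1ℤ)
      ; K     = proj₁ (kummer (suc r))
      ; value = λ t t<M → absorb-unit {C} {B̂ (suc (suc r) ℕ.+ p′ ℕ.* t)} {unit c p (suc r ℕ.+ p′ ℕ.* t)} {A (suc r ℕ.+ p′ ℕ.* t)}
                  (values (suc r ℕ.+ p′ ℕ.* t) (ℕ.s≤s (ℕ.+-monoʳ-≤ (suc r) (ℕ.*-monoʳ-≤ p′ (ℕ.<⇒≤ t<M)))))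
      ; U≋V   = λ t → ≋-* (≡⇒≋ {x = C} refl) (unit-mod {p} {p′} c r t fermat-c)
      ; p∤V   = ∤-* p-prime p∤C p∤c^l-1
      ; slope = proj₂ (kummer (suc r))
      }

  abstract

    bernoulli-model : ∀ {p p′} → p ≡ suc p′ → Prime p → ¬ 2 ℕ.∣ p →
                      ∀ l → 2 ℕ.≤ l → l < p′ → ∀ M → Model p (λ t → B̂ (l ℕ.+ p′ ℕ.* t)) M
    bernoulli-model {p} {p′} refl p-prime p-odd (suc (suc r)) (ℕ.s≤s (ℕ.s≤s _)) l<p′ M =
      let c , p∤c , p∤c^l-1 = nonresidue p-prime (suc (suc r)) ℕ.z<s l<p′
          -- Large enough for every n = l - 1 with l = l₁ + p′ t and t < M.
          M′ = suc (suc r ℕ.+ p′ ℕ.* M)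
          A , values , kummer = integral-values p-prime p-odd c p∤c M′
      in toModel {p} {p′} p-prime c r M (ℤ.+ (c ^ M′))
           (λ p∣ → ∤-^ p-prime M′ p∤c (subst (ℤ.+ p ∣ᶻ_) (pos-^ c M′) p∣))
           (fermat p-prime c p∤c) p∤c^l-1 A values kummer

  -- Some integer multiple of B̂(l) is an integer congruent to -1 modulo p; it would be divisible by
  -- p if the numerator of B̂(l) were.
  ∤B̂-exceptional : ∀ {p p′} → p ≡ suc p′ → Prime p → ¬ 2 ℕ.∣ p →
                   ∀ l s → 0 < l → l ≡ s ℕ.* p′ → ¬ (p ^ 1) ∣ℚ B̂ l
  ∤B̂-exceptional {p} refl p-prime p-odd l@(suc n) s _ l≡ p∣B̂ =
    let z , eq , z≋-1 = integral-values-exceptional p-prime p-odd n n s ℕ.≤-refl l≡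
    in absurd z (absorb-unit {ℤ.+ (suc p ^ suc n)} {B̂ l} {unit (suc p) p n} {z} eq) z≋-1
    where
    absurd : ∀ z → B̂ l * ι (ℤ.+ (suc p ^ suc n) ℤ.* unit (suc p) p n) ≡ ι z → ¬ z ≋ ℤ.-1ℤ [ ℤ.+ p ]
    absurd z eq z≋-1 = ∤1 p-prime (ℤ.∣m⇒∣-m (∣-resp-≋ z≋-1 (subst (_∣ᶻ z) (ℤ.*-identityʳ (ℤ.+ p))
      (^∣ℚ⇒^∣ p-prime 0 (B̂ l) {ℤ.+ (suc p ^ suc n) ℤ.* unit (suc p) p n} {z} eq p∣B̂))))

-- Irregular pairs over a pair of order one.

module IrregularPairs where

  open BernoulliModel
  open LiftingTower
  open Totient
  open import Defs hiding (i)
  open import Data.Nat.Base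
  open import Data.Nat.Divisibility
  open import Data.Nat.DivMod using (m≡m%n+[m/n]*n; m%n<n)
  open import Data.Nat.Primality using (Prime; prime?; ¬prime[0])
  open import Data.Nat.Properties
  open import Data.Product.Base using (∃; ∃₂; _×_; _,_; proj₂)
  import Data.Rational.Base as ℚ
  import Data.Integer.Base as ℤ
  open import Data.Rational.Base using (ℚ)
  open import Data.Sum.Base using (_⊎_; inj₁; inj₂)
  open import Relation.Binary.PropositionalEquality
  open import Relation.Nullary.Decidable using (from-yes; from-no)
  open import Relation.Nullary.Negation using (¬_; contradiction)
  open import Relation.Unary using (_∈_)

  even⊎odd : ∀ n → (2 ∣ n) ⊎ (2 ∣ suc n)
  even⊎odd zero    = inj₁ (2 ∣0)
  even⊎odd (suc n) with even⊎odd n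
  ... | inj₁ 2∣n   = inj₂ (∣m∣n⇒∣m+n (∣-refl {2}) 2∣n)
  ... | inj₂ 2∣1+n = inj₁ 2∣1+n

  even-pred : ∀ {n} → ¬ 2 ∣ suc n → 2 ∣ n
  even-pred {n} odd with even⊎odd n
  ... | inj₁ 2∣n   = 2∣n
  ... | inj₂ 2∣1+n = contradiction 2∣1+n odd

  -- At p = 3 every even index is divisible by p − 1.
  B̂-nonzero : ∀ l → 0 < l → 2 ∣ l → NonZero ℤ.∣ ℚ.↥ B̂ l ∣
  B̂-nonzero l 0<l (divides s l≡) = ≢-nonZero λ eq →
    ∤B̂-exceptional refl (from-yes (prime? 3)) (from-no (2 ∣? 3)) l s 0<l l≡ (subst (3 ^ 1 ∣_) (sym eq) ((3 ^ 1) ∣0))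

  -- Indices are shifted: `index k` is l of order k + 1, and `digit k` is the p-adic digit s of
  -- index k + 2, whose weight is φ(p^(k+1)).
  IrregularTower : (p l₁ : ℕ) → Set
  IrregularTower p l₁ = ∃₂ λ (index digit : ℕ → ℕ) →
    index 0 ≡ l₁ ×
    (∀ k → index (suc k) ≡ index k + digit k * φ (p ^ suc k)) ×
    (∀ k → digit k < p) ×
    (∀ k → (p , index k) ∈ Ψ (suc k)) ×
    (∀ k → Related p 1 (index k) l₁) ×
    (∀ k l → (p , l) ∈ Ψ (suc k) → Related p 1 l l₁ → l ≡ index k) ×
    (∀ k → Δ (suc k) p (index k) ≡ Δ (suc (suc k)) p (index (suc k)))

  module Pairs {p p′} (p≡ : p ≡ suc p′) (p-prime : Prime p) (p-odd : ¬ 2 ∣ p)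
               (l₁ : ℕ) (2≤l₁ : 2 ≤ l₁) (l₁<p′ : l₁ < p′) (2∣l₁ : 2 ∣ l₁) where

    b : ℕ → ℚ
    b t = B̂ (l₁ + p′ * t)

    open Divisible p-prime b (bernoulli-model p≡ p-prime p-odd l₁ 2≤l₁ l₁<p′) public

    private

      φ-p : φ (p ^ 1) ≡ p′
      φ-p = trans (φ-^ p≡ p-prime 0) (*-identityʳ p′)

      instance
        p′≢0 : NonZero p′
        p′≢0 = >-nonZero (≤-<-trans z≤n l₁<p′)

    related-index : ∀ l → Related p 1 l l₁ → ∃ λ t → l ≡ l₁ + p′ * t
    related-index l related with ≤-total l₁ l | subst (_∣ ∣ l - l₁ ∣) φ-p related
    ... | inj₁ l₁≤l | divides t eq = t ,
      trans (sym (m+[n∸m]≡n l₁≤l)) (cong (l₁ +_) (trans (trans (sym (m≤n⇒∣n-m∣≡n∸m l₁≤l)) eq) (*-comm t p′)))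
    ... | inj₂ l≤l₁ | divides zero eq = 0 ,
      trans (∣m-n∣≡0⇒m≡n eq) (sym (trans (cong (l₁ +_) (*-zeroʳ p′)) (+-identityʳ l₁)))
    -- `Related` bounds an unsigned distance. For l ≤ l₁ it is at most l₁ < p′, so it cannot be a
    -- positive multiple of p′.
    ... | inj₂ l≤l₁ | divides (suc t) eq = contradiction l₁<p′ (≤⇒≯ (begin
      p′                 ≤⟨ m≤m+n p′ (t * p′) ⟩
      suc t * p′         ≡⟨ eq ⟨
      ∣ l - l₁ ∣         ≡⟨ m≤n⇒∣m-n∣≡n∸m l≤l₁ ⟩
      l₁ ∸ l             ≤⟨ m∸n≤m l₁ l ⟩
      l₁                 ∎))
      where open ≤-Reasoning

    related : ∀ t → Related p 1 (l₁ + p′ * t) l₁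
    related t = subst₂ _∣_ (sym φ-p) (sym (trans (∣-∣-comm (l₁ + p′ * t) l₁) (∣m-m+n∣≡n l₁ (p′ * t)))) (m∣m*n t)

    -- As l₁ < p′ and φ(p^(k+1)) = p′ p^k, the bound on l = l₁ + p′ t amounts to t < p^k.
    Ψ⇒ : ∀ k t → (p , l₁ + p′ * t) ∈ Ψ (suc k) → t < p ^ k × (p ^ suc k) ∣ℚ b t
    Ψ⇒ k t (_ , _ , _ , l<φ , p^k∣B̂) =
      *-cancelˡ-< p′ t (p ^ k) (≤-<-trans (m≤n+m (p′ * t) l₁) (subst (l₁ + p′ * t <_) (φ-^ p≡ p-prime k) l<φ)) , p^k∣B̂

    Ψ⇐ : ∀ k t → t < p ^ k → (p ^ suc k) ∣ℚ b t → (p , l₁ + p′ * t) ∈ Ψ (suc k)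
    Ψ⇐ k t t<p^k p^k∣B̂ =
      (p-prime , p-odd) , ∣m∣n⇒∣m+n 2∣l₁ (∣-trans (even-pred (subst (λ p → ¬ 2 ∣ p) p≡ p-odd)) (m∣m*n t)) , ≤-trans 2≤l₁ (m≤m+n l₁ (p′ * t)) , l<φ , p^k∣B̂
      where
      open ≤-Reasoning
      l<φ : l₁ + p′ * t < φ (p ^ suc k)
      l<φ = begin-strict
        l₁ + p′ * t        <⟨ +-monoˡ-< (p′ * t) l₁<p′ ⟩
        p′ + p′ * t        ≡⟨ *-suc p′ t ⟨
        p′ * suc t         ≤⟨ *-monoʳ-≤ p′ t<p^k ⟩
        p′ * p ^ k         ≡⟨ φ-^ p≡ p-prime k ⟨
        φ (p ^ suc k)      ∎

    -- Adding φ(p^(k+1)) to l moves t by p^k, the step at which the model has its slope.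
    Δ≡ : ∀ k t → Δ (suc k) p (l₁ + p′ * t) ≡ difference-residue k t
    Δ≡ k t = difference-residue-≡ k t {B̂ (l₁ + p′ * t + φ (p ^ suc k))} {B̂ (l₁ + p′ * t)} (cong B̂ (begin
      l₁ + p′ * t + φ (p ^ suc k)    ≡⟨ cong (l₁ + p′ * t +_) (φ-^ p≡ p-prime k) ⟩
      l₁ + p′ * t + p′ * p ^ k       ≡⟨ +-assoc l₁ (p′ * t) (p′ * p ^ k) ⟩
      l₁ + (p′ * t + p′ * p ^ k)     ≡⟨ cong (l₁ +_) (*-distribˡ-+ p′ t (p ^ k)) ⟨
      l₁ + p′ * (t + p ^ k)          ∎)) refl
      where open ≡-Reasoning

    module Nonzero (l₁∈Ψ : (p , l₁) ∈ Ψ 1) (Δ≢0 : Δ 1 p l₁ ≢ 0) where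

      private
        l₁+p′*0 : l₁ + p′ * 0 ≡ l₁
        l₁+p′*0 = trans (cong (l₁ +_) (*-zeroʳ p′)) (+-identityʳ l₁)

        abstract

          p∣b₀ : (p ^ 1) ∣ℚ b 0
          p∣b₀ = proj₂ (Ψ⇒ 0 0 (subst (λ l → (p , l) ∈ Ψ 1) (sym l₁+p′*0) l₁∈Ψ))

          δ≢0 : difference-residue 0 0 ≢ 0
          δ≢0 eq = Δ≢0 (trans (cong (Δ 1 p) (sym l₁+p′*0)) (trans (Δ≡ 0 0) eq))

      open Tower p∣b₀ δ≢0

      index : ℕ → ℕ
      index k = l₁ + p′ * τ k

      index-0 : index 0 ≡ l₁
      index-0 = trans (cong (λ t → l₁ + p′ * t) τ-0) l₁+p′*0

      index∈Ψ : ∀ k → (p , index k) ∈ Ψ (suc k)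
      index∈Ψ k = Ψ⇐ k (τ k) (τ<p^ k) (τ-∣ k)

      index-suc : ∀ k → index (suc k) ≡ index k + digit k * φ (p ^ suc k)
      index-suc k = begin
        l₁ + p′ * τ (suc k)                             ≡⟨ cong (λ t → l₁ + p′ * t) (τ-suc k) ⟩
        l₁ + p′ * (τ k + digit k * p ^ k)               ≡⟨ cong (l₁ +_) (*-distribˡ-+ p′ (τ k) (digit k * p ^ k)) ⟩
        l₁ + (p′ * τ k + p′ * (digit k * p ^ k))        ≡⟨ +-assoc l₁ (p′ * τ k) (p′ * (digit k * p ^ k)) ⟨
        index k + p′ * (digit k * p ^ k)                ≡⟨ cong (index k +_) (swap p′ (digit k) (p ^ k)) ⟩
        index k + digit k * (p′ * p ^ k)                ≡⟨ cong (λ x → index k + digit k * x) (φ-^ p≡ p-prime k) ⟨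
        index k + digit k * φ (p ^ suc k)               ∎
        where
        open ≡-Reasoning
        swap : ∀ a b c → a * (b * c) ≡ b * (a * c)
        swap a b c = trans (sym (*-assoc a b c)) (trans (cong (_* c) (*-comm a b)) (*-assoc b a c))

      index-unique : ∀ k l → (p , l) ∈ Ψ (suc k) → Related p 1 l l₁ → l ≡ index k
      index-unique k l l∈Ψ rel = let t , l≡ = related-index l rel
                                     t<p^k , p^k∣b = Ψ⇒ k t (subst (λ l → (p , l) ∈ Ψ (suc k)) l≡ l∈Ψ)
                                 in trans l≡ (cong (λ t → l₁ + p′ * t) (τ-unique k t t<p^k p^k∣b))

      index-Δ : ∀ k → Δ (suc k) p (index k) ≡ Δ (suc (suc k)) p (index (suc k))
      index-Δ k = trans (Δ≡ k (τ k)) (trans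
        (difference-residue-constant {k} {τ k} {suc k} {τ (suc k)} (τ-∣ k) (τ-∣ (suc k))) (sym (Δ≡ (suc k) (τ (suc k)))))

      abstract
        tower : IrregularTower p l₁
        tower = index , digit , index-0 , index-suc , digit<p , index∈Ψ , (λ k → related (τ k)) , index-unique , index-Δ

  module Reduction {p p′} (p≡ : p ≡ suc p′) (p-prime : Prime p) (p-odd : ¬ 2 ∣ p) .{{_ : NonZero p′}} where

    private

      ≡%+* : ∀ l → l ≡ l % p′ + p′ * (l / p′)
      ≡%+* l = trans (m≡m%n+[m/n]*n l p′) (cong (l % p′ +_) (*-comm (l / p′) p′))

      even-% : ∀ l → 2 ∣ l → 2 ∣ l % p′
      even-% l 2∣l = ∣m+n∣n⇒∣m (subst (2 ∣_) (≡%+* l) 2∣l) (∣-trans (even-pred (subst (λ p → ¬ 2 ∣ p) p≡ p-odd)) (m∣m*n (l / p′)))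
        where
        ∣m+n∣n⇒∣m : ∀ {d m n} → d ∣ m + n → d ∣ n → d ∣ m
        ∣m+n∣n⇒∣m {d} {m} {n} d∣m+n d∣n = ∣m+n∣m⇒∣n (subst (d ∣_) (+-comm m n) d∣m+n) d∣n

      p∣p^ : ∀ k → p ^ 1 ∣ p ^ suc k
      p∣p^ k = subst (_∣ p ^ suc k) (sym (*-identityʳ p)) (m∣m*n (p ^ k))

      reduce-admissible : ∀ k l l₁ t → (p ^ suc k) ∣ℚ B̂ l → 2 ≤ l₁ → 2 ∣ l₁ → l₁ < p′ → l ≡ l₁ + p′ * t → (p , l₁) ∈ Ψ 1
      reduce-admissible k l l₁ t p^k∣B̂ 2≤l₁ 2∣l₁ l₁<p′ l≡ = subst (λ l → (p , l) ∈ Ψ 1)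
        (trans (cong (l₁ +_) (*-zeroʳ p′)) (+-identityʳ l₁))
        (Ψ⇐ 0 0 (s≤s z≤n) (∣-unshift 0 0 t (subst (λ t → (p ^ 1) ∣ℚ b t) (sym (*-identityʳ t))
          (∣-trans (p∣p^ k) (subst (λ l → (p ^ suc k) ∣ℚ B̂ l) l≡ p^k∣B̂)))))
        where open Pairs p≡ p-prime p-odd l₁ 2≤l₁ l₁<p′ 2∣l₁ using (b; ∣-unshift; Ψ⇐)

      reduce-index : ∀ k l l₁ t → 0 < l → (p ^ suc k) ∣ℚ B̂ l → 2 ∣ l₁ → l₁ < p′ → l ≡ l₁ + p′ * t → (p , l₁) ∈ Ψ 1
      reduce-index k l zero t 0<l p^k∣B̂ _ _ l≡ = contradiction (∣-trans (p∣p^ k) p^k∣B̂)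
        (∤B̂-exceptional p≡ p-prime p-odd l t 0<l (trans l≡ (*-comm p′ t)))
      reduce-index k l (suc zero) t _ _ 2∣1 _ _ = contradiction (∣⇒≤ 2∣1) λ { (s≤s ()) }
      reduce-index k l l₁@(suc (suc _)) t _ p^k∣B̂ 2∣l₁ l₁<p′ l≡ = reduce-admissible k l l₁ t p^k∣B̂ (s≤s (s≤s z≤n)) 2∣l₁ l₁<p′ l≡

    -- The remainder is even because p′ is. Remainder 0 is ruled out by `∤B̂-exceptional`; any other
    -- one inherits divisibility by p through `∣-unshift`.
    reduce : ∀ k l → (p , l) ∈ Ψ (suc k) → (p , l % p′) ∈ Ψ 1
    reduce k l (_ , 2∣l , 2≤l , l<φ , p^k∣B̂) =
      reduce-index k l (l % p′) (l / p′) (<-≤-trans (s≤s z≤n) 2≤l) p^k∣B̂ (even-% l 2∣l) (m%n<n l p′) (≡%+* l)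

  prime-suc : ∀ {p} → Prime p → p ≡ suc (pred p)
  prime-suc {zero}  p-prime = contradiction p-prime ¬prime[0]
  prime-suc {suc p} p-prime = refl

  φ-p : ∀ {p} → Prime p → φ (p ^ 1) ≡ pred p
  φ-p {p} p-prime = trans (φ-^ (prime-suc p-prime) p-prime 0) (*-identityʳ (pred p))

  irregularTower : ∀ {p l₁} → (p , l₁) ∈ Ψ 1 → Δ 1 p l₁ ≢ 0 → IrregularTower p l₁
  irregularTower {p} {l₁} l₁∈Ψ@((p-prime , p-odd) , 2∣l₁ , 2≤l₁ , l₁<φ , _) Δ≢0 =
    Pairs.Nonzero.tower (prime-suc p-prime) p-prime p-odd l₁ 2≤l₁ (subst (l₁ <_) (φ-p p-prime) l₁<φ) 2∣l₁ l₁∈Ψ Δ≢0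

-- Uniqueness, digits, growth, and the number of irregular pairs.

module Consequences where

  open import Defs
  open IrregularPairs
  open Totient
  open import Data.Bool.Base using (if_then_else_)
  open import Data.Fin.Base using (toℕ)
  import Data.Integer.Base as ℤ
  open import Data.List.Base using ([]; _∷_; map; length; upTo)
  open import Data.List.Membership.Propositional using () renaming (_∈_ to _∈ˡ_)
  open import Data.List.Membership.Propositional.Properties using (∈-filter⁺; ∈-filter⁻; ∈-upTo⁺; ∈-map⁺; ∈-map⁻)
  open import Data.List.Membership.Propositional.Properties.WithK using (unique∧set⇒bag)
  open import Data.List.Properties using (length-map)
  open import Data.List.Relation.Binary.BagAndSetEquality using (∼bag⇒↭)
  open import Data.List.Relation.Binary.Permutation.Propositional.Properties using (↭-length)
  open import Data.List.Relation.Unary.All as All using (All; all?)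
  import Data.List.Relation.Unary.All.Properties as All
  open import Data.List.Relation.Unary.AllPairs using ([]; _∷_)
  open import Data.List.Relation.Unary.Any using (here; there)
  open import Data.List.Relation.Unary.Unique.Propositional using (Unique)
  import Data.List.Relation.Unary.Unique.Propositional.Properties as Unique
  open import Data.Nat.Base
  open import Data.Nat.DivMod using (m<n⇒m%n≡m; m≡m%n+[m/n]*n; [m+kn]%n≡m%n)
  open import Data.Nat.Divisibility
  open import Data.Nat.Primality using (Prime; prime⇒nonTrivial; prime⇒nonZero)
  open import Data.Nat.Properties
  open import Data.Product.Base using (∃; _×_; _,_; proj₁; proj₂)
  open import Data.Product using (∃!)
  import Data.Rational.Base as ℚ
  open import Data.Sum.Base using (_⊎_; inj₁; inj₂)
  open import Function.Bundles using (mk⇔)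
  open import Relation.Binary.PropositionalEquality
  open import Relation.Nullary.Decidable using (Dec; does; yes; ¬?)
  open import Relation.Nullary.Negation using (¬_; contradiction)
  open import Relation.Unary using (_∈_)
  import Algebra.Properties.Monoid.Sum +-0-monoid as ℕSum

  -- Finite sums are built from the front, whereas a p-adic expansion grows at its end.
  sum-last : ∀ n (f : ℕ → ℕ) → ℕSum.sum {suc n} (λ j → f (toℕ j)) ≡ ℕSum.sum {n} (λ j → f (toℕ j)) + f n
  sum-last zero    f = +-comm (f 0) 0
  sum-last (suc n) f = trans (cong (f 0 +_) (sum-last n λ j → f (suc j))) (sym (+-assoc (f 0) _ (f (suc n))))

  fromDigits-suc : ∀ p (s : ℕ → ℕ) n →
                   fromDigits p (prefix s (suc n)) ≡ fromDigits p (prefix s n) + s (suc n) * φ (p ^ n)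
  fromDigits-suc p s n = sum-last n λ j → s (suc j) * φ (p ^ j)

  fromDigits-1 : ∀ p (s : ℕ → ℕ) → fromDigits p (prefix s 1) ≡ s 1
  fromDigits-1 p s = trans (+-identityʳ _) (*-identityʳ (s 1))

  bounded : ∀ (f : ℕ → ℕ) M → ∃ λ B → ∀ j → j < M → f j ≤ B
  bounded f zero    = 0 , λ _ ()
  bounded f (suc M) =
    let B , f≤B = bounded f M
    in f M + B , λ j j<1+M → case j (m≤n⇒m<n∨m≡n (≤-pred j<1+M)) (f≤B j)
    where
    case : ∀ {B} j → (j < M) ⊎ (j ≡ M) → (j < M → f j ≤ B) → f j ≤ f M + B
    case j (inj₁ j<M)  f≤B = ≤-trans (f≤B j<M) (m≤n+m _ (f M))
    case j (inj₂ refl) f≤B = m≤m+n (f M) _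

  n<p^n : ∀ p → 2 ≤ p → ∀ n → n < p ^ n
  n<p^n p 2≤p zero    = s≤s z≤n
  n<p^n p 2≤p (suc n) = begin
    2 + n              ≤⟨ s≤s (n<p^n p 2≤p n) ⟩
    1 + p ^ n          ≤⟨ +-monoˡ-≤ (p ^ n) (≤-trans (s≤s z≤n) (n<p^n p 2≤p n)) ⟩
    p ^ n + p ^ n      ≡⟨ cong (p ^ n +_) (+-identityʳ (p ^ n)) ⟨
    2 * p ^ n          ≤⟨ *-monoˡ-≤ (p ^ n) 2≤p ⟩
    p * p ^ n          ∎
    where open ≤-Reasoning

  -- A nonzero rational number is divisible by only finitely many powers of p.
  irregular-unbounded : ∀ p (l : ℕ → ℕ) → (∀ n → 1 ≤ n → (p , l n) ∈ Ψ n) → TendsToInfinity l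
  irregular-unbounded p l l∈Ψ M = suc B , λ n B<n → ≮⇒≥ λ l<M → absurd n B<n l<M (l∈Ψ n (≤-trans (s≤s z≤n) B<n))
    where
    B = proj₁ (bounded (λ j → ℤ.∣ ℚ.↥ (B̂ j) ∣) M)
    absurd : ∀ n → suc B ≤ n → l n < M → ¬ (p , l n) ∈ Ψ n
    absurd n B<n l<M ((p-prime , _) , 2∣l , 2≤l , _ , p^n∣B̂) = <-irrefl refl (begin-strict
      n                          <⟨ n<p^n p (nonTrivial⇒n>1 p {{prime⇒nonTrivial p-prime}}) n ⟩
      p ^ n                      ≤⟨ ∣⇒≤ {{B̂-nonzero (l n) (<-≤-trans (s≤s z≤n) 2≤l) 2∣l}} p^n∣B̂ ⟩
      ℤ.∣ ℚ.↥ (B̂ (l n)) ∣        ≤⟨ proj₂ (bounded (λ j → ℤ.∣ ℚ.↥ (B̂ j) ∣) M) (l n) l<M ⟩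
      B                          <⟨ B<n ⟩
      n                          ∎)
      where open ≤-Reasoning

  -- The only value between p - 3 and p - 1 is p - 2, which is odd.
  even-gap : ∀ {p l} → Prime p → ¬ 2 ∣ p → 2 ∣ l → l < pred p → l ≤ p ∸ 3
  even-gap {p} {l} p-prime p-odd 2∣l l<p′ with m≤n⇒m<n∨m≡n l<p′
  ... | inj₁ 1+l<p′ = subst (l ≤_) p∸3 (∸-monoˡ-≤ 2 1+l<p′)
    where
    p∸3 : pred p ∸ 2 ≡ p ∸ 3
    p∸3 = cong (_∸ 3) (sym (prime-suc p-prime))
  ... | inj₂ 1+l≡p′ = contradiction (∣m+n∣m⇒∣n {2} {l} {1} (subst (2 ∣_) (trans (sym 1+l≡p′) (+-comm 1 l)) 2∣p′) 2∣l) λ 2∣1 → <⇒≱ (s≤s (s≤s z≤n)) (∣⇒≤ 2∣1)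
    where
    2∣p′ : 2 ∣ pred p
    2∣p′ = even-pred (subst (λ p → ¬ 2 ∣ p) (prime-suc p-prime) p-odd)

  Unique-map : ∀ (g : ℕ → ℕ) {xs} → (∀ {x y} → x ∈ˡ xs → y ∈ˡ xs → g x ≡ g y → x ≡ y) → Unique xs → Unique (map g xs)
  Unique-map g inj []         = []
  Unique-map g inj (x≢ ∷ xs!) =
    All.map⁺ (All.tabulate λ y∈ gx≡gy → All.lookup x≢ y∈ (inj (here refl) (there y∈) gx≡gy)) ∷
    Unique-map g (λ x∈ y∈ → inj (there x∈) (there y∈)) xs!

  -- Lists without repetition that have the same members are permutations of each other.
  length-≡ : ∀ (g : ℕ → ℕ) {xs ys} → Unique xs → Unique ys →
             (∀ {x} → x ∈ˡ xs → g x ∈ˡ ys) →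
             (∀ {x y} → x ∈ˡ xs → y ∈ˡ xs → g x ≡ g y → x ≡ y) →
             (∀ {y} → y ∈ˡ ys → ∃ λ x → x ∈ˡ xs × g x ≡ y) →
             length xs ≡ length ys
  length-≡ g {xs} {ys} xs! ys! maps inj surj = trans (sym (length-map g xs)) (↭-length (∼bag⇒↭
    (unique∧set⇒bag (Unique-map g inj xs!) ys! (mk⇔ to from))))
    where
    to : ∀ {y} → y ∈ˡ map g xs → y ∈ˡ ys
    to y∈ = let x , x∈ , y≡ = ∈-map⁻ g y∈ in subst (_∈ˡ ys) (sym y≡) (maps x∈)
    from : ∀ {y} → y ∈ˡ ys → y ∈ˡ map g xs
    from y∈ = let x , x∈ , gx≡y = surj y∈ in subst (_∈ˡ map g xs) gx≡y (∈-map⁺ g x∈)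

  Conclusion : (p l₁ : ℕ) → Set
  Conclusion p l₁ =
    (∀ n → 1 < n → ∃! _≡_ λ lₙ → (p , lₙ) ∈ Ψ n × Related p 1 lₙ l₁)
    × ∃! _≈_ (IrregularSeq p l₁)
    × ∃! _≈_ (IrregularDigits p l₁)
    × (∀ l → l ∈ IrregularSeq p l₁ →
        (∀ n → 1 ≤ n → l n ≤ l (suc n))
        × TendsToInfinity l
        × (∀ n → 1 ≤ n → Δ n p (l n) ≡ Δ (suc n) p (l (suc n))))

  module _ {p l₁ : ℕ} (l₁∈Ψ : (p , l₁) ∈ Ψ 1) where

    conclusion : IrregularTower p l₁ → Conclusion p l₁
    conclusion (index , digit , index-0 , index-suc , digit<p , index∈Ψ , index-related , index-unique , index-Δ) =
      unique-index , unique-sequence , unique-digits , λ l l-seq → monotone l l-seq , irregular-unbounded p l (proj₁ (proj₂ l-seq)) , constant l l-seq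
      where
      p-prime = proj₁ (proj₁ l₁∈Ψ)
      p-odd = proj₂ (proj₁ l₁∈Ψ)
      2∣l₁ = proj₁ (proj₂ l₁∈Ψ)
      2≤l₁ = proj₁ (proj₂ (proj₂ l₁∈Ψ))

      l₁<p′ : l₁ < pred p
      l₁<p′ = subst (l₁ <_) (φ-p p-prime) (proj₁ (proj₂ (proj₂ (proj₂ l₁∈Ψ))))

      unique-index : ∀ n → 1 < n → ∃! _≡_ λ lₙ → (p , lₙ) ∈ Ψ n × Related p 1 lₙ l₁
      unique-index (suc k) _ = index k , (index∈Ψ k , index-related k) , λ {l} (l∈Ψ , rel) → sym (index-unique k l l∈Ψ rel)

      sequence : ℕ → ℕ
      sequence zero    = 0
      sequence (suc k) = index k

      sequence-unique : ∀ l → l ∈ IrregularSeq p l₁ → ∀ k → l (suc k) ≡ index k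
      sequence-unique l (l1≡ , l∈Ψ , rel) zero    = trans l1≡ (sym index-0)
      sequence-unique l (l1≡ , l∈Ψ , rel) (suc k) =
        index-unique (suc k) (l (2 + k)) (l∈Ψ (2 + k) (s≤s z≤n)) (rel (2 + k) (s≤s (s≤s z≤n)))

      unique-sequence : ∃! _≈_ (IrregularSeq p l₁)
      unique-sequence = sequence ,
        (index-0 , (λ { (suc k) _ → index∈Ψ k }) , (λ { (suc k) _ → index-related k })) ,
        λ {l} l-seq → λ { (suc k) _ → sym (sequence-unique l l-seq k) }

      digits : ℕ → ℕ
      digits zero          = 0
      digits (suc zero)    = l₁
      digits (suc (suc k)) = digit k

      fromDigits-digits : ∀ k → fromDigits p (prefix digits (suc k)) ≡ index k
      fromDigits-digits zero    = trans (fromDigits-1 p digits) (sym index-0)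
      fromDigits-digits (suc k) = trans (fromDigits-suc p digits (suc k))
        (trans (cong (_+ digit k * φ (p ^ suc k)) (fromDigits-digits k)) (sym (index-suc k)))

      digits<p : ∀ j → digits (suc j) < p
      digits<p zero    = <-≤-trans l₁<p′ pred[n]≤n
      digits<p (suc k) = digit<p k

      digits∈Ψ̂ : ∀ n → 1 ≤ n → (p , prefix digits n) ∈ Ψ̂ n
      digits∈Ψ̂ (suc k) _ = (λ ν → digits<p (toℕ ν)) , (2∣l₁ , 2≤l₁ , even-gap p-prime p-odd 2∣l₁ l₁<p′) ,
        subst (λ l → (p , l) ∈ Ψ (suc k)) (sym (fromDigits-digits k)) (index∈Ψ k)

      φ-nonzero : ∀ k → NonZero (φ (p ^ suc k))
      φ-nonzero k = subst NonZero (sym (φ-^ (prime-suc p-prime) p-prime k))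
        (m*n≢0 (pred p) (p ^ k) {{>-nonZero (≤-<-trans z≤n l₁<p′)}} {{m^n≢0 p k {{prime⇒nonZero p-prime}}}})

      fromDigits-unique : ∀ s → s ∈ IrregularDigits p l₁ → ∀ k → fromDigits p (prefix s (suc k)) ≡ index k
      fromDigits-unique s (s1≡ , _ , _)     zero    = trans (fromDigits-1 p s) (trans s1≡ (sym index-0))
      fromDigits-unique s (s1≡ , s∈Ψ̂ , rel) (suc k) =
        index-unique (suc k) (fromDigits p (prefix s (2 + k))) (proj₂ (proj₂ (s∈Ψ̂ (2 + k) (s≤s z≤n)))) (rel (2 + k) (s≤s (s≤s z≤n)))

      -- The partial sums of an admissible digit sequence are irregular indices related to l₁, hence
      -- the entries of the tower. Consecutive entries differ by the digit times φ(p^(k+1)) ≠ 0,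
      -- which recovers the digit.
      digits-unique : ∀ s → s ∈ IrregularDigits p l₁ → ∀ j → digits (suc j) ≡ s (suc j)
      digits-unique s s-digits zero    = sym (proj₁ s-digits)
      digits-unique s s-digits (suc k) = *-cancelʳ-≡ (digit k) (s (2 + k)) (φ (p ^ suc k)) {{φ-nonzero k}}
        (+-cancelˡ-≡ (index k) _ _ (begin
          index k + digit k * φ (p ^ suc k)                                ≡⟨ index-suc k ⟨
          index (suc k)                                                    ≡⟨ fromDigits-unique s s-digits (suc k) ⟨
          fromDigits p (prefix s (2 + k))                                  ≡⟨ fromDigits-suc p s (suc k) ⟩
          fromDigits p (prefix s (suc k)) + s (2 + k) * φ (p ^ suc k)      ≡⟨ cong (_+ s (2 + k) * φ (p ^ suc k)) (fromDigits-unique s s-digits k) ⟩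
          index k + s (2 + k) * φ (p ^ suc k)                              ∎))
        where open ≡-Reasoning

      unique-digits : ∃! _≈_ (IrregularDigits p l₁)
      unique-digits = digits ,
        (refl , digits∈Ψ̂ , (λ { (suc k) _ → subst (λ l → Related p 1 l l₁) (sym (fromDigits-digits k)) (index-related k) })) ,
        λ {s} s-digits → λ { (suc j) _ → digits-unique s s-digits j }

      monotone : ∀ l → l ∈ IrregularSeq p l₁ → ∀ n → 1 ≤ n → l n ≤ l (suc n)
      monotone l l-seq (suc k) _ = subst₂ _≤_ (sym (sequence-unique l l-seq k)) (sym (sequence-unique l l-seq (suc k)))
        (subst (index k ≤_) (sym (index-suc k)) (m≤m+n (index k) _))

      constant : ∀ l → l ∈ IrregularSeq p l₁ → ∀ n → 1 ≤ n → Δ n p (l n) ≡ Δ (suc n) p (l (suc n))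
      constant l l-seq (suc k) _ = subst₂ (λ x y → Δ (suc k) p x ≡ Δ (suc (suc k)) p y)
        (sym (sequence-unique l l-seq k)) (sym (sequence-unique l l-seq (suc k))) (index-Δ k)

  if-true : ∀ {P : Set} (P? : Dec P) → (if does P? then 1 else 0) ≡ 1 → P
  if-true (yes Px) _ = Px

  module _ (p : ℕ) (p-prime : Prime p) (p-odd : ¬ 2 ∣ p) (Δₚ≡1 : Δₚ p ≡ 1) where

    private
      p′ = pred p

      ∈-indices⁺ : ∀ n l → (p , l) ∈ Ψ n → l ∈ˡ irregularIndices n p
      ∈-indices⁺ n l ψ@(_ , _ , _ , l<φ , _) = ∈-filter⁺ (λ l → Ψ? n (p , l)) (∈-upTo⁺ l<φ) ψ

      ∈-indices⁻ : ∀ n l → l ∈ˡ irregularIndices n p → (p , l) ∈ Ψ n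
      ∈-indices⁻ n l l∈ = proj₂ (∈-filter⁻ (λ l → Ψ? n (p , l)) {xs = upTo (φ (p ^ n))} l∈)

      indices! : ∀ n → Unique (irregularIndices n p)
      indices! n = Unique.filter⁺ (λ l → Ψ? n (p , l)) (Unique.upTo⁺ (φ (p ^ n)))

      tower : ∀ l → (p , l) ∈ Ψ 1 → IrregularTower p l
      tower l l∈Ψ = irregularTower {p} {l} l∈Ψ
        (All.lookup (if-true (all? (λ l → ¬? (Δ 1 p l ≟ 0)) (irregularIndices 1 p)) Δₚ≡1) (∈-indices⁺ 1 l l∈Ψ))

      instance
        p′≢0 : NonZero p′
        p′≢0 = >-nonZero (≤-pred (subst (2 ≤_) (prime-suc p-prime) (nonTrivial⇒n>1 p {{prime⇒nonTrivial p-prime}})))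

      related-% : ∀ l → Related p 1 l (l % p′)
      related-% l = subst₂ _∣_ (sym (φ-p p-prime))
        (sym (trans (cong (∣_- l % p′ ∣) (m≡m%n+[m/n]*n l p′)) (trans (∣-∣-comm (l % p′ + l / p′ * p′) (l % p′)) (∣m-m+n∣≡n (l % p′) (l / p′ * p′)))))
        (n∣m*n (l / p′))

      -- The bound l₁ ≤ l gives the unsigned distance its sign.
      %-related : ∀ l l₁ → l₁ < p′ → l₁ ≤ l → Related p 1 l l₁ → l % p′ ≡ l₁
      %-related l l₁ l₁<p′ l₁≤l related = let divides q eq = subst (_∣ ∣ l - l₁ ∣) (φ-p p-prime) related in begin
        l % p′                    ≡⟨ cong (_% p′) (m+[n∸m]≡n l₁≤l) ⟨
        (l₁ + (l ∸ l₁)) % p′      ≡⟨ cong (λ x → (l₁ + x) % p′) (trans (sym (m≤n⇒∣n-m∣≡n∸m l₁≤l)) eq) ⟩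
        (l₁ + q * p′) % p′        ≡⟨ [m+kn]%n≡m%n l₁ q p′ ⟩
        l₁ % p′                   ≡⟨ m<n⇒m%n≡m l₁<p′ ⟩
        l₁                        ∎
        where open ≡-Reasoning

      reduce-index : ∀ k l → (p , l) ∈ Ψ (suc k) → (p , l % p′) ∈ Ψ 1
      reduce-index k l = Reduction.reduce (prime-suc p-prime) p-prime p-odd k l

      injective : ∀ k l l′ → (p , l) ∈ Ψ (suc k) → (p , l′) ∈ Ψ (suc k) → l % p′ ≡ l′ % p′ → l ≡ l′
      injective k l l′ l∈Ψ l′∈Ψ eq =
        let index , _ , _ , _ , _ , _ , _ , index-unique , _ = tower (l % p′) (reduce-index k l l∈Ψ)
        in trans (index-unique k l l∈Ψ (related-% l)) (sym (index-unique k l′ l′∈Ψ (subst (Related p 1 l′) (sym eq) (related-% l′))))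

      surjective : ∀ k l₁ → (p , l₁) ∈ Ψ 1 → ∃ λ l → (p , l) ∈ Ψ (suc k) × l % p′ ≡ l₁
      surjective k l₁ l₁∈Ψ@(_ , _ , _ , l₁<φ , _) =
        let index , _ , index-0 , index-suc , _ , index∈Ψ , index-related , _ = tower l₁ l₁∈Ψ
            l₁≤index : ∀ k → l₁ ≤ index k
            l₁≤index = λ k → above index index-0 (λ k → subst (index k ≤_) (sym (index-suc k)) (m≤m+n (index k) _)) k
        in index k , index∈Ψ k , %-related (index k) l₁ (subst (l₁ <_) (φ-p p-prime) l₁<φ) (l₁≤index k) (index-related k)
        where
        above : ∀ (f : ℕ → ℕ) → f 0 ≡ l₁ → (∀ k → f k ≤ f (suc k)) → ∀ k → l₁ ≤ f k
        above f f0≡ mono zero    = ≤-reflexive (sym f0≡)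
        above f f0≡ mono (suc k) = ≤-trans (above f f0≡ mono k) (mono k)

    -- Reduction modulo p - 1 is a bijection onto the pairs of order one. Each of these carries a
    -- tower because Δ(p) = 1; uniqueness in the tower gives injectivity, existence surjectivity.
    i-constant : ∀ k → i (suc k) p ≡ i 1 p
    i-constant k = length-≡ (_% p′) (indices! (suc k)) (indices! 1)
      (λ {l} l∈ → ∈-indices⁺ 1 (l % p′) (reduce-index k l (∈-indices⁻ (suc k) l l∈)))
      (λ {l} {l′} l∈ l′∈ → injective k l l′ (∈-indices⁻ (suc k) l l∈) (∈-indices⁻ (suc k) l′ l′∈))
      (λ {l₁} l₁∈ → let l , l∈Ψ , eq = surjective k l₁ (∈-indices⁻ 1 l₁ l₁∈) in l , ∈-indices⁺ (suc k) l l∈Ψ , eq)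

  irregular-pairs-of-higher-order : ∀ p l₁ → (p , l₁) ∈ Ψ 1 → Δ 1 p l₁ ≢ 0 → Conclusion p l₁
  irregular-pairs-of-higher-order p l₁ l₁∈Ψ Δ≢0 = conclusion {p} {l₁} l₁∈Ψ (irregularTower {p} {l₁} l₁∈Ψ Δ≢0)

  number-of-irregular-pairs-constant : ∀ p → Irregular p → Δₚ p ≡ 1 → ∀ n → 1 ≤ n → i n p ≡ i (suc n) p
  number-of-irregular-pairs-constant p ((p-prime , p-odd) , _) Δₚ≡1 (suc k) _ =
    trans (i-constant p p-prime p-odd Δₚ≡1 k) (sym (i-constant p p-prime p-odd Δₚ≡1 (suc k)))

open import Defs
open import Data.Nat.Base using (ℕ; suc; _≤_; _<_)
open import Data.Product using (_×_; _,_; ∃!)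
open import Relation.Binary.PropositionalEquality using (_≡_; _≢_)
open import Relation.Unary using (_∈_)
open Consequences

theorem3p1 : (∀ p l₁ → (p , l₁) ∈ Ψ 1 → Δ 1 p l₁ ≢ 0 →
    (∀ n → 1 < n → ∃! _≡_ λ lₙ → (p , lₙ) ∈ Ψ n × Related p 1 lₙ l₁)
    × ∃! _≈_ (IrregularSeq p l₁)
    × ∃! _≈_ (IrregularDigits p l₁)
    × (∀ l → l ∈ IrregularSeq p l₁ →
    (∀ n → 1 ≤ n → l n ≤ l (suc n))
    × TendsToInfinity l
    × (∀ n → 1 ≤ n → Δ n p (l n) ≡ Δ (suc n) p (l (suc n)))))
    × (∀ p → Irregular p → Δₚ p ≡ 1 → ∀ n → 1 ≤ n → i n p ≡ i (suc n) p)
theorem3p1 = irregular-pairs-of-higher-order , number-of-irregular-pairs-constant
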